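{- Let $q\ge 6$ be a prime power and let $\bar{\mathcal C}$ be an $\mathbb F_q$-conic in an $\mathbb F_q$-subplane $\bar\pi$ of $\mathrm{PG}(2,q^3)$ that is tangent to $\ell_\infty$. Then in the exact-at-infinity Bruck-Bose representation in $\mathrm{PG}(6,q)$, the points of $[\mathcal C]$ form either a 6-dimensional normal rational curve $\mathcal N_6$, or a 4-dimensional normal rational curve $\mathcal N_4$ and a spread plane.
   Context: **$\mathbb F_q$-conics.** An $\mathbb F_q$-subplane of $\mathrm{PG}(2,q^3)$ is a subplane of order $q$; it is secant, tangent or exterior to a line if it meets it in $q+1$, $1$ or $0$ points. An $\mathbb F_q$-conic is a non-degenerate conic of an $\mathbb F_q$-subplane. A line $\ell_\infty$ of $\mathrm{PG}(2,q^3)$ is fixed as line at infinity. **Normal rational curves.** An $r$-dimensional normal rational curve in $\mathrm{PG}(n,q)$ is a set of points lying in an $r$-space and projectively equivalent to $\{(1,\theta,\dots,\theta^r):\theta\in\mathbb F_q\}\cup\{(0,\dots,0,1)\}$. **Regular 2-spread.** $X^q$ is obtained from $X$ by raising coordinates to the $q$-th power. A regular 2-spread $\mathcal S$ of $\Sigma_\infty\cong\mathrm{PG}(5,q)$ is obtained from a line $g$ of $\mathrm{PG}(5,q^3)$ disjoint from $\Sigma_\infty$ such that $g,g^q,g^{q^2}$ span $\mathrm{PG}(5,q^3)$: its elements (spread planes) are the planes $\langle X,X^q,X^{q^2}\rangle\cap\Sigma_\infty$, $X\in g$. **Exact-at-infinity Bruck-Bose representation.** Let $\Sigma_\infty$ be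 a hyperplane of $\mathrm{PG}(6,q)$ and $\mathcal S$ a regular 2-spread of $\Sigma_\infty$. The incidence structure whose points are the points of $\mathrm{PG}(6,q)\setminus\Sigma_\infty$ and the planes of $\mathcal S$; whose lines are the 3-spaces of $\mathrm{PG}(6,q)$ not contained in $\Sigma_\infty$ that contain a plane of $\mathcal S$, together with the line at infinity $\ell_\infty$ (the set of planes of $\mathcal S$); with incidence induced by $\mathrm{PG}(6,q)$, is isomorphic to $\mathrm{PG}(2,q^3)$. Write $[X]$ for the element representing the point $\bar X$ of $\mathrm{PG}(2,q^3)$: a point of $\mathrm{PG}(6,q)\setminus\Sigma_\infty$ if $\bar X\notin\ell_\infty$, a plane of $\mathcal S$ if $\bar X\in\ell_\infty$. In the exact-at-infinity representation, $[\mathcal C]$ is the set of all points of $\mathrm{PG}(6,q)$ lying in the $[X]$, $\bar X\in\bar{\mathcal C}$ (so whole spread planes are included for points of $\bar{\mathcal C}$ on $\ell_\infty$). -}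

module Defs where

open import Algebra.Bundles using (CommutativeRing; Semiring)
open import Algebra.Structures using (IsCommutativeRing)
open import Algebra.Morphism.Structures using (IsRingHomomorphism)
import Algebra.Definitions.RawSemiring as RawSemiringDefinitions
open import Data.Empty using (⊥)
open import Data.Fin using (Fin; toℕ)
open import Data.Nat using (ℕ; suc; _^_)
open import Data.Nat.Primality using (Prime)
open import Data.Product using (∃; _×_; _,_; proj₁; proj₂)
open import Data.Unit using (⊤)
open import Data.Vec using (Vec; []; _∷_; map; zipWith; foldr′; replicate; _++_; _∷ʳ_; tabulate)
open import Data.Vec.Properties using (map-id; map-cong; map-∘)
open import Function.Bundles using (_↔_; _⇔_; Bijection)
open import Level using (0ℓ)
open import Relation.Binary.Bundles using (Setoid)
open import Relation.Binary.Definitions using (_Respects_)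
open import Relation.Binary.Structures using (IsEquivalence)
open import Relation.Binary.PropositionalEquality
  using (_≡_; _≢_; refl; sym; trans; cong; module ≡-Reasoning)
import Relation.Binary.PropositionalEquality as ≡
import Relation.Binary.Construct.On as On
open import Relation.Nullary using (¬_)
open import Relation.Unary using (Pred; U; _⊆_; _≐_)

PrimePower : ℕ → Set
PrimePower q = ∃ λ p → ∃ λ k → Prime p × q ≡ p ^ suc k

record FiniteField (q : ℕ) : Set₁ where
  infixl 6 _+_
  infixl 7 _*_
  field
    Carrier           : Set
    _+_ _*_           : Carrier → Carrier → Carrier
    -_                : Carrier → Carrier
    0# 1#             : Carrier
    isCommutativeRing : IsCommutativeRing _≡_ _+_ _*_ -_ 0# 1#
    0≢1               : 0# ≢ 1#
    invertible        : ∀ x → x ≢ 0# → ∃ λ y → y * x ≡ 1#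
    enumeration       : Carrier ↔ Fin q

  commutativeRing : CommutativeRing 0ℓ 0ℓ
  commutativeRing = record { isCommutativeRing = isCommutativeRing }

  open CommutativeRing commutativeRing public
    using (rawRing; semiring; *-assoc; *-identityˡ; zeroˡ; zeroʳ)

  open RawSemiringDefinitions (Semiring.rawSemiring semiring) public
    using () renaming (_^_ to _^ᶠ_)

-- The degree 3 is forced by the cardinalities.
record CubicExtension (q : ℕ) : Set₁ where
  field
    F                 : FiniteField q
    K                 : FiniteField (q ^ 3)
    embed             : FiniteField.Carrier F → FiniteField.Carrier K
    isRingHomomorphism :
      IsRingHomomorphism (FiniteField.rawRing F) (FiniteField.rawRing K) embed

module _ {q : ℕ} (F : FiniteField q) where
  open FiniteField F

  Vector : ℕ → Set
  Vector n = Vec Carrier n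

  0ᵛ : ∀ {n} → Vector n
  0ᵛ = replicate _ 0#

  scale : ∀ {n} → Carrier → Vector n → Vector n
  scale c = map (c *_)

  dot : ∀ {n} → Vector n → Vector n → Carrier
  dot u v = foldr′ _+_ 0# (zipWith _*_ u v)

  combination : ∀ {n k} → Vector k → Vec (Vector n) k → Vector n
  combination []       []       = 0ᵛ
  combination (c ∷ cs) (v ∷ vs) = zipWith _+_ (scale c v) (combination cs vs)

  Span : ∀ {n k} → Vec (Vector n) k → Pred (Vector n) 0ℓ
  Span vs v = ∃ λ cs → combination cs vs ≡ v

  LinearlyIndependent : ∀ {n k} → Vec (Vector n) k → Set
  LinearlyIndependent vs = ∀ cs → combination cs vs ≡ 0ᵛ → cs ≡ 0ᵛ

  record Point (n : ℕ) : Set where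
    constructor point
    field
      coords  : Vector (suc n)
      nonzero : coords ≢ 0ᵛ

  open Point

  infix 4 _~_
  _~_ : ∀ {n} → Vector n → Vector n → Set
  u ~ v = ∃ λ c → c ≢ 0# × u ≡ scale c v

  private
    scale-1 : ∀ {n} (v : Vector n) → scale 1# v ≡ v
    scale-1 v = trans (map-cong *-identityˡ v) (map-id v)

    scale-* : ∀ {n} a b (v : Vector n) → scale (a * b) v ≡ scale a (scale b v)
    scale-* a b v = trans (map-cong (*-assoc a b) v) (map-∘ (a *_) (b *_) v)

    1≢0 : 1# ≢ 0#
    1≢0 e = 0≢1 (sym e)

    ~-sym : ∀ {n} {u v : Vector n} → u ~ v → v ~ u
    ~-sym {v = v} (c , c≢0 , refl) with invertible c c≢0
    ... | d , dc≡1 = d , d≢0 , sym (trans (sym (scale-* d c v)) (trans (cong (λ e → scale e v) dc≡1) (scale-1 v)))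
      where
      d≢0 : d ≢ 0#
      d≢0 refl = 0≢1 (trans (sym (zeroˡ c)) dc≡1)

    ~-trans : ∀ {n} {u v w : Vector n} → u ~ v → v ~ w → u ~ w
    ~-trans {w = w} (a , a≢0 , refl) (b , b≢0 , refl) = a * b , ab≢0 , sym (scale-* a b w)
      where
      ab≢0 : a * b ≢ 0#
      ab≢0 ab≡0 with invertible a a≢0
      ... | d , da≡1 = b≢0 (begin
        b            ≡⟨ sym (*-identityˡ b) ⟩
        1# * b       ≡⟨ cong (_* b) (sym da≡1) ⟩
        (d * a) * b  ≡⟨ *-assoc d a b ⟩
        d * (a * b)  ≡⟨ cong (d *_) ab≡0 ⟩
        d * 0#       ≡⟨ zeroʳ d ⟩
        0#           ∎)
        where open ≡-Reasoning

  pointSetoid : ℕ → Setoid 0ℓ 0ℓ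
  pointSetoid n = record
    { Carrier       = Point n
    ; _≈_           = λ P Q → coords P ~ coords Q
    ; isEquivalence = record
      { refl  = λ {P} → 1# , 1≢0 , sym (scale-1 (coords P))
      ; sym   = ~-sym
      ; trans = ~-trans
      }
    }

  -- A subspace of PG(n,F) of projective dimension r.
  record Flat (n r : ℕ) : Set where
    field
      basis       : Vec (Vector (suc n)) (suc r)
      independent : LinearlyIndependent basis

  open Flat

  points : ∀ {n r} → Flat n r → Pred (Point n) 0ℓ
  points W P = Span (basis W) (coords P)

  -- A hyperplane is given by its dual homogeneous coordinates.
  onHyperplane : ∀ {n} → Point n → Pred (Point n) 0ℓ
  onHyperplane H P = dot (coords H) (coords P) ≡ 0#

  data StandardNRC (r : ℕ) : Pred (Vector (suc r)) 0ℓ where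
    finite   : ∀ θ → StandardNRC r (tabulate (λ i → θ ^ᶠ toℕ i))
    infinite : StandardNRC r (replicate r 0# ∷ʳ 1#)

  -- The basis of W is the matrix of a projectivity from PG(r,F) onto W.
  IsNormalRationalCurve : ∀ {n} → ℕ → Pred (Point n) 0ℓ → Set
  IsNormalRationalCurve {n} r N =
    ∃ λ (W : Flat n r) →
      N ≐ λ P → ∃ λ x → StandardNRC r x × coords P ~ combination x (basis W)

  -- a x² + b y² + c z² + f y z + g z x + h x y
  record TernaryQuadraticForm : Set where
    field
      a b c f g h : Carrier

    value : Vector 3 → Carrier
    value (x ∷ y ∷ z ∷ []) =
      a * x * x + b * y * y + c * z * z + f * y * z + g * z * x + h * x * y

    gradient : Vector 3 → Vector 3
    gradient (x ∷ y ∷ z ∷ []) =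
      ((a + a) * x + h * y + g * z) ∷
      (h * x + (b + b) * y + f * z) ∷
      (g * x + f * y + (c + c) * z) ∷ []

    zeros : Pred (Point 2) 0ℓ
    zeros P = value (coords P) ≡ 0#

    -- In characteristic 2 a vanishing gradient does not force the form itself
    -- to vanish, so both conditions are needed for a singular point; and over
    -- a perfect field a degenerate form has a rational singular point.
    NonDegenerate : Set
    NonDegenerate = ∀ (P : Point 2) → ¬ (zeros P × gradient (coords P) ≡ 0ᵛ)

record IncidenceStructure : Set₁ where
  infix 4 _I_
  field
    Points Lines : Setoid 0ℓ 0ℓ
    _I_          : Setoid.Carrier Points → Setoid.Carrier Lines → Set

  open Setoid Points public renaming (Carrier to Pt; _≈_ to _≈ₚ_) using ()
  open Setoid Lines public renaming (Carrier to Ln; _≈_ to _≈ₗ_) using ()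

record Isomorphism (𝓐 𝓑 : IncidenceStructure) : Set where
  private
    module A = IncidenceStructure 𝓐
    module B = IncidenceStructure 𝓑
  field
    onPoints : Bijection A.Points B.Points
    onLines  : Bijection A.Lines B.Lines

  point↦ : A.Pt → B.Pt
  point↦ = Bijection.to onPoints

  line↦ : A.Ln → B.Ln
  line↦ = Bijection.to onLines

  field
    incidence : ∀ P ℓ → (P A.I ℓ) ⇔ (point↦ P B.I line↦ ℓ)

module _ (𝓐 : IncidenceStructure) where
  open IncidenceStructure 𝓐

  MeetsIn : ℕ → Pred Pt 0ℓ → Ln → Set
  MeetsIn k B ℓ =
    Bijection (≡.setoid (Fin k)) (On.setoid Points (proj₁ {B = λ P → B P × P I ℓ}))

  record IsProjectivePlane : Set where
    field
      join : ∀ P Q → ¬ P ≈ₚ Q →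
             ∃ λ ℓ → P I ℓ × Q I ℓ × (∀ m → P I m → Q I m → m ≈ₗ ℓ)
      meet : ∀ ℓ m → ¬ ℓ ≈ₗ m →
             ∃ λ P → P I ℓ × P I m × (∀ Q → Q I ℓ → Q I m → Q ≈ₚ P)
      quadrangle : ∃ λ (A : Fin 4 → Pt) → ∀ i j k → i ≢ j → j ≢ k → i ≢ k →
             ∀ ℓ → ¬ (A i I ℓ × A j I ℓ × A k I ℓ)

  HasOrder : ℕ → Set
  HasOrder n = ∀ ℓ → MeetsIn (suc n) U ℓ

module _ (𝓐 : IncidenceStructure) where
  open IncidenceStructure 𝓐

  restrict : Pred Pt 0ℓ → Pred Ln 0ℓ → IncidenceStructure
  restrict B M = record
    { Points = On.setoid Points (proj₁ {B = B})
    ; Lines  = On.setoid Lines (proj₁ {B = M})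
    ; _I_    = λ P ℓ → proj₁ P I proj₁ ℓ
    }

  record Subplane (n : ℕ) : Set₁ where
    field
      inPlane       : Pred Pt 0ℓ
      isLine        : Pred Ln 0ℓ
      inPlane-resp  : inPlane Respects _≈ₚ_
      isLine-resp   : isLine Respects _≈ₗ_

    structure : IncidenceStructure
    structure = restrict inPlane isLine

    field
      isProjectivePlane : IsProjectivePlane structure
      hasOrder          : HasOrder structure n

  -- The line ℓ need not be a line of the subplane.
  Tangent : ∀ {n} → Subplane n → Ln → Set
  Tangent π ℓ = MeetsIn 𝓐 1 (Subplane.inPlane π) ℓ

PG2 : ∀ {q} → FiniteField q → IncidenceStructure
PG2 F = record
  { Points = pointSetoid F 2
  ; Lines  = pointSetoid F 2
  ; _I_    = λ P ℓ → onHyperplane F ℓ P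
  }

module _ {q : ℕ} (E : CubicExtension q) where
  open CubicExtension E
  open FiniteField F using (0#)
  open FiniteField K using (_^ᶠ_) renaming (0# to 0ᴷ)
  open Point using (coords)
  open Flat using (basis)

  private
    Planeᴷ : IncidenceStructure
    Planeᴷ = PG2 K
    module Planeᴷ = IncidenceStructure Planeᴷ

  -- A conic of a plane isomorphic to PG(2,q) is the image of a conic of PG(2,q).
  record IsConicOf (π : Subplane Planeᴷ q) (C : Pred (Point K 2) 0ℓ) : Set where
    field
      coordinates   : Isomorphism (PG2 F) (Subplane.structure π)
      form          : TernaryQuadraticForm F
      nonDegenerate : TernaryQuadraticForm.NonDegenerate form
      image         : C ≐ λ X → ∃ λ P → TernaryQuadraticForm.zeros form P ×
                        X Planeᴷ.≈ₚ proj₁ (Isomorphism.point↦ coordinates P)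

  extend : ∀ {n} → Vector F n → Vector K n
  extend = map embed

  frobenius : ∀ {n} → Vector K n → Vector K n
  frobenius = map (_^ᶠ q)

  module _ (Σ∞ : Point F 6) where

    -- PG(5,q³) is the hyperplane of PG(6,q³) with the same equation as Σ∞.
    InΣ∞ᴷ : Pred (Vector K 7) 0ℓ
    InΣ∞ᴷ v = dot K (extend (coords Σ∞)) v ≡ 0ᴷ

    record RegularSpread : Set where
      field
        g : Flat K 6 1

      conjugates : Vec (Vector K 7) 6
      conjugates = basis g ++ map frobenius (basis g)
                           ++ map (λ v → frobenius (frobenius v)) (basis g)

      field
        g-in-Σ∞    : ∀ X → points K g X → InΣ∞ᴷ (coords X)
        g-disjoint : ∀ P → onHyperplane F Σ∞ P → ¬ Span K (basis g) (extend (coords P))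
        g-spanning : ∀ v → InΣ∞ᴷ v → Span K conjugates v

      spreadPlane : Point K 6 → Pred (Point F 6) 0ℓ
      spreadPlane X P =
        onHyperplane F Σ∞ P ×
        Span K (coords X ∷ frobenius (coords X) ∷ frobenius (frobenius (coords X)) ∷ [])
               (extend (coords P))

    module _ (𝓢 : RegularSpread) where
      open RegularSpread 𝓢

      -- Elements are identified with their point sets (see BruckBose below), so
      -- proportional X give the same spread plane, and incidence is containment.
      data BBPoint : Set where
        affine : ∀ P → ¬ onHyperplane F Σ∞ P → BBPoint
        plane  : ∀ X → points K g X → BBPoint

      pointsOf : BBPoint → Pred (Point F 6) 0ℓ
      pointsOf (affine P _) Q = Setoid._≈_ (pointSetoid F 6) Q P
      pointsOf (plane X _)  Q = spreadPlane X Q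

      data BBLine : Set where
        solid : ∀ (W : Flat F 6 3) →
                ¬ (points F W ⊆ onHyperplane F Σ∞) →
                (∃ λ X → points K g X × spreadPlane X ⊆ points F W) → BBLine
        line∞ : BBLine

      _≈ᴸ_ : BBLine → BBLine → Set
      solid W _ _ ≈ᴸ solid W′ _ _ = points F W ≐ points F W′
      line∞       ≈ᴸ line∞        = ⊤
      solid _ _ _ ≈ᴸ line∞        = ⊥
      line∞       ≈ᴸ solid _ _ _  = ⊥

      _Iᴮ_ : BBPoint → BBLine → Set
      A          Iᴮ solid W _ _ = pointsOf A ⊆ points F W
      affine _ _ Iᴮ line∞       = ⊥
      plane _ _  Iᴮ line∞       = ⊤

      private
        ≐-isEquivalence : IsEquivalence (_≐_ {A = Point F 6} {0ℓ} {0ℓ})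
        ≐-isEquivalence = record
          { refl  = (λ x → x) , (λ x → x)
          ; sym   = λ (f , g) → g , f
          ; trans = λ (f , g) (f′ , g′) → (λ x → f′ (f x)) , (λ x → g (g′ x))
          }

        module ≐ = IsEquivalence ≐-isEquivalence

        ≈ᴸ-refl : ∀ {ℓ} → ℓ ≈ᴸ ℓ
        ≈ᴸ-refl {solid W _ _} = ≐.refl {points F W}
        ≈ᴸ-refl {line∞}       = _

        ≈ᴸ-sym : ∀ {ℓ m} → ℓ ≈ᴸ m → m ≈ᴸ ℓ
        ≈ᴸ-sym {solid W _ _} {solid W′ _ _} = ≐.sym {points F W} {points F W′}
        ≈ᴸ-sym {line∞} {line∞} _ = _

        ≈ᴸ-trans : ∀ {ℓ m n} → ℓ ≈ᴸ m → m ≈ᴸ n → ℓ ≈ᴸ n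
        ≈ᴸ-trans {solid W _ _} {solid W′ _ _} {solid W″ _ _} =
          ≐.trans {points F W} {points F W′} {points F W″}
        ≈ᴸ-trans {line∞} {line∞} {line∞} _ _ = _

      BruckBose : IncidenceStructure
      BruckBose = record
        { Points = record
          { Carrier       = BBPoint
          ; _≈_           = λ A B → pointsOf A ≐ pointsOf B
          ; isEquivalence = On.isEquivalence pointsOf ≐-isEquivalence
          }
        ; Lines  = record
          { Carrier       = BBLine
          ; _≈_           = _≈ᴸ_
          ; isEquivalence = record
            { refl  = λ {ℓ} → ≈ᴸ-refl {ℓ}
            ; sym   = λ {ℓ} {m} → ≈ᴸ-sym {ℓ} {m}
            ; trans = λ {ℓ} {m} {n} → ≈ᴸ-trans {ℓ} {m} {n}
            }
          }
        ; _I_    = _Iᴮ_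
        }

      record Representation (ℓ∞ : Point K 2) : Set where
        field
          isomorphism : Isomorphism Planeᴷ BruckBose
          infinity    : Isomorphism.line↦ isomorphism ℓ∞ ≈ᴸ line∞

        ⟦_⟧ : Pred (Point K 2) 0ℓ → Pred (Point F 6) 0ℓ
        ⟦ C ⟧ P = ∃ λ X → C X × pointsOf (Isomorphism.point↦ isomorphism X) P

{-# OPTIONS --safe #-}
module Submission where

-- Write φ for the Frobenius map x ↦ x^q of K and ′ for conjugation by φ. Tracing
-- down from the line g identifies F⁷ with K² × F so that Σ∞ is K², the spread
-- planes are the K-lines of K², and the Bruck-Bose lines are the lines of
-- PG(2,K). The map from PG(2,F) to PG(2,K) underlying the conic preserves and
-- reflects incidence, so by the fundamental theorem of projective geometry it
-- is semilinear. A non-degenerate conic has a rational point (Chevalley) and is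
-- parametrised from it, so its points become (X : Y : L) with X, Y, L linearly
-- independent binary quadratic forms over K. Tangency says that the linear
-- form l underlying L vanishes at exactly one point p of PG(2,F).
--
-- If p is not on the conic, the affine points (X L′L″, Y L′L″, L L′L″) of K² × F
-- are values of sextic forms over F. A relation c between their coefficients
-- satisfies l′ ⋆ l″ ⋆ c = 0 for the contraction action of quadratic forms on
-- dual vectors; a vector killed by two conjugates of l has all its windows of
-- length three proportional to p, which forces it to vanish because p is off
-- the conic, so c = 0 and the curve is normal rational of dimension 6. If p is
-- on the conic, put it at t = 0; then L = t M and the same argument applies to
-- the quartic forms (X M′M″, Y M′M″, t M M′M″), while p contributes its spread
-- plane.

open import Algebra.Bundles using (CommutativeRing)
open import Algebra.Morphism.Structures using (IsRingHomomorphism)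
open import Data.Bool.Base using (Bool)
open import Data.Fin as Fin using (Fin; zero; suc; toℕ; punchOut; inject₁; fromℕ)
import Data.Fin.Properties as Fin
open import Data.Integer.Base using (ℤ)
open import Data.Maybe.Base using (nothing)
open import Data.Nat as ℕ using (ℕ; zero; suc; _<_; _≤_; z≤n; s≤s; _!; _∸_)
open import Data.Nat.Combinatorics using (nCk≡n!/k![n-k]!; k![n∸k]!∣n!; nCn≡1)
  renaming (_C_ to _choose_)
open import Data.Nat.DivMod using (m/n*n≡m)
open import Data.Nat.Divisibility using (_∣_; divides; m∣m*n; >⇒∤; ∣1⇒≡1)
open import Data.Nat.Primality using (Prime; euclidsLemma; prime⇒nonTrivial; prime⇒nonZero)
import Data.Nat.Properties as ℕ
open import Data.Product using (∃; _×_; _,_; proj₁; proj₂)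
open import Data.Product.Function.NonDependent.Propositional using (_×-↔_)
open import Data.Sum using (_⊎_; inj₁; inj₂)
open import Data.Vec using (Vec; []; _∷_; map; head; tail; zipWith; replicate; lookup; tabulate; _∷ʳ_; _++_)
import Data.Vec.Properties as Vec
open import Defs
open import Function using (_∘_; const; id)
open import Function.Bundles using (_↔_; _⇔_; Bijection; Equivalence; Inverse; mk⇔; mk↔ₛ′)
open import Function.Construct.Composition using (_↔-∘_; _⇔-∘_)
open import Function.Construct.Symmetry using (↔-sym)
open import Function.Definitions using (Injective)
open import Level using (0ℓ)
open import Relation.Binary.Bundles using (Setoid)
open import Relation.Binary.PropositionalEquality
  using (_≡_; _≢_; refl; sym; trans; cong; cong₂; subst; module ≡-Reasoning)
open import Relation.Nullary using (¬_; Dec; yes; no; contradiction)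
open import Relation.Nullary.Decidable using (map′; isYes; toWitness; decidable-stable; ¬?; _×-dec_)
open import Relation.Unary using (Pred; _⊆_; _≐_; _∪_)
open import Tactic.RingSolver.Core.AlmostCommutativeRing
  using (AlmostCommutativeRing; fromCommutativeRing)
import Tactic.RingSolver.Core.Expression as Expression
open import Tactic.RingSolver.Core.Polynomial.Parameters using (Homomorphism)

-- The two isomorphisms in the hypotheses, the Bruck-Bose representation and the coordinates of the
-- subplane, are known through incidence only, and each may hide a field automorphism. They are
-- therefore composed, before anything is computed, into one map from PG(2,F) to PG(2,K). It is not
-- onto, so what is needed is a fundamental theorem for maps that preserve and reflect incidence.
-- The homomorphism F → K that comes out has the same image as `embed` and merely reparametrises the
-- conic.
--
-- Tangency enters as independence over F. The line l has coefficients in K and a single rational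
-- point p, so two of its coefficients, x and y, have a ratio outside F. Then x φ(y) - y φ(x) ≠ 0,
-- and l and its conjugate cut out p alone. When p is on the conic, x and y are the coefficients of
-- M.
--
-- Dimension counts are replaced by counting elements: an injection, or a surjection, between finite
-- sets of equal size is bijective. This is applied to F⁷ and K² × F, and to a solid and K × F.

open Point using (coords; nonzero)

-- The coefficients are integers because in an abstract field 1 + - 1 does not
-- compute to 0.
module IntegerSolver {q : ℕ} (F : FiniteField q) where
  open CommutativeRing (FiniteField.commutativeRing F) hiding (refl; sym; trans)
  open import Algebra.Properties.Ring ring
  open import Algebra.Properties.AbelianGroup +-abelianGroup using (⁻¹-∙-comm)
  open import Algebra.Properties.Semiring.Mult.TCOptimised semiring
    using (1+×; ×-homo-+; ×1-homo-*) renaming (_×_ to _·_)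
  open import Data.Integer.Base as ℤ using (ℤ; +_; -[1+_])
  import Data.Integer.Properties as ℤ
  open ≡-Reasoning

  ⟦_⟧ℤ : ℤ → Carrier
  ⟦ + n ⟧ℤ = n · 1#
  ⟦ -[1+ n ] ⟧ℤ = - (suc n · 1#)

  private
    cancel : ∀ x y z → (x + y) - (x + z) ≡ y - z
    cancel x y z = begin
      (x + y) - (x + z) ≡⟨ +-congˡ (sym (⁻¹-∙-comm x z)) ⟩
      (x + y) + (- x + - z) ≡⟨ +-congʳ (+-comm x y) ⟩
      (y + x) + (- x + - z) ≡⟨ +-assoc y x _ ⟩
      y + (x + (- x + - z)) ≡⟨ +-congˡ (sym (+-assoc x (- x) _)) ⟩
      y + ((x + - x) + - z) ≡⟨ +-congˡ (+-congʳ (-‿inverseʳ x)) ⟩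
      y + (0# + - z) ≡⟨ +-congˡ (+-identityˡ _) ⟩
      y - z ∎

    ⊖-homo : ∀ m n → ⟦ m ℤ.⊖ n ⟧ℤ ≡ m · 1# - n · 1#
    ⊖-homo zero zero = sym (-‿inverseʳ 0#)
    ⊖-homo zero (suc n) = sym (+-identityˡ _)
    ⊖-homo (suc m) zero = sym (trans (+-congˡ -0#≈0#) (+-identityʳ _))
    ⊖-homo (suc m) (suc n) = begin
      ⟦ suc m ℤ.⊖ suc n ⟧ℤ ≡⟨ cong ⟦_⟧ℤ (ℤ.[1+m]⊖[1+n]≡m⊖n m n) ⟩
      ⟦ m ℤ.⊖ n ⟧ℤ ≡⟨ ⊖-homo m n ⟩
      m · 1# - n · 1# ≡⟨ cancel 1# _ _ ⟨
      (1# + m · 1#) - (1# + n · 1#) ≡⟨ +-cong (1+× m 1#) (-‿cong (1+× n 1#)) ⟨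
      suc m · 1# - suc n · 1# ∎

    -‿homo : ∀ i → ⟦ ℤ.- i ⟧ℤ ≡ - ⟦ i ⟧ℤ
    -‿homo (+ zero) = sym -0#≈0#
    -‿homo (+ suc n) = refl
    -‿homo (-[1+ n ]) = sym (-‿involutive _)

    +-homo : ∀ i j → ⟦ i ℤ.+ j ⟧ℤ ≡ ⟦ i ⟧ℤ + ⟦ j ⟧ℤ
    +-homo (+ m) (+ n) = ×-homo-+ 1# m n
    +-homo (+ m) (-[1+ n ]) = ⊖-homo m (suc n)
    +-homo (-[1+ m ]) (+ n) = trans (⊖-homo n (suc m)) (+-comm _ _)
    +-homo (-[1+ m ]) (-[1+ n ]) = begin
      - (suc (suc (m ℕ.+ n)) · 1#) ≡⟨ cong (λ k → - (suc k · 1#)) (ℕ.+-suc m n) ⟨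
      - ((suc m ℕ.+ suc n) · 1#) ≡⟨ -‿cong (×-homo-+ 1# (suc m) (suc n)) ⟩
      - (suc m · 1# + suc n · 1#) ≡⟨ ⁻¹-∙-comm _ _ ⟨
      - (suc m · 1#) - (suc n · 1#) ∎

    *-homo⁺ : ∀ m j → ⟦ + m ℤ.* j ⟧ℤ ≡ ⟦ + m ⟧ℤ * ⟦ j ⟧ℤ
    *-homo⁺ m (+ n) = trans (cong ⟦_⟧ℤ (sym (ℤ.pos-* m n))) (×1-homo-* m n)
    *-homo⁺ m -[1+ n ] = begin
      ⟦ + m ℤ.* -[1+ n ] ⟧ℤ ≡⟨ cong ⟦_⟧ℤ (ℤ.neg-distribʳ-* (+ m) (+ suc n)) ⟨
      ⟦ ℤ.- (+ m ℤ.* + suc n) ⟧ℤ ≡⟨ -‿homo (+ m ℤ.* + suc n) ⟩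
      - ⟦ + m ℤ.* + suc n ⟧ℤ ≡⟨ -‿cong (*-homo⁺ m (+ suc n)) ⟩
      - (⟦ + m ⟧ℤ * ⟦ + suc n ⟧ℤ) ≡⟨ -‿distribʳ-* _ _ ⟩
      ⟦ + m ⟧ℤ * ⟦ -[1+ n ] ⟧ℤ ∎

    *-homo : ∀ i j → ⟦ i ℤ.* j ⟧ℤ ≡ ⟦ i ⟧ℤ * ⟦ j ⟧ℤ
    *-homo (+ m) j = *-homo⁺ m j
    *-homo (-[1+ m ]) j = begin
      ⟦ -[1+ m ] ℤ.* j ⟧ℤ ≡⟨ cong ⟦_⟧ℤ (ℤ.neg-distribˡ-* (+ suc m) j) ⟨
      ⟦ ℤ.- (+ suc m ℤ.* j) ⟧ℤ ≡⟨ -‿homo (+ suc m ℤ.* j) ⟩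
      - ⟦ + suc m ℤ.* j ⟧ℤ ≡⟨ -‿cong (*-homo⁺ (suc m) j) ⟩
      - (⟦ + suc m ⟧ℤ * ⟦ j ⟧ℤ) ≡⟨ -‿distribˡ-* _ _ ⟩
      ⟦ -[1+ m ] ⟧ℤ * ⟦ j ⟧ℤ ∎

    almostCommutativeRing : AlmostCommutativeRing 0ℓ 0ℓ
    almostCommutativeRing = fromCommutativeRing (FiniteField.commutativeRing F) (λ _ → nothing)

    -- Zero is recognised among the integer coefficients, so that terms cancel in normal forms
    -- although equality with 0 in the field is left undecided (`nothing`).
    isZero : ℤ → Bool
    isZero i = isYes (i ℤ.≟ + 0)

    homomorphism : Homomorphism 0ℓ 0ℓ 0ℓ 0ℓ
    homomorphism = record
      { from = record { rawRing = ℤ.+-*-rawRing ; isZero = isZero }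
      ; to = almostCommutativeRing
      ; morphism = record
        { ⟦_⟧ = ⟦_⟧ℤ ; +-homo = +-homo ; *-homo = *-homo ; -‿homo = -‿homo
        ; 0-homo = refl ; 1-homo = refl }
      ; Zero-C⟶Zero-R = λ i i≡0 → cong ⟦_⟧ℤ (sym (toWitness {a? = i ℤ.≟ + 0} i≡0))
      }

    open AlmostCommutativeRing almostCommutativeRing using () renaming (rawRing to rawRing′)

  open Expression public using (Expr; Κ; Ι; _⊕_; _⊗_; _⊛_; ⊝_)

  𝟘 𝟙 : ∀ {n} → Expr ℤ n
  𝟘 = Κ (+ 0)
  𝟙 = Κ (+ 1)

  private
    open import Tactic.RingSolver.Core.Polynomial.Base (Homomorphism.from homomorphism)
    open Expression.Eval rawRing′ ⟦_⟧ℤ renaming (⟦_⟧ to eval)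
    open import Tactic.RingSolver.Core.Polynomial.Semantics homomorphism renaming (⟦_⟧ to evalₚ)
    open import Tactic.RingSolver.Core.Polynomial.Homomorphism homomorphism
    open import Algebra.Properties.Semiring.Exp.TCOptimised (AlmostCommutativeRing.semiring almostCommutativeRing) using (^-congˡ)

    norm : ∀ {n} → Expr ℤ n → Poly n
    norm (Κ x) = κ x
    norm (Ι x) = ι x
    norm (x ⊕ y) = norm x ⊞ norm y
    norm (x ⊗ y) = norm x ⊠ norm y
    norm (⊝ x) = ⊟ norm x
    norm (x ⊛ i) = norm x ⊡ i

    normalised : ∀ {n} → Expr ℤ n → Vec Carrier n → Carrier
    normalised e = evalₚ (norm e)

    correct : ∀ {n} (e : Expr ℤ n) ρ → normalised e ρ ≡ eval e ρ
    correct (Κ x) ρ = κ-hom x ρ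
    correct (Ι x) ρ = ι-hom x ρ
    correct (x ⊕ y) ρ = trans (⊞-hom (norm x) (norm y) ρ) (+-cong (correct x ρ) (correct y ρ))
    correct (x ⊗ y) ρ = trans (⊠-hom (norm x) (norm y) ρ) (*-cong (correct x ρ) (correct y ρ))
    correct (⊝ x) ρ = trans (⊟-hom (norm x) ρ) (-‿cong (correct x ρ))
    correct (x ⊛ i) ρ = trans (⊡-hom (norm x) i ρ) (^-congˡ i (correct x ρ))

  open import Relation.Binary.Reflection setoid Ι eval normalised correct public
    using (solve; _⊜_)

-- Finite sets

-- A missed value j could be punched out of the codomain, leaving an injection of `Fin (suc n)` into
-- `Fin n`.
Fin-injective⇒surjective : ∀ {n} (f : Fin n → Fin n) → Injective _≡_ _≡_ f → ∀ j → ∃ λ i → f i ≡ j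
Fin-injective⇒surjective {suc n} f inj j with Fin.any? (λ i → f i Fin.≟ j)
... | yes hit = hit
... | no miss = contradiction (Fin.injective⇒≤ squeeze-injective) ℕ.1+n≰n
  where
  missed : ∀ i → j ≢ f i
  missed i e = miss (i , sym e)
  squeeze : Fin (suc n) → Fin n
  squeeze i = punchOut (missed i)
  squeeze-injective : Injective _≡_ _≡_ squeeze
  squeeze-injective e = inj (Fin.punchOut-injective (missed _) (missed _) e)

module _ {A B : Set} {n : ℕ} (A↔ : A ↔ Fin n) (B↔ : B ↔ Fin n) where
  private
    module A = Inverse A↔
    module B = Inverse B↔

  injective⇒surjective : (f : A → B) → Injective _≡_ _≡_ f → ∀ b → ∃ λ a → f a ≡ b
  injective⇒surjective f inj b =
    let i , e = Fin-injective⇒surjective (B.to ∘ f ∘ A.from) index-injective (B.to b)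
    in A.from i , trans (sym (B.strictlyInverseʳ _)) (trans (cong B.from e) (B.strictlyInverseʳ b))
    where
    index-injective : Injective _≡_ _≡_ (B.to ∘ f ∘ A.from)
    index-injective {i} {j} e =
      trans (sym (A.strictlyInverseˡ i)) (trans (cong A.to (inj (trans (sym (B.strictlyInverseʳ _))
        (trans (cong B.from e) (B.strictlyInverseʳ _))))) (A.strictlyInverseˡ j))

-- A section of f is injective, hence onto by `injective⇒surjective`; every element is then a chosen
-- preimage, and f is inverse to the choice.
surjective⇒injective : ∀ {A B : Set} {n} → A ↔ Fin n → B ↔ Fin n → (f : A → B) →
  (∀ b → ∃ λ a → f a ≡ b) → Injective _≡_ _≡_ f
surjective⇒injective A↔ B↔ f sur {a} {a′} fa≡fa′ =
  let b , gb≡a = g-surjective a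
      b′ , gb′≡a′ = g-surjective a′
      b≡b′ = begin
        b ≡⟨ proj₂ (sur b) ⟨
        f (g b) ≡⟨ cong f gb≡a ⟩
        f a ≡⟨ fa≡fa′ ⟩
        f a′ ≡⟨ cong f gb′≡a′ ⟨
        f (g b′) ≡⟨ proj₂ (sur b′) ⟩
        b′ ∎
  in trans (sym gb≡a) (trans (cong g b≡b′) gb′≡a′)
  where
  open ≡-Reasoning
  g = proj₁ ∘ sur
  g-surjective = injective⇒surjective B↔ A↔ g
    (λ {b} {b′} e → trans (sym (proj₂ (sur b))) (trans (cong f e) (proj₂ (sur b′))))

module _ {A : Set} {n : ℕ} (A↔ : A ↔ Fin n) where
  private
    module A = Inverse A↔

  ≟-finite : (x y : A) → Dec (x ≡ y)
  ≟-finite x y = map′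
    (λ e → trans (sym (A.strictlyInverseʳ x)) (trans (cong A.from e) (A.strictlyInverseʳ y)))
    (cong A.to) (A.to x Fin.≟ A.to y)

  any-finite? : ∀ {P : A → Set} → (∀ x → Dec (P x)) → Dec (∃ P)
  any-finite? {P} P? = map′ (λ (i , p) → A.from i , p)
    (λ (x , p) → A.to x , subst P (sym (A.strictlyInverseʳ x)) p) (Fin.any? (P? ∘ A.from))

  vec-finite : ∀ k → Vec A k ↔ Fin (n ℕ.^ k)
  vec-finite zero = mk↔ₛ′ (λ _ → zero) (λ _ → []) (λ { zero → refl }) (λ { [] → refl })
  vec-finite (suc k) = ↔-sym (Fin.*↔× {n} {n ℕ.^ k}) ↔-∘ ((A↔ ×-↔ vec-finite k) ↔-∘ split)
    where
    split : Vec A (suc k) ↔ (A × Vec A k)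
    split = mk↔ₛ′ (λ { (x ∷ xs) → x , xs }) (λ (x , xs) → x ∷ xs) (λ _ → refl) (λ { (x ∷ xs) → refl })

×-finite : ∀ {A B : Set} {m n} → A ↔ Fin m → B ↔ Fin n → (A × B) ↔ Fin (m ℕ.* n)
×-finite {m = m} {n} A↔ B↔ = ↔-sym (Fin.*↔× {m} {n}) ↔-∘ (A↔ ×-↔ B↔)

-- Finite fields

module FieldTheory {n : ℕ} (F : FiniteField n) where
  open FiniteField F public using (Carrier; _+_; _*_; -_; 0#; 1#; 0≢1; invertible; enumeration; commutativeRing; _^ᶠ_)
  open CommutativeRing commutativeRing public
    using (+-comm; +-assoc; +-identityˡ; +-identityʳ; *-comm; *-assoc; *-identityˡ; *-identityʳ; zeroˡ; zeroʳ; -‿inverseʳ; -‿inverseˡ; distribˡ; distribʳ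
          ; +-commutativeMonoid; *-commutativeMonoid)
  open IntegerSolver F public
  open import Algebra.Properties.CommutativeMonoid.Sum +-commutativeMonoid public
    using (sum; sum-permute; sum-cong-≗; sum-replicate; ∑-distrib-+)
  open import Algebra.Properties.CommutativeMonoid.Sum *-commutativeMonoid
    using () renaming (sum to product; sum-permute to product-permute; sum-cong-≗ to product-cong;
                       sum-replicate to product-replicate; ∑-distrib-+ to product-distrib; sum-remove to product-remove)
  open import Algebra.Properties.Semiring.Sum (FiniteField.semiring F) public using (*-distribˡ-sum)
  open import Algebra.Properties.CommutativeSemiring.Exp (CommutativeRing.commutativeSemiring commutativeRing) public
    using (^-distrib-*; ^-homo-*; ^-assocʳ)
  open import Algebra.Properties.Semiring.Mult (FiniteField.semiring F) public
    using (×1-homo-*; ×-homo-+) renaming (_×_ to _·_)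
  open ≡-Reasoning

  infix 4 _≟_
  _≟_ : (x y : Carrier) → Dec (x ≡ y)
  _≟_ = ≟-finite enumeration

  1≢0 : 1# ≢ 0#
  1≢0 e = 0≢1 (sym e)

  difference-zero : ∀ {x y} → x + - y ≡ 0# → x ≡ y
  difference-zero {x} {y} e = begin
    x ≡⟨ solve 2 (λ x y → x ⊜ (x ⊕ ⊝ y) ⊕ y) refl x y ⟩
    (x + - y) + y ≡⟨ cong (_+ y) e ⟩
    0# + y ≡⟨ +-identityˡ y ⟩
    y ∎

  *-zero-divisor : ∀ {x y} → x ≢ 0# → x * y ≡ 0# → y ≡ 0#
  *-zero-divisor {x} {y} x≢0 xy≡0 with invertible x x≢0
  ... | z , zx≡1 = begin
    y ≡⟨ *-identityˡ y ⟨
    1# * y ≡⟨ cong (_* y) zx≡1 ⟨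
    z * x * y ≡⟨ *-assoc z x y ⟩
    z * (x * y) ≡⟨ cong (z *_) xy≡0 ⟩
    z * 0# ≡⟨ zeroʳ z ⟩
    0# ∎

  *-nonzero : ∀ {x y} → x ≢ 0# → y ≢ 0# → x * y ≢ 0#
  *-nonzero x≢0 y≢0 xy≡0 = y≢0 (*-zero-divisor x≢0 xy≡0)

  *-cancelˡ : ∀ {x y z} → x ≢ 0# → x * y ≡ x * z → y ≡ z
  *-cancelˡ {x} {y} {z} x≢0 e = difference-zero (*-zero-divisor x≢0 (begin
    x * (y + - z) ≡⟨ solve 3 (λ x y z → x ⊗ (y ⊕ ⊝ z) ⊜ x ⊗ y ⊕ ⊝ (x ⊗ z)) refl x y z ⟩
    x * y + - (x * z) ≡⟨ cong (λ w → w + - (x * z)) e ⟩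
    x * z + - (x * z) ≡⟨ -‿inverseʳ _ ⟩
    0# ∎))

  factor-nonzero : ∀ {x y} → y * x ≡ 1# → y ≢ 0#
  factor-nonzero {x} yx≡1 refl = 0≢1 (trans (sym (zeroˡ x)) yx≡1)

  ^-nonzero : ∀ {x} k → x ≢ 0# → x ^ᶠ k ≢ 0#
  ^-nonzero zero x≢0 = 1≢0
  ^-nonzero (suc k) x≢0 = *-nonzero x≢0 (^-nonzero k x≢0)

  zero-^ : ∀ {x} k → x ^ᶠ k ≡ 0# → x ≡ 0#
  zero-^ {x} k e = decidable-stable (x ≟ 0#) (λ x≢0 → ^-nonzero k x≢0 e)

  -- The leading coefficient 1 is not stored.
  monic : ∀ {k} → Vec Carrier k → Carrier → Carrier
  monic [] x = 1#
  monic (c ∷ cs) x = c + x * monic cs x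

  -- Horner's scheme: for p = c + x m one has p(x) - p(r) = (x - r) m(r) + x (m(x) - m(r)), so the
  -- quotient for p is m(r) + x times the quotient for m.
  monic-divide : ∀ {k} (cs : Vec Carrier (suc k)) r →
                 ∃ λ (ds : Vec Carrier k) → ∀ x → monic cs x + - monic cs r ≡ (x + - r) * monic ds x
  monic-divide (c ∷ []) r = [] , λ x →
    solve 3 (λ c x r → (c ⊕ x ⊗ 𝟙) ⊕ ⊝ (c ⊕ r ⊗ 𝟙) ⊜ (x ⊕ ⊝ r) ⊗ 𝟙) refl c x r
  monic-divide (c ∷ cs@(_ ∷ _)) r with monic-divide cs r
  ... | ds , e = monic cs r ∷ ds , λ x → begin
    (c + x * monic cs x) + - (c + r * monic cs r)
      ≡⟨ solve 5 (λ c x r m k → (c ⊕ x ⊗ m) ⊕ ⊝ (c ⊕ r ⊗ k) ⊜ (x ⊕ ⊝ r) ⊗ k ⊕ x ⊗ (m ⊕ ⊝ k)) refl c x r (monic cs x) (monic cs r) ⟩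
    (x + - r) * monic cs r + x * (monic cs x + - monic cs r)
      ≡⟨ cong (λ w → (x + - r) * monic cs r + x * w) (e x) ⟩
    (x + - r) * monic cs r + x * ((x + - r) * monic ds x)
      ≡⟨ solve 4 (λ x r k d → (x ⊕ ⊝ r) ⊗ k ⊕ x ⊗ ((x ⊕ ⊝ r) ⊗ d) ⊜ (x ⊕ ⊝ r) ⊗ (k ⊕ x ⊗ d)) refl x r (monic cs r) (monic ds x) ⟩
    (x + - r) * (monic cs r + x * monic ds x) ∎

  -- Dividing by x minus the first root leaves the other roots to the quotient, which is again
  -- monic; the zero polynomial never turns up.
  monic-root-bound : ∀ {k} (cs : Vec Carrier k) (x : Fin (suc k) → Carrier) →
                     Injective _≡_ _≡_ x → ¬ (∀ i → monic cs (x i) ≡ 0#)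
  monic-root-bound [] x inj roots = 1≢0 (roots zero)
  monic-root-bound cs@(_ ∷ _) x inj roots with monic-divide cs (x zero)
  ... | ds , e = monic-root-bound ds (x ∘ suc) (Fin.suc-injective ∘ inj) λ i →
    *-zero-divisor (λ d → Fin.0≢1+n (sym (inj (difference-zero d)))) (begin
      (x (suc i) + - x zero) * monic ds (x (suc i)) ≡⟨ e (x (suc i)) ⟨
      monic cs (x (suc i)) + - monic cs (x zero) ≡⟨ cong₂ (λ u v → u + - v) (roots (suc i)) (roots zero) ⟩
      0# + - 0# ≡⟨ -‿inverseʳ 0# ⟩
      0# ∎)

  monic-power : ∀ k x → monic (replicate k 0#) x ≡ x ^ᶠ k
  monic-power zero x = refl
  monic-power (suc k) x = trans (+-identityˡ _) (cong (x *_) (monic-power k x))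

  -- Together with `monic-power` this builds the sparse polynomials used below, such as x^q - x; j <
  -- k protects the leading coefficient.
  monic-add : ∀ {k} (cs : Vec Carrier k) a {j} → j < k →
              ∃ λ (ds : Vec Carrier k) → ∀ x → monic ds x ≡ monic cs x + a * x ^ᶠ j
  monic-add (c ∷ cs) a {zero} _ = (c + a) ∷ cs , λ x →
    solve 4 (λ c a x m → (c ⊕ a) ⊕ x ⊗ m ⊜ (c ⊕ x ⊗ m) ⊕ a ⊗ 𝟙) refl c a x (monic cs x)
  monic-add (c ∷ cs) a {suc j} (s≤s j<k) with monic-add cs a j<k
  ... | ds , e = c ∷ ds , λ x → trans (cong (λ w → c + x * w) (e x))
    (solve 5 (λ c a x m p → c ⊕ x ⊗ (m ⊕ a ⊗ p) ⊜ (c ⊕ x ⊗ m) ⊕ a ⊗ (x ⊗ p)) refl c a x (monic cs x) (x ^ᶠ j))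

  private
    module En = Inverse enumeration

  element : Fin n → Carrier
  element = En.from

  element-injective : Injective _≡_ _≡_ element
  element-injective {i} {j} e = trans (sym (En.strictlyInverseˡ i)) (trans (cong En.to e) (En.strictlyInverseˡ j))

  monic-nonroot : ∀ {k} (cs : Vec Carrier k) → k < n → ∃ λ x → monic cs x ≢ 0#
  monic-nonroot cs k<n with any-finite? enumeration (λ x → ¬? (monic cs x ≟ 0#))
  ... | yes found = found
  ... | no none = contradiction (λ i → decidable-stable (_ ≟ _) (λ ne → none (_ , ne)))
    (monic-root-bound cs (λ i → element (Fin.inject≤ i k<n))
      (λ e → Fin.inject≤-injective k<n k<n _ _ (element-injective e)))

  total : (Carrier → Carrier) → Carrier
  total f = sum (f ∘ element)

  permutation : Carrier ↔ Carrier → Fin n ↔ Fin n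
  permutation e = enumeration ↔-∘ (e ↔-∘ ↔-sym enumeration)

  total-permute : ∀ f (e : Carrier ↔ Carrier) → total f ≡ total (f ∘ Inverse.to e)
  total-permute f e = trans (sum-permute (f ∘ element) (permutation e))
    (sum-cong-≗ (λ i → cong f (En.strictlyInverseʳ (Inverse.to e (element i)))))

  translation : Carrier → Carrier ↔ Carrier
  translation a = mk↔ₛ′ (_+ a) (_+ - a)
    (λ x → solve 2 (λ a x → (x ⊕ ⊝ a) ⊕ a ⊜ x) refl a x)
    (λ x → solve 2 (λ a x → (x ⊕ a) ⊕ ⊝ a ⊜ x) refl a x)

  dilation : ∀ a → a ≢ 0# → Carrier ↔ Carrier
  dilation a a≢0 with invertible a a≢0
  ... | b , ba≡1 = mk↔ₛ′ (a *_) (b *_) (λ x → trans (solve 3 (λ a b x → a ⊗ (b ⊗ x) ⊜ (b ⊗ a) ⊗ x) refl a b x) (unit x))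
                                       (λ x → trans (sym (*-assoc b a x)) (unit x))
    where
    unit : ∀ x → b * a * x ≡ x
    unit x = trans (cong (_* x) ba≡1) (*-identityˡ x)

  -- Translation by 1 permutes the field, so the sum of all elements equals itself plus n · 1.
  n·1≡0 : n · 1# ≡ 0#
  n·1≡0 = begin
    n · 1# ≡⟨ solve 2 (λ t m → m ⊜ (t ⊕ m) ⊕ ⊝ t) refl (total (λ x → x)) (n · 1#) ⟩
    (total (λ x → x) + n · 1#) + - total (λ x → x)
                                      ≡⟨ cong (λ w → w + - total (λ x → x)) shift ⟨
    total (λ x → x) + - total (λ x → x) ≡⟨ -‿inverseʳ _ ⟩
    0# ∎
    where
    shift : total (λ x → x) ≡ total (λ x → x) + n · 1#
    shift = begin
      total (λ x → x) ≡⟨ total-permute (λ x → x) (translation 1#) ⟩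
      total (λ x → x + 1#) ≡⟨ ∑-distrib-+ element (const 1#) ⟩
      total (λ x → x) + sum (const {B = Fin n} 1#) ≡⟨ cong (total (λ x → x) +_) (sum-replicate n) ⟩
      total (λ x → x) + n · 1# ∎

  private
    -- The factor a in front stands in for the exceptional index, so that the exponent is m rather
    -- than a predecessor.
    product-except-one : ∀ {m} (t : Fin m → Carrier) i a → t i ≡ 1# → (∀ j → j ≢ i → t j ≡ a) → a * product t ≡ a ^ᶠ m
    product-except-one {suc m} t i a ti≡1 rest = cong (a *_) (begin
      product t ≡⟨ product-remove {i = i} t ⟩
      t i * product (t ∘ Fin.punchIn i) ≡⟨ cong₂ _*_ ti≡1 (product-cong (λ j → rest _ (Fin.punchInᵢ≢i i j))) ⟩
      1# * product (const {B = Fin m} a) ≡⟨ *-identityˡ _ ⟩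
      product (const {B = Fin m} a) ≡⟨ product-replicate m ⟩
      a ^ᶠ m ∎)

    productᶜ : (Carrier → Carrier) → Carrier
    productᶜ f = product (f ∘ element)

    productᶜ-permute : ∀ f (e : Carrier ↔ Carrier) → productᶜ f ≡ productᶜ (f ∘ Inverse.to e)
    productᶜ-permute f e = trans (product-permute (f ∘ element) (permutation e))
      (product-cong (λ i → cong f (En.strictlyInverseʳ (Inverse.to e (element i)))))

    product-nonzero : ∀ {m} (t : Fin m → Carrier) → (∀ i → t i ≢ 0#) → product t ≢ 0#
    product-nonzero {zero} t ne = 1≢0
    product-nonzero {suc m} t ne = *-nonzero (ne zero) (product-nonzero (t ∘ suc) (ne ∘ suc))

    instead : Carrier → Carrier → Carrier → Carrier
    instead u v x with x ≟ 0#
    ... | yes _ = u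
    ... | no _ = v

    instead-0 : ∀ u v → instead u v 0# ≡ u
    instead-0 u v with 0# ≟ 0#
    ... | yes _ = refl
    ... | no ne = contradiction refl ne

    instead-≢0 : ∀ u v {x} → x ≢ 0# → instead u v x ≡ v
    instead-≢0 u v {x} x≢0 with x ≟ 0#
    ... | yes e = contradiction e x≢0
    ... | no _ = refl

    -- With 0 replaced by 1, the product over the whole field is the product of its nonzero
    -- elements, and can be cancelled.
    unit : Carrier → Carrier
    unit x = instead 1# x x

    unit-nonzero : ∀ x → unit x ≢ 0#
    unit-nonzero x with x ≟ 0#
    ... | yes _ = 1≢0
    ... | no ne = ne

    unit-* : ∀ {a} → a ≢ 0# → ∀ x → unit (a * x) ≡ instead 1# a x * unit x
    unit-* {a} a≢0 x = go (x ≟ 0#)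
      where
      go : Dec (x ≡ 0#) → unit (a * x) ≡ instead 1# a x * unit x
      go (yes refl) = begin
        unit (a * 0#) ≡⟨ cong unit (zeroʳ a) ⟩
        unit 0# ≡⟨ instead-0 1# 0# ⟩
        1# ≡⟨ *-identityˡ 1# ⟨
        1# * 1# ≡⟨ cong₂ _*_ (instead-0 1# a) (instead-0 1# 0#) ⟨
        instead 1# a 0# * unit 0# ∎
      go (no x≢0) = begin
        unit (a * x) ≡⟨ instead-≢0 _ _ (*-nonzero a≢0 x≢0) ⟩
        a * x ≡⟨ cong₂ _*_ (instead-≢0 1# a x≢0) (instead-≢0 1# x x≢0) ⟨
        instead 1# a x * unit x ∎

  -- Multiplication by a ≠ 0 permutes the nonzero elements, so their product is unchanged when each
  -- is multiplied by a. The product of these factors a is therefore 1.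
  fermat : ∀ x → x ^ᶠ n ≡ x
  fermat a = go (a ≟ 0#)
    where
    -- An element of `Fin m` certifies that the exponent is not 0.
    zero-power : ∀ {m} → Fin m → 0# ^ᶠ m ≡ 0#
    zero-power {suc m} _ = zeroˡ _
    go : Dec (a ≡ 0#) → a ^ᶠ n ≡ a
    go (yes refl) = zero-power (En.to 0#)
    go (no a≢0) = begin
      a ^ᶠ n ≡⟨ product-except-one (instead 1# a ∘ element) (En.to 0#) a
                                        (trans (cong (instead 1# a) (En.strictlyInverseʳ 0#)) (instead-0 1# a))
                                        (λ j ne → instead-≢0 1# a (λ e → ne (trans (sym (En.strictlyInverseˡ j)) (cong En.to e)))) ⟨
      a * productᶜ (instead 1# a) ≡⟨ cong (a *_) (*-cancelˡ (product-nonzero _ (λ i → unit-nonzero (element i))) (begin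
        productᶜ unit * productᶜ (instead 1# a) ≡⟨ *-comm _ _ ⟩
        productᶜ (instead 1# a) * productᶜ unit ≡⟨ product-distrib (instead 1# a ∘ element) (unit ∘ element) ⟨
        productᶜ (λ x → instead 1# a x * unit x) ≡⟨ product-cong (λ i → unit-* a≢0 (element i)) ⟨
        productᶜ (λ x → unit (a * x)) ≡⟨ permuted ⟨
        productᶜ unit ≡⟨ *-identityʳ _ ⟨
        productᶜ unit * 1# ∎)) ⟩
      a * 1# ≡⟨ *-identityʳ a ⟩
      a ∎
      where
      permuted : productᶜ unit ≡ productᶜ (λ x → unit (a * x))
      permuted = productᶜ-permute unit (dilation a a≢0)

  -- For exponent 0 the sum is n · 1. For k > 0 the polynomial x^(k+1) - x has degree below n, so
  -- some g ≠ 0 has g^k ≠ 1; the dilation by g permutes the field and multiplies the sum by g^k.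
  power-sum : ∀ i → suc i < n → total (_^ᶠ i) ≡ 0#
  power-sum zero _ = trans (sum-replicate n) n·1≡0
  power-sum (suc i) 2+i<n = *-zero-divisor (λ e → ne e) (begin
    (g ^ᶠ k + - 1#) * S ≡⟨ solve 2 (λ p s → (p ⊕ ⊝ 𝟙) ⊗ s ⊜ p ⊗ s ⊕ ⊝ s) refl (g ^ᶠ k) S ⟩
    g ^ᶠ k * S + - S ≡⟨ cong (_+ - S) (begin
      g ^ᶠ k * S ≡⟨ *-distribˡ-sum (g ^ᶠ k) ((_^ᶠ k) ∘ element) ⟩
      total (λ x → g ^ᶠ k * x ^ᶠ k) ≡⟨ sum-cong-≗ (λ i → ^-distrib-* g (element i) k) ⟨
      total (λ x → (g * x) ^ᶠ k) ≡⟨ total-permute (_^ᶠ k) (dilation g g≢0) ⟨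
      S ∎) ⟩
    S + - S ≡⟨ -‿inverseʳ S ⟩
    0# ∎)
    where
    k = suc i
    S = total (_^ᶠ k)
    poly = monic-add (replicate (suc k) 0#) (- 1#) {1} (s≤s (s≤s z≤n))
    value : ∀ x → monic (proj₁ poly) x ≡ (x ^ᶠ k + - 1#) * x
    value x = trans (proj₂ poly x) (trans (cong (λ w → w + - 1# * (x * 1#)) (monic-power (suc k) x))
      (solve 2 (λ x p → x ⊗ p ⊕ (⊝ 𝟙) ⊗ (x ⊗ 𝟙) ⊜ (p ⊕ ⊝ 𝟙) ⊗ x) refl x (x ^ᶠ k)))
    nonroot = monic-nonroot (proj₁ poly) 2+i<n
    g = proj₁ nonroot
    g≢0 : g ≢ 0#
    g≢0 e = proj₂ nonroot (trans (value g) (trans (cong ((g ^ᶠ k + - 1#) *_) e) (zeroʳ _)))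
    ne : g ^ᶠ k + - 1# ≢ 0#
    ne e = proj₂ nonroot (trans (value g) (trans (cong (_* g) e) (zeroˡ g)))

-- The Frobenius map of the cubic extension

prime∤! : ∀ {p} → Prime p → ∀ k → k < p → ¬ p ∣ k !
prime∤! {p} pp zero k<p p∣1 = contradiction (∣1⇒≡1 p∣1) (λ { refl → ℕ.nonTrivial⇒≢1 {{prime⇒nonTrivial pp}} refl })
prime∤! pp (suc k) k<p p∣ with euclidsLemma (suc k) (k !) pp p∣
... | inj₁ p∣1+k = >⇒∤ k<p p∣1+k
... | inj₂ p∣k! = prime∤! pp k (ℕ.<-trans (ℕ.n<1+n k) k<p) p∣k!

-- p divides p! = C(p,k) k! (p - k)! but neither of the two factorials.
prime∣C : ∀ {p} → Prime p → ∀ k → 0 < k → k < p → p ∣ p choose k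
prime∣C {p@(suc p-1)} pp k 0<k k<p
  with euclidsLemma (p choose k) (k ! ℕ.* (p ∸ k) !) pp
         (subst (p ∣_) (sym (trans (cong (ℕ._* (k ! ℕ.* (p ∸ k) !)) (nCk≡n!/k![n-k]! (ℕ.<⇒≤ k<p)))
                                   (m/n*n≡m {{k ℕ.!* (p ∸ k) !≢0}} (k![n∸k]!∣n! (ℕ.<⇒≤ k<p)))))
                (m∣m*n (p-1 !)))
... | inj₁ p∣C = p∣C
... | inj₂ p∣k![p-k]! with euclidsLemma (k !) ((p ∸ k) !) pp p∣k![p-k]!
... | inj₁ p∣k! = contradiction p∣k! (prime∤! pp k k<p)
... | inj₂ p∣[p-k]! = contradiction p∣[p-k]! (prime∤! pp (p ∸ k) (ℕ.∸-monoʳ-< 0<k (ℕ.<⇒≤ k<p)))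

module Characteristic {n : ℕ} (K : FiniteField n) {p : ℕ} (pp : Prime p)
  (p·1≡0 : FieldTheory._·_ K p (FiniteField.1# K) ≡ FiniteField.0# K) where
  open FieldTheory K
  open ≡-Reasoning
  open import Algebra.Properties.CommutativeSemiring.Binomial (CommutativeRing.commutativeSemiring commutativeRing)
    using (theorem; binomialTerm)
  open import Algebra.Properties.Semiring.Mult (FiniteField.semiring K) using (×-assocˡ; ×-assoc-*; ×-homo-1)
  open import Algebra.Properties.Monoid.Sum (CommutativeRing.+-monoid commutativeRing) using (sum-init-last; sum-replicate-zero)

  multiple-zero : ∀ {m} → p ∣ m → ∀ x → m · x ≡ 0#
  multiple-zero {m} (divides c refl) x = begin
    (c ℕ.* p) · x ≡⟨ cong (_· x) (ℕ.*-comm c p) ⟩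
    (p ℕ.* c) · x ≡⟨ ×-assocˡ x p c ⟨
    p · (c · x) ≡⟨ cong (p ·_) (*-identityˡ (c · x)) ⟨
    p · (1# * c · x) ≡⟨ ×-assoc-* p 1# (c · x) ⟨
    p · 1# * c · x ≡⟨ cong (_* c · x) p·1≡0 ⟩
    0# * c · x ≡⟨ zeroˡ _ ⟩
    0# ∎

  freshman : ∀ x y → (x + y) ^ᶠ p ≡ x ^ᶠ p + y ^ᶠ p
  freshman x y = go p pp p·1≡0 refl
    where
    -- The exponent is generalised to some m ≡ p so that it can be matched as a successor, which
    -- exposes the two outer terms of the binomial sum.
    go : ∀ m → Prime m → m · 1# ≡ 0# → m ≡ p → (x + y) ^ᶠ m ≡ x ^ᶠ m + y ^ᶠ m
    go zero pm _ _ = contradiction refl (ℕ.≢-nonZero⁻¹ 0 {{prime⇒nonZero pm}})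
    go (suc m) pm _ refl = begin
      (x + y) ^ᶠ suc m ≡⟨ theorem (suc m) x y ⟩
      t zero + sum (t ∘ suc) ≡⟨ cong (t zero +_) (sum-init-last (t ∘ suc)) ⟩
      t zero + (sum (t ∘ suc ∘ inject₁) + t (fromℕ (suc m)))
        ≡⟨ cong₂ (λ u v → u + (v + t (fromℕ (suc m)))) first middle ⟩
      y ^ᶠ suc m + (0# + t (fromℕ (suc m))) ≡⟨ cong (λ w → y ^ᶠ suc m + (0# + w)) last ⟩
      y ^ᶠ suc m + (0# + x ^ᶠ suc m) ≡⟨ solve 2 (λ a b → b ⊕ (𝟘 ⊕ a) ⊜ a ⊕ b) refl (x ^ᶠ suc m) (y ^ᶠ suc m) ⟩
      x ^ᶠ suc m + y ^ᶠ suc m ∎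
      where
      t = binomialTerm x y (suc m)
      first : t zero ≡ y ^ᶠ suc m
      first = trans (×-homo-1 _) (*-identityˡ _)
      last : t (fromℕ (suc m)) ≡ x ^ᶠ suc m
      last = begin
        (suc m choose toℕ (fromℕ (suc m))) · (x ^ᶠ toℕ (fromℕ (suc m)) * y ^ᶠ (suc m ∸ toℕ (fromℕ (suc m))))
          ≡⟨ cong (λ k → (suc m choose k) · (x ^ᶠ k * y ^ᶠ (suc m ∸ k))) (Fin.toℕ-fromℕ (suc m)) ⟩
        (suc m choose suc m) · (x ^ᶠ suc m * y ^ᶠ (m ∸ m))
          ≡⟨ cong₂ (λ a b → a · (x ^ᶠ suc m * y ^ᶠ b)) (nCn≡1 (suc m)) (ℕ.n∸n≡0 m) ⟩
        1 · (x ^ᶠ suc m * 1#) ≡⟨ ×-homo-1 _ ⟩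
        x ^ᶠ suc m * 1# ≡⟨ *-identityʳ _ ⟩
        x ^ᶠ suc m ∎
      middle : sum (t ∘ suc ∘ inject₁) ≡ 0#
      middle = trans (sum-cong-≗ (λ i → multiple-zero (prime∣C pm _ (s≤s z≤n) (s≤s (bound i))) _)) (sum-replicate-zero m)
        where
        bound : ∀ (i : Fin m) → toℕ (inject₁ i) < m
        bound i = subst (_< m) (sym (Fin.toℕ-inject₁ i)) (Fin.toℕ<n i)

  freshman^ : ∀ k x y → (x + y) ^ᶠ (p ℕ.^ k) ≡ x ^ᶠ (p ℕ.^ k) + y ^ᶠ (p ℕ.^ k)
  freshman^ zero x y = trans (*-identityʳ _) (sym (cong₂ _+_ (*-identityʳ x) (*-identityʳ y)))
  freshman^ (suc k) x y = begin
    (x + y) ^ᶠ (p ℕ.* r) ≡⟨ ^-assocʳ (x + y) p r ⟨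
    ((x + y) ^ᶠ p) ^ᶠ r ≡⟨ cong (_^ᶠ r) (freshman x y) ⟩
    (x ^ᶠ p + y ^ᶠ p) ^ᶠ r ≡⟨ freshman^ k _ _ ⟩
    (x ^ᶠ p) ^ᶠ r + (y ^ᶠ p) ^ᶠ r ≡⟨ cong₂ _+_ (^-assocʳ x p r) (^-assocʳ y p r) ⟩
    x ^ᶠ (p ℕ.* r) + y ^ᶠ (p ℕ.* r) ∎
    where r = p ℕ.^ k

module CubicTheory {q : ℕ} (primePower : PrimePower q) (2≤q : 2 ≤ q) (E : CubicExtension q) where
  open CubicExtension E public
  open IsRingHomomorphism isRingHomomorphism public using (+-homo; *-homo; -‿homo; 0#-homo; 1#-homo)
  module 𝔽 = FieldTheory F
  module 𝕂 = FieldTheory K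
  open 𝕂
  open ≡-Reasoning

  -- Stated for an arbitrary homomorphism because it is needed for `embed` and for the one delivered
  -- by the fundamental theorem.
  homo-injective : ∀ {σ : 𝔽.Carrier → Carrier} →
                   IsRingHomomorphism (FiniteField.rawRing F) (FiniteField.rawRing K) σ → Injective _≡_ _≡_ σ
  homo-injective {σ} σ-homo {a} {b} e with a 𝔽.+ 𝔽.- b 𝔽.≟ 𝔽.0#
  ... | yes d = 𝔽.difference-zero d
  ... | no ne with 𝔽.invertible _ ne
  ... | c , cd≡1 = contradiction (begin
    0# ≡⟨ zeroʳ (σ c) ⟨
    σ c * 0# ≡⟨ cong (σ c *_) (-‿inverseʳ (σ a)) ⟨
    σ c * (σ a + - σ a) ≡⟨ cong (λ w → σ c * (σ a + - w)) e ⟩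
    σ c * (σ a + - σ b) ≡⟨ cong (λ w → σ c * (σ a + w)) (S.-‿homo b) ⟨
    σ c * (σ a + σ (𝔽.- b)) ≡⟨ cong (σ c *_) (S.+-homo a (𝔽.- b)) ⟨
    σ c * σ (a 𝔽.+ 𝔽.- b) ≡⟨ S.*-homo c _ ⟨
    σ (c 𝔽.* (a 𝔽.+ 𝔽.- b)) ≡⟨ cong σ cd≡1 ⟩
    σ 𝔽.1# ≡⟨ S.1#-homo ⟩
    1# ∎) 0≢1
    where module S = IsRingHomomorphism σ-homo

  embed-injective : Injective _≡_ _≡_ embed
  embed-injective = homo-injective isRingHomomorphism

  homo-^ : ∀ {σ : 𝔽.Carrier → Carrier} →
           IsRingHomomorphism (FiniteField.rawRing F) (FiniteField.rawRing K) σ →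
           ∀ a k → σ (a 𝔽.^ᶠ k) ≡ σ a ^ᶠ k
  homo-^ σ-homo a zero = IsRingHomomorphism.1#-homo σ-homo
  homo-^ {σ} σ-homo a (suc k) = trans (IsRingHomomorphism.*-homo σ-homo a _) (cong (σ a *_) (homo-^ σ-homo a k))

  private
    p k : ℕ
    p = proj₁ primePower
    k = proj₁ (proj₂ primePower)
    pp : Prime p
    pp = proj₁ (proj₂ (proj₂ primePower))
    q≡p^ : q ≡ p ℕ.^ suc k
    q≡p^ = proj₂ (proj₂ (proj₂ primePower))

    power·1 : ∀ m j → (m ℕ.^ j) · 1# ≡ (m · 1#) ^ᶠ j
    power·1 m zero = +-identityʳ 1#
    power·1 m (suc j) = trans (×1-homo-* m (m ℕ.^ j)) (cong (m · 1# *_) (power·1 m j))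

    -- K has q³ elements, so q³ · 1 = 0; this is a power of p · 1, and a field has no nilpotents.
    p·1≡0 : p · 1# ≡ 0#
    p·1≡0 = zero-^ (suc k) (zero-^ 3 (begin
      ((p · 1#) ^ᶠ suc k) ^ᶠ 3 ≡⟨ cong (_^ᶠ 3) (power·1 p (suc k)) ⟨
      ((p ℕ.^ suc k) · 1#) ^ᶠ 3 ≡⟨ cong (λ r → (r · 1#) ^ᶠ 3) q≡p^ ⟨
      (q · 1#) ^ᶠ 3 ≡⟨ power·1 q 3 ⟨
      (q ℕ.^ 3) · 1# ≡⟨ n·1≡0 ⟩
      0# ∎))

  open Characteristic K pp p·1≡0

  φ : Carrier → Carrier
  φ x = x ^ᶠ q

  φ-+ : ∀ x y → φ (x + y) ≡ φ x + φ y
  φ-+ x y = subst (λ r → (x + y) ^ᶠ r ≡ x ^ᶠ r + y ^ᶠ r) (sym q≡p^) (freshman^ (suc k) x y)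

  φ-* : ∀ x y → φ (x * y) ≡ φ x * φ y
  φ-* x y = ^-distrib-* x y q

  φ-embed : ∀ a → φ (embed a) ≡ embed a
  φ-embed a = trans (sym (homo-^ isRingHomomorphism a q)) (cong embed (𝔽.fermat a))

  φ-0 : φ 0# ≡ 0#
  φ-0 = trans (cong φ (sym 0#-homo)) (trans (φ-embed 𝔽.0#) 0#-homo)

  φ-1 : φ 1# ≡ 1#
  φ-1 = trans (cong φ (sym 1#-homo)) (trans (φ-embed 𝔽.1#) 1#-homo)

  φ³ : ∀ x → φ (φ (φ x)) ≡ x
  φ³ x = begin
    ((x ^ᶠ q) ^ᶠ q) ^ᶠ q ≡⟨ cong (_^ᶠ q) (^-assocʳ x q q) ⟩
    (x ^ᶠ (q ℕ.* q)) ^ᶠ q ≡⟨ ^-assocʳ x (q ℕ.* q) q ⟩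
    x ^ᶠ (q ℕ.* q ℕ.* q) ≡⟨ cong (x ^ᶠ_) (trans (ℕ.*-assoc q q q) (cong (λ r → q ℕ.* (q ℕ.* r)) (sym (ℕ.*-identityʳ q)))) ⟩
    x ^ᶠ (q ℕ.^ 3) ≡⟨ fermat x ⟩
    x ∎

  φ-injective : Injective _≡_ _≡_ φ
  φ-injective {x} {y} e = trans (sym (φ³ x)) (trans (cong (φ ∘ φ) e) (φ³ y))

  φ-zero : ∀ {x} → φ x ≡ 0# → x ≡ 0#
  φ-zero e = φ-injective (trans e (sym φ-0))

  private
    fixed-polynomial : ∃ λ (cs : Vec Carrier q) → ∀ x → monic cs x ≡ φ x + - x
    -- The polynomial is x^q - x; 2 ≤ q keeps its linear term below the leading one.
    fixed-polynomial = let cs , e = monic-add (replicate q 0#) (- 1#) {1} 2≤q in cs , λ x →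
      trans (e x) (trans (cong (_+ - 1# * (x * 1#)) (monic-power q x))
        (solve 2 (λ x y → y ⊕ (⊝ 𝟙) ⊗ (x ⊗ 𝟙) ⊜ y ⊕ ⊝ x) refl x (φ x)))

  -- The q elements of F already supply q roots of x^q - x; a fixed element outside the image would
  -- be one too many.
  fixed⇒embedded : ∀ {x} → φ x ≡ x → ∃ λ a → embed a ≡ x
  fixed⇒embedded {x} φx≡x with any-finite? 𝔽.enumeration (λ a → embed a ≟ x)
  ... | yes found = found
  ... | no none = contradiction roots (monic-root-bound (proj₁ fixed-polynomial) points-of points-injective)
    where
    points-of : Fin (suc q) → Carrier
    points-of zero = x
    points-of (suc i) = embed (𝔽.element i)
    points-injective : Injective _≡_ _≡_ points-of
    points-injective {zero} {zero} _ = refl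
    points-injective {zero} {suc j} e = contradiction (_ , sym e) none
    points-injective {suc i} {zero} e = contradiction (_ , e) none
    points-injective {suc i} {suc j} e = cong suc (𝔽.element-injective (embed-injective e))
    root : ∀ {y} → φ y ≡ y → monic (proj₁ fixed-polynomial) y ≡ 0#
    root {y} e = trans (proj₂ fixed-polynomial y) (trans (cong (_+ - y) e) (-‿inverseʳ y))
    roots : ∀ i → monic (proj₁ fixed-polynomial) (points-of i) ≡ 0#
    roots zero = root φx≡x
    roots (suc i) = root (φ-embed (𝔽.element i))

  tr : Carrier → Carrier
  tr x = x + (φ x + φ (φ x))

  φ-tr : ∀ x → φ (tr x) ≡ tr x
  φ-tr x = begin
    φ (x + (φ x + φ (φ x))) ≡⟨ trans (φ-+ _ _) (cong (φ x +_) (φ-+ _ _)) ⟩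
    φ x + (φ (φ x) + φ (φ (φ x))) ≡⟨ cong (λ w → φ x + (φ (φ x) + w)) (φ³ x) ⟩
    φ x + (φ (φ x) + x) ≡⟨ solve 3 (λ x y z → y ⊕ (z ⊕ x) ⊜ x ⊕ (y ⊕ z)) refl x (φ x) (φ (φ x)) ⟩
    x + (φ x + φ (φ x)) ∎

  private
    q<q² : q < q ℕ.* q
    q<q² = ℕ.m<m*n q q {{ℕ.>-nonZero (ℕ.<-trans (s≤s z≤n) 2≤q)}} 2≤q
    q²<q³ : q ℕ.* q < q ℕ.^ 3
    q²<q³ = subst (q ℕ.* q <_) (trans (ℕ.*-assoc q q q) (cong (λ r → q ℕ.* (q ℕ.* r)) (sym (ℕ.*-identityʳ q))))
      (ℕ.m<m*n (q ℕ.* q) q {{ℕ.>-nonZero (ℕ.<-trans (ℕ.<-trans (s≤s z≤n) 2≤q) q<q²)}} 2≤q)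

    trace-polynomial : ∃ λ (cs : Vec Carrier (q ℕ.* q)) → ∀ x → monic cs x ≡ tr x
    trace-polynomial =
      let cs , e = monic-add (replicate (q ℕ.* q) 0#) 1# q<q²
          ds , e′ = monic-add cs 1# {1} (ℕ.<-trans 2≤q q<q²)
      in ds , λ x → begin
        monic ds x ≡⟨ e′ x ⟩
        monic cs x + 1# * (x * 1#) ≡⟨ cong (_+ 1# * (x * 1#)) (trans (e x) (cong (_+ 1# * φ x) (monic-power (q ℕ.* q) x))) ⟩
        (x ^ᶠ (q ℕ.* q) + 1# * φ x) + 1# * (x * 1#) ≡⟨ cong (λ w → (w + 1# * φ x) + 1# * (x * 1#)) (^-assocʳ x q q) ⟨
        (φ (φ x) + 1# * φ x) + 1# * (x * 1#) ≡⟨ solve 3 (λ x y z → (z ⊕ 𝟙 ⊗ y) ⊕ 𝟙 ⊗ (x ⊗ 𝟙) ⊜ x ⊕ (y ⊕ z)) refl x (φ x) (φ (φ x)) ⟩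
        tr x ∎

  φ-inverse : ∀ {x y} → φ x ≡ x → y * x ≡ 1# → φ y ≡ y
  φ-inverse {x} {y} φx≡x yx≡1 = *-cancelˡ {x} x≢0 (begin
    x * φ y ≡⟨ cong (_* φ y) φx≡x ⟨
    φ x * φ y ≡⟨ φ-* x y ⟨
    φ (x * y) ≡⟨ cong φ xy≡1 ⟩
    φ 1# ≡⟨ φ-1 ⟩
    1# ≡⟨ xy≡1 ⟨
    x * y ∎)
    where
    xy≡1 = trans (*-comm x y) yx≡1
    x≢0 : x ≢ 0#
    x≢0 = factor-nonzero xy≡1

  -- As a polynomial of degree q² < q³ the trace is not identically zero. A nonzero value is fixed
  -- by Frobenius, and so is its inverse, which therefore passes through the trace. The simple
  -- candidate 1 has trace 3, which is 0 in characteristic 3.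
  trace-one : ∃ λ x → tr x ≡ 1#
  trace-one =
    let cs , e = trace-polynomial
        x , ne = monic-nonroot cs q²<q³
        y , yt≡1 = invertible (tr x) (ne ∘ trans (e x))
        φy≡y = φ-inverse (φ-tr x) yt≡1
        φyx : φ (y * x) ≡ y * φ x
        φyx = trans (φ-* y x) (cong (_* φ x) φy≡y)
        φφyx : φ (φ (y * x)) ≡ y * φ (φ x)
        φφyx = trans (cong φ φyx) (trans (φ-* y (φ x)) (cong (_* φ (φ x)) φy≡y))
    in y * x , (begin
      y * x + (φ (y * x) + φ (φ (y * x))) ≡⟨ cong₂ (λ u v → y * x + (u + v)) φyx φφyx ⟩
      y * x + (y * φ x + y * φ (φ x)) ≡⟨ solve 4 (λ y a b c → y ⊗ a ⊕ (y ⊗ b ⊕ y ⊗ c) ⊜ y ⊗ (a ⊕ (b ⊕ c))) refl y x (φ x) (φ (φ x)) ⟩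
      y * tr x ≡⟨ yt≡1 ⟩
      1# ∎)

-- Linear algebra

module VectorTheory {q : ℕ} (F : FiniteField q) where
  open FieldTheory F
  open ≡-Reasoning

  V : ℕ → Set
  V = Vector F

  infixl 6 _⊞_
  infixr 7 _⊡_

  _⊞_ : ∀ {n} → V n → V n → V n
  _⊞_ = zipWith _+_

  _⊡_ : ∀ {n} → Carrier → V n → V n
  _⊡_ = scale F

  infix 4 _∝_
  -- Unlike in `_~_` the factor may be 0; when u is the coordinate vector of a point it is nonzero
  -- anyway.
  _∝_ : ∀ {n} → V n → V n → Set
  u ∝ v = ∃ λ c → u ≡ c ⊡ v

  𝟎 : ∀ {n} → V n
  𝟎 = 0ᵛ F

  infix 4 _≟ᵛ_
  _≟ᵛ_ : ∀ {n} (u v : V n) → Dec (u ≡ v)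
  _≟ᵛ_ = Vec.≡-dec _≟_

  ⊞-identityˡ : ∀ {n} (v : V n) → 𝟎 ⊞ v ≡ v
  ⊞-identityˡ [] = refl
  ⊞-identityˡ (x ∷ v) = cong₂ _∷_ (+-identityˡ x) (⊞-identityˡ v)

  ⊞-identityʳ : ∀ {n} (v : V n) → v ⊞ 𝟎 ≡ v
  ⊞-identityʳ [] = refl
  ⊞-identityʳ (x ∷ v) = cong₂ _∷_ (+-identityʳ x) (⊞-identityʳ v)

  ⊞-comm : ∀ {n} (u v : V n) → u ⊞ v ≡ v ⊞ u
  ⊞-comm [] [] = refl
  ⊞-comm (x ∷ u) (y ∷ v) = cong₂ _∷_ (+-comm x y) (⊞-comm u v)

  ⊞-assoc : ∀ {n} (u v w : V n) → (u ⊞ v) ⊞ w ≡ u ⊞ (v ⊞ w)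
  ⊞-assoc [] [] [] = refl
  ⊞-assoc (x ∷ u) (y ∷ v) (z ∷ w) = cong₂ _∷_ (+-assoc x y z) (⊞-assoc u v w)

  ⊞-interchange : ∀ {n} (s t u v : V n) → (s ⊞ t) ⊞ (u ⊞ v) ≡ (s ⊞ u) ⊞ (t ⊞ v)
  ⊞-interchange [] [] [] [] = refl
  ⊞-interchange (x ∷ s) (y ∷ t) (z ∷ u) (w ∷ v) = cong₂ _∷_
    (solve 4 (λ x y z w → (x ⊕ y) ⊕ (z ⊕ w) ⊜ (x ⊕ z) ⊕ (y ⊕ w)) refl x y z w) (⊞-interchange s t u v)

  ⊡-distribˡ : ∀ {n} c (u v : V n) → c ⊡ (u ⊞ v) ≡ c ⊡ u ⊞ c ⊡ v
  ⊡-distribˡ c [] [] = refl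
  ⊡-distribˡ c (x ∷ u) (y ∷ v) = cong₂ _∷_ (distribˡ c x y) (⊡-distribˡ c u v)

  ⊡-distribʳ : ∀ {n} c d (v : V n) → (c + d) ⊡ v ≡ c ⊡ v ⊞ d ⊡ v
  ⊡-distribʳ c d [] = refl
  ⊡-distribʳ c d (x ∷ v) = cong₂ _∷_ (distribʳ x c d) (⊡-distribʳ c d v)

  ⊡-assoc : ∀ {n} c d (v : V n) → (c * d) ⊡ v ≡ c ⊡ d ⊡ v
  ⊡-assoc c d [] = refl
  ⊡-assoc c d (x ∷ v) = cong₂ _∷_ (*-assoc c d x) (⊡-assoc c d v)

  ⊡-identity : ∀ {n} (v : V n) → 1# ⊡ v ≡ v
  ⊡-identity [] = refl
  ⊡-identity (x ∷ v) = cong₂ _∷_ (*-identityˡ x) (⊡-identity v)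

  ⊡-zeroˡ : ∀ {n} (v : V n) → 0# ⊡ v ≡ 𝟎
  ⊡-zeroˡ [] = refl
  ⊡-zeroˡ (x ∷ v) = cong₂ _∷_ (zeroˡ x) (⊡-zeroˡ v)

  ⊡-zeroʳ : ∀ {n} c → c ⊡ 𝟎 {n} ≡ 𝟎
  ⊡-zeroʳ {zero} c = refl
  ⊡-zeroʳ {suc n} c = cong₂ _∷_ (zeroʳ c) (⊡-zeroʳ c)

  ⊡-inverse : ∀ {n} {c d} → d * c ≡ 1# → (v : V n) → d ⊡ c ⊡ v ≡ v
  ⊡-inverse {c = c} {d} dc≡1 v = trans (sym (⊡-assoc d c v)) (trans (cong (_⊡ v) dc≡1) (⊡-identity v))

  ⊡-zero-divisor : ∀ {n} {c} {v : V n} → c ≢ 0# → c ⊡ v ≡ 𝟎 → v ≡ 𝟎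
  ⊡-zero-divisor {c = c} {v} c≢0 e with invertible c c≢0
  ... | d , dc≡1 = trans (sym (⊡-inverse dc≡1 v)) (trans (cong (d ⊡_) e) (⊡-zeroʳ d))

  ⊡-nonzero : ∀ {n} {c} {v : V n} → c ≢ 0# → v ≢ 𝟎 → c ⊡ v ≢ 𝟎
  ⊡-nonzero c≢0 v≢0 e = v≢0 (⊡-zero-divisor c≢0 e)

  ⊡-zero-scalar : ∀ {n} {c} {v : V n} → v ≢ 𝟎 → c ⊡ v ≡ 𝟎 → c ≡ 0#
  ⊡-zero-scalar {c = c} v≢0 e with c ≟ 0#
  ... | yes c≡0 = c≡0
  ... | no c≢0 = contradiction (⊡-zero-divisor c≢0 e) v≢0

  ⊞-cancel : ∀ {n} (u v : V n) → (u ⊞ v) ⊞ (- 1#) ⊡ v ≡ u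
  ⊞-cancel [] [] = refl
  ⊞-cancel (x ∷ u) (y ∷ v) = cong₂ _∷_ (solve 2 (λ x y → (x ⊕ y) ⊕ (⊝ 𝟙) ⊗ y ⊜ x) refl x y) (⊞-cancel u v)

  ⊟-cancel : ∀ {n} (u v : V n) → (u ⊞ (- 1#) ⊡ v) ⊞ v ≡ u
  ⊟-cancel [] [] = refl
  ⊟-cancel (x ∷ u) (y ∷ v) = cong₂ _∷_ (solve 2 (λ x y → (x ⊕ (⊝ 𝟙) ⊗ y) ⊕ y ⊜ x) refl x y) (⊟-cancel u v)

  ⊟-zero : ∀ {n} {u v : V n} → u ⊞ (- 1#) ⊡ v ≡ 𝟎 → u ≡ v
  ⊟-zero {u = u} {v} e = trans (sym (⊟-cancel u v)) (trans (cong (_⊞ v) e) (⊞-identityˡ v))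

  ⊟-self : ∀ {n} (v : V n) → v ⊞ (- 1#) ⊡ v ≡ 𝟎
  ⊟-self [] = refl
  ⊟-self (x ∷ v) = cong₂ _∷_ (solve 1 (λ x → x ⊕ (⊝ 𝟙) ⊗ x ⊜ 𝟘) refl x) (⊟-self v)

  record IsLinear {m n} (f : V m → V n) : Set where
    field
      ⊞-homo : ∀ u v → f (u ⊞ v) ≡ f u ⊞ f v
      ⊡-homo : ∀ c v → f (c ⊡ v) ≡ c ⊡ f v

    𝟎-homo : f 𝟎 ≡ 𝟎
    𝟎-homo = trans (cong f (sym (⊡-zeroˡ 𝟎))) (trans (⊡-homo 0# 𝟎) (⊡-zeroˡ _))

    kernel⇒injective : (∀ v → f v ≡ 𝟎 → v ≡ 𝟎) → Injective _≡_ _≡_ f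
    kernel⇒injective ker {u} {v} e = ⊟-zero (ker _ (begin
      f (u ⊞ (- 1#) ⊡ v) ≡⟨ ⊞-homo u _ ⟩
      f u ⊞ f ((- 1#) ⊡ v) ≡⟨ cong₂ _⊞_ e (⊡-homo _ v) ⟩
      f v ⊞ (- 1#) ⊡ f v ≡⟨ ⊟-self (f v) ⟩
      𝟎 ∎))

    injective⇒kernel : Injective _≡_ _≡_ f → ∀ v → f v ≡ 𝟎 → v ≡ 𝟎
    injective⇒kernel inj v e = inj (trans e (sym 𝟎-homo))

  open IsLinear

  module _ {n k} (vs : Vec (V n) k) where
    comb : V k → V n
    comb cs = combination F cs vs

  comb-linear : ∀ {n k} (vs : Vec (V n) k) → IsLinear (comb vs)
  ⊞-homo (comb-linear []) [] [] = sym (⊞-identityˡ _)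
  ⊞-homo (comb-linear (v ∷ vs)) (c ∷ cs) (d ∷ ds) =
    trans (cong₂ _⊞_ (⊡-distribʳ c d v) (⊞-homo (comb-linear vs) cs ds)) (⊞-interchange _ _ _ _)
  ⊡-homo (comb-linear []) a [] = sym (⊡-zeroʳ a)
  ⊡-homo (comb-linear (v ∷ vs)) a (c ∷ cs) =
    trans (cong₂ _⊞_ (⊡-assoc a c v) (⊡-homo (comb-linear vs) a cs)) (sym (⊡-distribˡ a _ _))

  comb-map : ∀ {l m n} {f : V m → V n} → IsLinear f → ∀ (vs : Vec (V m) l) cs → f (comb vs cs) ≡ comb (map f vs) cs
  comb-map lin [] [] = 𝟎-homo lin
  comb-map lin (v ∷ vs) (c ∷ cs) = trans (⊞-homo lin _ _) (cong₂ _⊞_ (⊡-homo lin c v) (comb-map lin vs cs))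

  ∘-linear : ∀ {l m n} {g : V m → V n} {f : V l → V m} → IsLinear g → IsLinear f → IsLinear (g ∘ f)
  ⊞-homo (∘-linear {g = g} lg lf) u v = trans (cong g (⊞-homo lf u v)) (⊞-homo lg _ _)
  ⊡-homo (∘-linear {g = g} lg lf) c v = trans (cong g (⊡-homo lf c v)) (⊡-homo lg _ _)

  -- A flat and a projectivity onto it are given by a list of basis vectors; this extracts such a
  -- list from a map known only to be linear.
  columns : ∀ {k n} {f : V k → V n} → IsLinear f → ∃ λ (vs : Vec (V n) k) → ∀ x → comb vs x ≡ f x
  columns {zero} {f = f} lin = [] , λ { [] → sym (𝟎-homo lin) }
  columns {suc k} {f = f} lin with columns {f = λ x → f (0# ∷ x)} tail-linear
    where
    tail-linear : IsLinear (λ x → f (0# ∷ x))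
    ⊞-homo tail-linear u v = trans (cong (λ z → f (z ∷ u ⊞ v)) (sym (+-identityˡ 0#))) (⊞-homo lin (0# ∷ u) (0# ∷ v))
    ⊡-homo tail-linear c v = trans (cong (λ z → f (z ∷ c ⊡ v)) (sym (zeroʳ c))) (⊡-homo lin c (0# ∷ v))
  ... | vs , e = f (1# ∷ 𝟎) ∷ vs , λ { (x ∷ xs) → begin
    x ⊡ f (1# ∷ 𝟎) ⊞ comb vs xs ≡⟨ cong₂ _⊞_ (sym (⊡-homo lin x _)) (e xs) ⟩
    f (x * 1# ∷ x ⊡ 𝟎) ⊞ f (0# ∷ xs) ≡⟨ ⊞-homo lin _ _ ⟨
    f (x * 1# + 0# ∷ x ⊡ 𝟎 ⊞ xs) ≡⟨ cong₂ (λ a b → f (a ∷ b)) (trans (+-identityʳ _) (*-identityʳ x))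
                                            (trans (cong (_⊞ xs) (⊡-zeroʳ x)) (⊞-identityˡ xs)) ⟩
    f (x ∷ xs) ∎ }

  module _ {n} (vs : Vec (V n) n) (ind : LinearlyIndependent F vs) where
    independent⇒injective : Injective _≡_ _≡_ (comb vs)
    independent⇒injective = kernel⇒injective (comb-linear vs) ind

    -- The combinations form an injective map from the finite set `V n` to itself.
    independent⇒spanning : ∀ v → Span F vs v
    independent⇒spanning = injective⇒surjective (vec-finite enumeration n) (vec-finite enumeration n) (comb vs) independent⇒injective

  spanning⇒independent : ∀ {n} (vs : Vec (V n) n) → (∀ v → Span F vs v) → LinearlyIndependent F vs
  spanning⇒independent {n} vs spans = injective⇒kernel (comb-linear vs)
    (surjective⇒injective (vec-finite enumeration n) (vec-finite enumeration n) (comb vs) spans)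

  lookup-𝟎 : ∀ {n} (v : V n) → (∀ i → lookup v i ≡ 0#) → v ≡ 𝟎
  lookup-𝟎 [] zeros = refl
  lookup-𝟎 (x ∷ v) zeros = cong₂ _∷_ (zeros zero) (lookup-𝟎 v (zeros ∘ suc))

  infix 8 _∙_
  _∙_ : ∀ {n} → V n → V n → Carrier
  _∙_ = dot F

  ∙-comm : ∀ {n} (u v : V n) → u ∙ v ≡ v ∙ u
  ∙-comm [] [] = refl
  ∙-comm (x ∷ u) (y ∷ v) = cong₂ _+_ (*-comm x y) (∙-comm u v)

  ∙-⊞ : ∀ {n} (u v w : V n) → u ∙ (v ⊞ w) ≡ u ∙ v + u ∙ w
  ∙-⊞ [] [] [] = sym (+-identityˡ 0#)
  ∙-⊞ (x ∷ u) (y ∷ v) (z ∷ w) = trans (cong (x * (y + z) +_) (∙-⊞ u v w))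
    (solve 5 (λ x y z a b → x ⊗ (y ⊕ z) ⊕ (a ⊕ b) ⊜ (x ⊗ y ⊕ a) ⊕ (x ⊗ z ⊕ b)) refl x y z (u ∙ v) (u ∙ w))

  ∙-⊡ : ∀ {n} (u : V n) c v → u ∙ (c ⊡ v) ≡ c * u ∙ v
  ∙-⊡ [] c [] = sym (zeroʳ c)
  ∙-⊡ (x ∷ u) c (y ∷ v) = trans (cong (x * (c * y) +_) (∙-⊡ u c v))
    (solve 4 (λ x c y a → x ⊗ (c ⊗ y) ⊕ c ⊗ a ⊜ c ⊗ (x ⊗ y ⊕ a)) refl x c y (u ∙ v))

  ∙-𝟎 : ∀ {n} (u : V n) → u ∙ 𝟎 ≡ 0#
  ∙-𝟎 [] = refl
  ∙-𝟎 (x ∷ u) = trans (cong₂ _+_ (zeroʳ x) (∙-𝟎 u)) (+-identityˡ 0#)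

  dual : ∀ {n} {v : V n} → v ≢ 𝟎 → ∃ λ u → u ∙ v ≡ 1#
  dual {v = []} v≢0 = contradiction refl v≢0
  dual {v = x ∷ v} v≢0 with x ≟ 0#
  ... | no x≢0 with invertible x x≢0
  ... | y , yx≡1 = y ∷ 𝟎 , (begin
    y * x + 𝟎 ∙ v ≡⟨ cong₂ _+_ yx≡1 (trans (∙-comm 𝟎 v) (∙-𝟎 v)) ⟩
    1# + 0# ≡⟨ +-identityʳ 1# ⟩
    1# ∎)
  dual {v = x ∷ v} v≢0 | yes refl with dual (λ { refl → v≢0 refl })
  ... | u , uv≡1 = 0# ∷ u , trans (cong₂ _+_ (zeroˡ 0#) uv≡1) (+-identityˡ 1#)

  ∙-comb : ∀ {n k} (u : V n) (vs : Vec (V n) k) cs → u ∙ comb vs cs ≡ cs ∙ map (u ∙_) vs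
  ∙-comb u [] [] = ∙-𝟎 u
  ∙-comb u (v ∷ vs) (c ∷ cs) = trans (∙-⊞ u (c ⊡ v) (comb vs cs)) (cong₂ _+_ (∙-⊡ u c v) (∙-comb u vs cs))

  ∙-diagonal : ∀ {n} (u v : V n) i → (∀ j → j ≢ i → lookup u j ≡ 0#) → u ∙ v ≡ lookup u i * lookup v i
  ∙-diagonal (x ∷ u) (y ∷ v) zero off = trans (cong (x * y +_) (trans (cong (_∙ v) (lookup-𝟎 u (λ j → off (suc j) λ ())))
    (trans (∙-comm 𝟎 v) (∙-𝟎 v)))) (+-identityʳ (x * y))
  ∙-diagonal (x ∷ u) (y ∷ v) (suc i) off = trans (cong₂ _+_ (trans (cong (_* y) (off zero λ ())) (zeroˡ y))
    (∙-diagonal u v i (λ j j≢i → off (suc j) (j≢i ∘ Fin.suc-injective)))) (+-identityˡ _)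

  unit : ∀ {n} → Fin n → V n
  unit zero = 1# ∷ 𝟎
  unit (suc i) = 0# ∷ unit i

  lookup-unit : ∀ {n} (i : Fin n) → lookup (unit i) i ≡ 1#
  lookup-unit zero = refl
  lookup-unit (suc i) = lookup-unit i

  lookup-unit-≢ : ∀ {n} (i j : Fin n) → j ≢ i → lookup (unit i) j ≡ 0#
  lookup-unit-≢ zero zero j≢i = contradiction refl j≢i
  lookup-unit-≢ zero (suc j) j≢i = Vec.lookup-replicate j 0#
  lookup-unit-≢ (suc i) zero j≢i = refl
  lookup-unit-≢ (suc i) (suc j) j≢i = lookup-unit-≢ i j (j≢i ∘ cong suc)

  unit-∙ : ∀ {n} (i : Fin n) v → unit i ∙ v ≡ lookup v i
  unit-∙ i v = trans (∙-diagonal (unit i) v i (lookup-unit-≢ i)) (trans (cong (_* lookup v i) (lookup-unit i)) (*-identityˡ _))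

  ∙-nondegenerate : ∀ {n} (v : V n) → (∀ u → u ∙ v ≡ 0#) → v ≡ 𝟎
  ∙-nondegenerate v vanish with v ≟ᵛ 𝟎
  ... | yes e = e
  ... | no ne = contradiction (trans (sym (proj₂ (dual ne))) (vanish (proj₁ (dual ne)))) 1≢0

-- Instantiated with `embed`, with the Frobenius map of K and with the homomorphism from the
-- fundamental theorem.
module HomTheory {m n} {A : FiniteField m} {B : FiniteField n} (f : FiniteField.Carrier A → FiniteField.Carrier B)
  (f-+ : ∀ x y → f (FiniteField._+_ A x y) ≡ FiniteField._+_ B (f x) (f y))
  (f-* : ∀ x y → f (FiniteField._*_ A x y) ≡ FiniteField._*_ B (f x) (f y))
  (f-0 : f (FiniteField.0# A) ≡ FiniteField.0# B) where
  private
    module A = FieldTheory A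
    module B = FieldTheory B
    module VA = VectorTheory A
    module VB = VectorTheory B

  map-⊞ : ∀ {k} (u v : VA.V k) → map f (u VA.⊞ v) ≡ map f u VB.⊞ map f v
  map-⊞ [] [] = refl
  map-⊞ (x ∷ u) (y ∷ v) = cong₂ _∷_ (f-+ x y) (map-⊞ u v)

  map-⊡ : ∀ {k} c (v : VA.V k) → map f (c VA.⊡ v) ≡ f c VB.⊡ map f v
  map-⊡ c [] = refl
  map-⊡ c (x ∷ v) = cong₂ _∷_ (f-* c x) (map-⊡ c v)

  map-𝟎 : ∀ {k} → map f (VA.𝟎 {k}) ≡ VB.𝟎
  map-𝟎 {k} = trans (Vec.map-replicate f A.0# k) (cong (replicate k) f-0)

  map-comb : ∀ {k l} (vs : Vec (VA.V l) k) cs → map f (VA.comb vs cs) ≡ VB.comb (map (map f) vs) (map f cs)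
  map-comb [] [] = map-𝟎
  map-comb (v ∷ vs) (c ∷ cs) = trans (map-⊞ _ _) (cong₂ VB._⊞_ (map-⊡ c v) (map-comb vs cs))

  map-∙ : ∀ {k} (u v : VA.V k) → f (u VA.∙ v) ≡ map f u VB.∙ map f v
  map-∙ [] [] = f-0
  map-∙ (x ∷ u) (y ∷ v) = trans (f-+ _ _) (cong₂ B._+_ (f-* x y) (map-∙ u v))

-- Conics

module Cross {q : ℕ} (F : FiniteField q) where
  open FieldTheory F
  open VectorTheory F

  infixl 7 _⨯_
  _⨯_ : V 3 → V 3 → V 3
  (a ∷ b ∷ c ∷ []) ⨯ (x ∷ y ∷ z ∷ []) =
    (b * z + - (c * y)) ∷ (c * x + - (a * z)) ∷ (a * y + - (b * x)) ∷ []

  ∙-⨯ˡ : ∀ u v → u ∙ (u ⨯ v) ≡ 0#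
  ∙-⨯ˡ (a ∷ b ∷ c ∷ []) (x ∷ y ∷ z ∷ []) =
    solve 6 (λ a b c x y z → a ⊗ (b ⊗ z ⊕ ⊝ (c ⊗ y)) ⊕ (b ⊗ (c ⊗ x ⊕ ⊝ (a ⊗ z)) ⊕ (c ⊗ (a ⊗ y ⊕ ⊝ (b ⊗ x)) ⊕ 𝟘)) ⊜ 𝟘) refl a b c x y z

  ∙-⨯ʳ : ∀ u v → v ∙ (u ⨯ v) ≡ 0#
  ∙-⨯ʳ (a ∷ b ∷ c ∷ []) (x ∷ y ∷ z ∷ []) =
    solve 6 (λ a b c x y z → x ⊗ (b ⊗ z ⊕ ⊝ (c ⊗ y)) ⊕ (y ⊗ (c ⊗ x ⊕ ⊝ (a ⊗ z)) ⊕ (z ⊗ (a ⊗ y ⊕ ⊝ (b ⊗ x)) ⊕ 𝟘)) ⊜ 𝟘) refl a b c x y z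

  ⨯-⨯ : ∀ u v w → u ⨯ (v ⨯ w) ≡ (w ∙ u) ⊡ v ⊞ (- (v ∙ u)) ⊡ w
  ⨯-⨯ (a ∷ b ∷ c ∷ []) (x ∷ y ∷ z ∷ []) (r ∷ s ∷ t ∷ []) =
    cong₂ _∷_ (solve 9 (λ a b c x y z r s t →
       b ⊗ (x ⊗ s ⊕ ⊝ (y ⊗ r)) ⊕ ⊝ (c ⊗ (z ⊗ r ⊕ ⊝ (x ⊗ t))) ⊜
       (r ⊗ a ⊕ (s ⊗ b ⊕ (t ⊗ c ⊕ 𝟘))) ⊗ x ⊕ (⊝ (x ⊗ a ⊕ (y ⊗ b ⊕ (z ⊗ c ⊕ 𝟘)))) ⊗ r) refl a b c x y z r s t)
    (cong₂ _∷_ (solve 9 (λ a b c x y z r s t →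
       c ⊗ (y ⊗ t ⊕ ⊝ (z ⊗ s)) ⊕ ⊝ (a ⊗ (x ⊗ s ⊕ ⊝ (y ⊗ r))) ⊜
       (r ⊗ a ⊕ (s ⊗ b ⊕ (t ⊗ c ⊕ 𝟘))) ⊗ y ⊕ (⊝ (x ⊗ a ⊕ (y ⊗ b ⊕ (z ⊗ c ⊕ 𝟘)))) ⊗ s) refl a b c x y z r s t)
    (cong₂ _∷_ (solve 9 (λ a b c x y z r s t →
       a ⊗ (z ⊗ r ⊕ ⊝ (x ⊗ t)) ⊕ ⊝ (b ⊗ (y ⊗ t ⊕ ⊝ (z ⊗ s))) ⊜
       (r ⊗ a ⊕ (s ⊗ b ⊕ (t ⊗ c ⊕ 𝟘))) ⊗ z ⊕ (⊝ (x ⊗ a ⊕ (y ⊗ b ⊕ (z ⊗ c ⊕ 𝟘)))) ⊗ t) refl a b c x y z r s t)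
    refl))

  ⨯-zeroʳ : ∀ u → u ⨯ 𝟎 ≡ 𝟎
  ⨯-zeroʳ (a ∷ b ∷ c ∷ []) = cong₂ _∷_ (z b c) (cong₂ _∷_ (z c a) (cong₂ _∷_ (z a b) refl))
    where
    z : ∀ a b → a * 0# + - (b * 0#) ≡ 0#
    z = solve 2 (λ a b → a ⊗ 𝟘 ⊕ ⊝ (b ⊗ 𝟘) ⊜ 𝟘) refl

module ConicTheory {q : ℕ} (F : FiniteField q) (Q : TernaryQuadraticForm F) where
  open FieldTheory F
  open VectorTheory F
  open Cross F
  open TernaryQuadraticForm Q
  open ≡-Reasoning

  -- The polar form Q(u + v) - Q(u) - Q(v). In characteristic 2 it is alternating and does not
  -- determine Q, hence both are carried along.
  polar : V 3 → V 3 → Carrier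
  polar u v = gradient u ∙ v

  private
    -- `value` and `polar` as solver expressions. They have to agree with the unfolded definitions
    -- down to the final 0 of the dot product.
    module Syntax {n} (a b c f g h : Expr ℤ n) where
      val : (x y z : Expr ℤ n) → Expr ℤ n
      val x y z = a ⊗ x ⊗ x ⊕ b ⊗ y ⊗ y ⊕ c ⊗ z ⊗ z ⊕ f ⊗ y ⊗ z ⊕ g ⊗ z ⊗ x ⊕ h ⊗ x ⊗ y
      pol : (x y z u v w : Expr ℤ n) → Expr ℤ n
      pol x y z u v w = ((a ⊕ a) ⊗ x ⊕ h ⊗ y ⊕ g ⊗ z) ⊗ u ⊕ ((h ⊗ x ⊕ (b ⊕ b) ⊗ y ⊕ f ⊗ z) ⊗ v
                        ⊕ ((g ⊗ x ⊕ f ⊗ y ⊕ (c ⊕ c) ⊗ z) ⊗ w ⊕ 𝟘))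

  value-comb : ∀ s t u v → value (s ⊡ u ⊞ t ⊡ v) ≡ s * s * value u + s * t * polar u v + t * t * value v
  value-comb s t (x ∷ y ∷ z ∷ []) (u ∷ v ∷ w ∷ []) =
    solve 14 (λ a b c f g h s t x y z u v w → let open Syntax a b c f g h in
      val (s ⊗ x ⊕ t ⊗ u) (s ⊗ y ⊕ t ⊗ v) (s ⊗ z ⊕ t ⊗ w)
      ⊜ s ⊗ s ⊗ val x y z ⊕ s ⊗ t ⊗ pol x y z u v w ⊕ t ⊗ t ⊗ val u v w) refl a b c f g h s t x y z u v w

  value-⊡ : ∀ s u → value (s ⊡ u) ≡ s * s * value u
  value-⊡ s (x ∷ y ∷ z ∷ []) =
    solve 10 (λ a b c f g h s x y z → let open Syntax a b c f g h in
      val (s ⊗ x) (s ⊗ y) (s ⊗ z) ⊜ s ⊗ s ⊗ val x y z) refl a b c f g h s x y z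

  polar-comm : ∀ u v → polar u v ≡ polar v u
  polar-comm (x ∷ y ∷ z ∷ []) (u ∷ v ∷ w ∷ []) =
    solve 12 (λ a b c f g h x y z u v w → let open Syntax a b c f g h in
      pol x y z u v w ⊜ pol u v w x y z) refl a b c f g h x y z u v w

  polar-self : ∀ u → polar u u ≡ value u + value u
  polar-self (x ∷ y ∷ z ∷ []) =
    solve 9 (λ a b c f g h x y z → let open Syntax a b c f g h in
      pol x y z x y z ⊜ val x y z ⊕ val x y z) refl a b c f g h x y z

  polar-comb : ∀ u s t v w → polar u (s ⊡ v ⊞ t ⊡ w) ≡ s * polar u v + t * polar u w
  polar-comb u s t v w = trans (∙-⊞ (gradient u) (s ⊡ v) (t ⊡ w)) (cong₂ _+_ (∙-⊡ (gradient u) s v) (∙-⊡ (gradient u) t w))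

  -- R is a point of the conic, v₁ another point of the tangent at R, and v₂ a normalised vector off
  -- that tangent. In these coordinates Q becomes α z + f₁ y² + B₁₂ y z + f₂ z², linear in α: the
  -- lines through R parametrise the conic.
  module AdaptedBasis (nonDegenerate : NonDegenerate) (R v₁ v₂ : V 3) (fR≡0 : value R ≡ 0#)
    (Rv₁≡0 : polar R v₁ ≡ 0#) (Rv₂≡1 : polar R v₂ ≡ 1#)
    (basis-independent : LinearlyIndependent F (R ∷ v₁ ∷ v₂ ∷ [])) where
    private
      Rr≡0 : polar R R ≡ 0#
      Rr≡0 = trans (polar-self R) (trans (cong₂ _+_ fR≡0 fR≡0) (+-identityˡ 0#))

      basis : Vec (V 3) 3
      basis = R ∷ v₁ ∷ v₂ ∷ []

      f₁ f₂ B₁₂ : Carrier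
      f₁ = value v₁
      f₂ = value v₂
      B₁₂ = polar v₁ v₂

      value-basis : ∀ α y z → value (comb basis (α ∷ y ∷ z ∷ [])) ≡ α * z + (y * y * f₁ + y * z * B₁₂ + z * z * f₂)
      value-basis α y z = begin
        value (α ⊡ R ⊞ (y ⊡ v₁ ⊞ (z ⊡ v₂ ⊞ 𝟎)))
          ≡⟨ cong (λ w → value (α ⊡ R ⊞ w)) (trans (cong (y ⊡ v₁ ⊞_) (⊞-identityʳ _)) (sym (⊡-identity _))) ⟩
        value (α ⊡ R ⊞ 1# ⊡ (y ⊡ v₁ ⊞ z ⊡ v₂))
          ≡⟨ value-comb α 1# R _ ⟩
        α * α * value R + α * 1# * polar R (y ⊡ v₁ ⊞ z ⊡ v₂) + 1# * 1# * value (y ⊡ v₁ ⊞ z ⊡ v₂)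
          ≡⟨ cong₂ _+_ (cong₂ (λ a b → α * α * a + α * 1# * b) fR≡0
               (trans (polar-comb R y z v₁ v₂) (cong₂ _+_ (cong (y *_) Rv₁≡0) (cong (z *_) Rv₂≡1))))
               (cong (1# * 1# *_) (value-comb y z v₁ v₂)) ⟩
        α * α * 0# + α * 1# * (y * 0# + z * 1#) + 1# * 1# * (y * y * f₁ + y * z * B₁₂ + z * z * f₂)
          ≡⟨ solve 4 (λ α y z w → α ⊗ α ⊗ 𝟘 ⊕ α ⊗ 𝟙 ⊗ (y ⊗ 𝟘 ⊕ z ⊗ 𝟙) ⊕ 𝟙 ⊗ 𝟙 ⊗ w ⊜ α ⊗ z ⊕ w) refl α y z _ ⟩
        α * z + (y * y * f₁ + y * z * B₁₂ + z * z * f₂) ∎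

      -- Otherwise v₁ - B₁₂ R, where the line through R and v₁ meets the polar of v₂, is singular.
      f₁≢0 : f₁ ≢ 0#
      f₁≢0 f₁≡0 = nonDegenerate (point w w≢𝟎) (fw≡0 , gradient-w)
        where
        w : V 3
        w = (- B₁₂) ⊡ R ⊞ 1# ⊡ v₁
        w≡ : w ≡ comb basis (- B₁₂ ∷ 1# ∷ 0# ∷ [])
        w≡ = cong ((- B₁₂) ⊡ R ⊞_) (sym (trans (cong (1# ⊡ v₁ ⊞_) (trans (⊞-identityʳ _) (⊡-zeroˡ v₂))) (⊞-identityʳ _)))
        w≢𝟎 : w ≢ 𝟎
        w≢𝟎 e0 = 1≢0 (cong (head ∘ tail) (basis-independent (- B₁₂ ∷ 1# ∷ 0# ∷ []) (trans (sym w≡) e0)))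
        fw≡0 : value w ≡ 0#
        fw≡0 = trans (cong value w≡) (trans (value-basis _ _ _) (trans
          (cong (λ a → - B₁₂ * 0# + (1# * 1# * a + 1# * 0# * B₁₂ + 0# * 0# * f₂)) f₁≡0)
          (solve 2 (λ b f → ⊝ b ⊗ 𝟘 ⊕ (𝟙 ⊗ 𝟙 ⊗ 𝟘 ⊕ 𝟙 ⊗ 𝟘 ⊗ b ⊕ 𝟘 ⊗ 𝟘 ⊗ f) ⊜ 𝟘) refl B₁₂ f₂)))
        polar-w : ∀ u → polar w u ≡ - B₁₂ * polar u R + 1# * polar u v₁
        polar-w u = trans (polar-comm w u) (polar-comb u (- B₁₂) 1# R v₁)
        wR≡0 : polar w R ≡ 0#
        wR≡0 = trans (polar-w R) (trans (cong₂ (λ a b → - B₁₂ * a + 1# * b) Rr≡0 Rv₁≡0)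
          (solve 1 (λ b → ⊝ b ⊗ 𝟘 ⊕ 𝟙 ⊗ 𝟘 ⊜ 𝟘) refl B₁₂))
        wv₁≡0 : polar w v₁ ≡ 0#
        wv₁≡0 = trans (polar-w v₁) (trans (cong₂ (λ a b → - B₁₂ * a + 1# * b) (trans (polar-comm v₁ R) Rv₁≡0)
            (trans (polar-self v₁) (cong₂ _+_ f₁≡0 f₁≡0)))
          (solve 1 (λ b → ⊝ b ⊗ 𝟘 ⊕ 𝟙 ⊗ (𝟘 ⊕ 𝟘) ⊜ 𝟘) refl B₁₂))
        wv₂≡0 : polar w v₂ ≡ 0#
        wv₂≡0 = trans (polar-w v₂) (trans (cong₂ (λ a b → - B₁₂ * a + 1# * b) (trans (polar-comm v₂ R) Rv₂≡1) (polar-comm v₂ v₁))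
          (solve 1 (λ b → ⊝ b ⊗ 𝟙 ⊕ 𝟙 ⊗ b ⊜ 𝟘) refl B₁₂))
        gradient-w : gradient w ≡ 𝟎
        gradient-w = ∙-nondegenerate (gradient w) λ u → spanned (independent⇒spanning basis basis-independent u)
          where
          spanned : ∀ {u} → Span F basis u → u ∙ gradient w ≡ 0#
          spanned {u} (α ∷ y ∷ z ∷ [] , e) = begin
            u ∙ gradient w ≡⟨ ∙-comm u (gradient w) ⟩
            gradient w ∙ u ≡⟨ cong (gradient w ∙_) e ⟨
            gradient w ∙ comb basis (α ∷ y ∷ z ∷ []) ≡⟨ ∙-comb (gradient w) basis (α ∷ y ∷ z ∷ []) ⟩
            α * polar w R + (y * polar w v₁ + (z * polar w v₂ + 0#))
              ≡⟨ cong₂ (λ a b → α * a + b) wR≡0 (cong₂ (λ a b → y * a + (z * b + 0#)) wv₁≡0 wv₂≡0) ⟩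
            α * 0# + (y * 0# + (z * 0# + 0#)) ≡⟨ solve 3 (λ α y z → α ⊗ 𝟘 ⊕ (y ⊗ 𝟘 ⊕ (z ⊗ 𝟘 ⊕ 𝟘)) ⊜ 𝟘) refl α y z ⟩
            0# ∎

      -- Setting y = -θ and z = -1 and solving Q = 0 gives α = f₂ + B₁₂ θ + f₁ θ². The entries of T
      -- are the coefficient vectors of 1, θ and θ².
      T : Vec (V 3) 3
      T = (f₂ ∷ 0# ∷ - 1# ∷ []) ∷ (B₁₂ ∷ - 1# ∷ 0# ∷ []) ∷ (f₁ ∷ 0# ∷ 0# ∷ []) ∷ []

      T-comb : ∀ s t u → comb T (s ∷ t ∷ u ∷ []) ≡ (s * f₂ + t * B₁₂ + u * f₁) ∷ - t ∷ - s ∷ []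
      T-comb s t u = cong₂ _∷_
        (solve 6 (λ s t u f g b → s ⊗ f ⊕ (t ⊗ b ⊕ (u ⊗ g ⊕ 𝟘)) ⊜ s ⊗ f ⊕ t ⊗ b ⊕ u ⊗ g) refl s t u f₂ f₁ B₁₂) (cong₂ _∷_
        (solve 3 (λ s t u → s ⊗ 𝟘 ⊕ (t ⊗ (⊝ 𝟙) ⊕ (u ⊗ 𝟘 ⊕ 𝟘)) ⊜ ⊝ t) refl s t u) (cong₂ _∷_
        (solve 3 (λ s t u → s ⊗ (⊝ 𝟙) ⊕ (t ⊗ 𝟘 ⊕ (u ⊗ 𝟘 ⊕ 𝟘)) ⊜ ⊝ s) refl s t u) refl))

      neg-zero : ∀ {x} → - x ≡ 0# → x ≡ 0#
      neg-zero {x} e = trans (solve 1 (λ x → x ⊜ ⊝ (⊝ x)) refl x) (trans (cong -_ e) (solve 0 (⊝ 𝟘 ⊜ 𝟘) refl))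

      T-independent : LinearlyIndependent F T
      T-independent (s ∷ t ∷ u ∷ []) e0 = cong₂ _∷_ s≡0 (cong₂ _∷_ t≡0 (cong₂ _∷_ u≡0 refl))
        where
        eq = trans (sym (T-comb s t u)) e0
        s≡0 : s ≡ 0#
        s≡0 = neg-zero (cong (head ∘ tail ∘ tail) eq)
        t≡0 : t ≡ 0#
        t≡0 = neg-zero (cong (head ∘ tail) eq)
        u≡0 : u ≡ 0#
        u≡0 = *-zero-divisor f₁≢0 (begin
          f₁ * u ≡⟨ solve 4 (λ f b g u → f ⊗ u ⊜ 𝟘 ⊗ g ⊕ 𝟘 ⊗ b ⊕ u ⊗ f) refl f₁ B₁₂ f₂ u ⟩
          0# * f₂ + 0# * B₁₂ + u * f₁ ≡⟨ cong₂ (λ s t → s * f₂ + t * B₁₂ + u * f₁) s≡0 t≡0 ⟨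
          s * f₂ + t * B₁₂ + u * f₁ ≡⟨ cong head eq ⟩
          0# ∎)

    parametrisation : Vec (V 3) 3
    parametrisation = map (comb basis) T

    private
      via-T : ∀ x → comb parametrisation x ≡ comb basis (comb T x)
      via-T x = sym (comb-map (comb-linear basis) T x)

    parametrisation-independent : LinearlyIndependent F parametrisation
    parametrisation-independent x e0 = T-independent x (basis-independent _ (trans (sym (via-T x)) e0))

    parametrisation-∞ : comb parametrisation (0# ∷ 0# ∷ 1# ∷ []) ≡ f₁ ⊡ R
    parametrisation-∞ = begin
      comb parametrisation (0# ∷ 0# ∷ 1# ∷ []) ≡⟨ via-T (0# ∷ 0# ∷ 1# ∷ []) ⟩
      comb basis (comb T (0# ∷ 0# ∷ 1# ∷ [])) ≡⟨ cong (comb basis) (trans (T-comb 0# 0# 1#) (cong₂ _∷_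
         (solve 3 (λ f g b → 𝟘 ⊗ g ⊕ 𝟘 ⊗ b ⊕ 𝟙 ⊗ f ⊜ f) refl f₁ f₂ B₁₂) (cong₂ _∷_ -0≡0 (cong₂ _∷_ -0≡0 refl)))) ⟩
      comb basis (f₁ ∷ 0# ∷ 0# ∷ []) ≡⟨ cong₂ (λ a b → f₁ ⊡ R ⊞ (a ⊞ (b ⊞ 𝟎))) (⊡-zeroˡ v₁) (⊡-zeroˡ v₂) ⟩
      f₁ ⊡ R ⊞ (𝟎 ⊞ (𝟎 ⊞ 𝟎)) ≡⟨ cong (f₁ ⊡ R ⊞_) (trans (⊞-identityˡ _) (⊞-identityˡ _)) ⟩
      f₁ ⊡ R ⊞ 𝟎 ≡⟨ ⊞-identityʳ _ ⟩
      f₁ ⊡ R ∎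
      where
      -0≡0 : - 0# ≡ 0#
      -0≡0 = solve 0 (⊝ 𝟘 ⊜ 𝟘) refl

    -- The base point R has parameter ∞. This is what places the tangent point at infinity when it
    -- lies on the conic.
    infinity-zero : ∃ λ c → c ≢ 0# × comb parametrisation (0# ∷ 0# ∷ 1# ∷ []) ≡ c ⊡ R
    infinity-zero = f₁ , f₁≢0 , parametrisation-∞

    parametrised⇒zero : ∀ {y} → StandardNRC F 2 y → value (comb parametrisation y) ≡ 0#
    parametrised⇒zero (finite θ) = begin
      value (comb parametrisation y) ≡⟨ cong value (trans (via-T y) (cong (comb basis) (T-comb 1# (θ * 1#) (θ * (θ * 1#))))) ⟩
      value (comb basis (1# * f₂ + θ * 1# * B₁₂ + θ * (θ * 1#) * f₁ ∷ - (θ * 1#) ∷ - 1# ∷ []))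
        ≡⟨ value-basis (1# * f₂ + θ * 1# * B₁₂ + θ * (θ * 1#) * f₁) (- (θ * 1#)) (- 1#) ⟩
      (1# * f₂ + θ * 1# * B₁₂ + θ * (θ * 1#) * f₁) * - 1#
        + (- (θ * 1#) * - (θ * 1#) * f₁ + - (θ * 1#) * - 1# * B₁₂ + - 1# * - 1# * f₂)
        ≡⟨ solve 4 (λ θ f g b →
         (𝟙 ⊗ g ⊕ (θ ⊗ 𝟙) ⊗ b ⊕ (θ ⊗ (θ ⊗ 𝟙)) ⊗ f) ⊗ ⊝ 𝟙
           ⊕ (⊝ (θ ⊗ 𝟙) ⊗ ⊝ (θ ⊗ 𝟙) ⊗ f ⊕ ⊝ (θ ⊗ 𝟙) ⊗ ⊝ 𝟙 ⊗ b ⊕ ⊝ 𝟙 ⊗ ⊝ 𝟙 ⊗ g) ⊜ 𝟘) refl θ f₁ f₂ B₁₂ ⟩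
      0# ∎
      where
      y : V 3
      y = 1# ∷ θ * 1# ∷ θ * (θ * 1#) ∷ []
    parametrised⇒zero infinite = trans (cong value parametrisation-∞) (trans (value-⊡ f₁ R)
      (trans (cong (f₁ * f₁ *_) fR≡0) (zeroʳ _)))

    -- If z = 0, then f₁ y² = 0, so y = 0 and the point is R. Otherwise the parameter is y / z, and
    -- the factor is -z because `T` is normalised to z = -1.
    zero⇒parametrised : ∀ x → x ≢ 𝟎 → value x ≡ 0# → ∃ λ y → StandardNRC F 2 y × _~_ F x (comb parametrisation y)
    zero⇒parametrised x x≢𝟎 fx≡0 = from-coordinates (independent⇒spanning basis basis-independent x)
      where
      module _ (α y z : Carrier) (e : comb basis (α ∷ y ∷ z ∷ []) ≡ x) where
        F≡0 : α * z + (y * y * f₁ + y * z * B₁₂ + z * z * f₂) ≡ 0#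
        F≡0 = trans (sym (value-basis α y z)) (trans (cong value e) fx≡0)

        lift : ∀ c w → (α ∷ y ∷ z ∷ []) ≡ c ⊡ comb T w → x ≡ c ⊡ comb parametrisation w
        lift c w e′ = trans (sym e) (trans (cong (comb basis) e′)
          (trans (IsLinear.⊡-homo (comb-linear basis) c (comb T w)) (cong (c ⊡_) (sym (via-T w)))))

        at-∞ : z ≡ 0# → ∃ λ y → StandardNRC F 2 y × _~_ F x (comb parametrisation y)
        at-∞ z≡0 = (0# ∷ 0# ∷ 1# ∷ []) , infinite , α * d , αd≢0 , lift (α * d) (0# ∷ 0# ∷ 1# ∷ [])
          (trans (cong₂ _∷_ α≡ (cong₂ _∷_ y≡ (cong₂ _∷_ z≡ refl)))
                 (sym (cong ((α * d) ⊡_) (T-comb 0# 0# 1#))))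
          where
          d = proj₁ (invertible f₁ f₁≢0)
          df₁≡1 = proj₂ (invertible f₁ f₁≢0)
          α≡ : α ≡ α * d * (0# * f₂ + 0# * B₁₂ + 1# * f₁)
          α≡ = sym (trans (solve 5 (λ α d f g b → α ⊗ d ⊗ (𝟘 ⊗ g ⊕ 𝟘 ⊗ b ⊕ 𝟙 ⊗ f) ⊜ α ⊗ (d ⊗ f)) refl α d f₁ f₂ B₁₂)
                          (trans (cong (α *_) df₁≡1) (*-identityʳ α)))
          y≡0 : y ≡ 0#
          y≡0 = zero-^ 2 (*-zero-divisor f₁≢0 (trans
            (solve 5 (λ α y f g b → f ⊗ (y ⊗ (y ⊗ 𝟙)) ⊜ α ⊗ 𝟘 ⊕ (y ⊗ y ⊗ f ⊕ y ⊗ 𝟘 ⊗ b ⊕ 𝟘 ⊗ 𝟘 ⊗ g)) refl α y f₁ f₂ B₁₂)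
            (trans (cong (λ z → α * z + (y * y * f₁ + y * z * B₁₂ + z * z * f₂)) (sym z≡0)) F≡0)))
          0≡ : 0# ≡ α * d * - 0#
          0≡ = solve 1 (λ a → 𝟘 ⊜ a ⊗ ⊝ 𝟘) refl (α * d)
          y≡ : y ≡ α * d * - 0#
          y≡ = trans y≡0 0≡
          z≡ : z ≡ α * d * - 0#
          z≡ = trans z≡0 0≡
          αd≢0 : α * d ≢ 0#
          αd≢0 = *-nonzero (λ α≡0 → x≢𝟎 (trans (sym e) (trans (cong (comb basis) {x = α ∷ y ∷ z ∷ []} {y = 𝟎} (cong₂ _∷_ α≡0 (cong₂ _∷_ y≡0 (cong₂ _∷_ z≡0 refl))))
                                                   (IsLinear.𝟎-homo (comb-linear basis)))))
                           (factor-nonzero df₁≡1)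

        at-finite : z ≢ 0# → ∃ λ y → StandardNRC F 2 y × _~_ F x (comb parametrisation y)
        at-finite z≢0 = _ , finite θ , - z , (λ e → z≢0 (neg-zero e)) , lift (- z) (1# ∷ θ * 1# ∷ θ * (θ * 1#) ∷ [])
          (trans (cong₂ _∷_ α≡ (cong₂ _∷_ y≡ (cong₂ _∷_ z≡ refl)))
                 (sym (cong ((- z) ⊡_) (T-comb 1# (θ * 1#) (θ * (θ * 1#))))))
          where
          w θ : Carrier
          w = proj₁ (invertible z z≢0)
          θ = w * y
          y≡zθ : y ≡ z * θ
          y≡zθ = sym (trans (solve 3 (λ z w y → z ⊗ (w ⊗ y) ⊜ (w ⊗ z) ⊗ y) refl z w y)
                          (trans (cong (_* y) (proj₂ (invertible z z≢0))) (*-identityˡ y)))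
          y≡ : y ≡ - z * - (θ * 1#)
          y≡ = trans y≡zθ (solve 2 (λ z θ → z ⊗ θ ⊜ ⊝ z ⊗ ⊝ (θ ⊗ 𝟙)) refl z θ)
          z≡ : z ≡ - z * - 1#
          z≡ = solve 1 (λ z → z ⊜ ⊝ z ⊗ ⊝ 𝟙) refl z
          α≡ : α ≡ - z * (1# * f₂ + θ * 1# * B₁₂ + θ * (θ * 1#) * f₁)
          α≡ = *-cancelˡ z≢0 (difference-zero (begin
            z * α + - (z * (- z * (1# * f₂ + θ * 1# * B₁₂ + θ * (θ * 1#) * f₁)))
              ≡⟨ solve 6 (λ z α θ f g b → z ⊗ α ⊕ ⊝ (z ⊗ (⊝ z ⊗ (𝟙 ⊗ g ⊕ θ ⊗ 𝟙 ⊗ b ⊕ θ ⊗ (θ ⊗ 𝟙) ⊗ f)))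
                   ⊜ α ⊗ z ⊕ ((z ⊗ θ) ⊗ (z ⊗ θ) ⊗ f ⊕ (z ⊗ θ) ⊗ z ⊗ b ⊕ z ⊗ z ⊗ g)) refl z α θ f₁ f₂ B₁₂ ⟩
            α * z + ((z * θ) * (z * θ) * f₁ + (z * θ) * z * B₁₂ + z * z * f₂)
              ≡⟨ cong (λ y → α * z + (y * y * f₁ + y * z * B₁₂ + z * z * f₂)) y≡zθ ⟨
            α * z + (y * y * f₁ + y * z * B₁₂ + z * z * f₂)
              ≡⟨ F≡0 ⟩
            0# ∎))

      from-coordinates : Span F basis x → ∃ λ y → StandardNRC F 2 y × _~_ F x (comb parametrisation y)
      from-coordinates (α ∷ y ∷ z ∷ [] , e) with z ≟ 0#
      ... | yes z≡0 = at-∞ α y z e z≡0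
      ... | no z≢0 = at-finite α y z e z≢0

  private
    module Tangent (R e G v₂ : V 3) (eR≡1 : e ∙ R ≡ 1#) (GR≡0 : G ∙ R ≡ 0#) (Gv₂≡1 : G ∙ v₂ ≡ 1#) (G≢𝟎 : G ≢ 𝟎) where
      -- The intersection of the tangent G at R with the line e, which misses R: a point of the
      -- tangent other than R.
      v₁ : V 3
      v₁ = e ⨯ G

      v₁≢𝟎 : v₁ ≢ 𝟎
      v₁≢𝟎 v₁≡𝟎 = ⊡-nonzero -1≢0 G≢𝟎 (begin
        (- 1#) ⊡ G ≡⟨ ⊞-identityˡ _ ⟨
        𝟎 ⊞ (- 1#) ⊡ G ≡⟨ cong₂ (λ u c → u ⊞ (- c) ⊡ G) (trans (cong (_⊡ e) GR≡0) (⊡-zeroˡ e)) eR≡1 ⟨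
        (G ∙ R) ⊡ e ⊞ (- (e ∙ R)) ⊡ G ≡⟨ ⨯-⨯ R e G ⟨
        R ⨯ v₁ ≡⟨ cong (R ⨯_) v₁≡𝟎 ⟩
        R ⨯ 𝟎 ≡⟨ ⨯-zeroʳ R ⟩
        𝟎 ∎)
        where
        -1≢0 : - 1# ≢ 0#
        -1≢0 e = 1≢0 (trans (solve 0 (𝟙 ⊜ (⊝ 𝟙) ⊗ (⊝ 𝟙)) refl) (trans (cong (_* - 1#) e) (zeroˡ _)))


      -- Pairing a relation with G isolates z, pairing it then with e isolates α, and v₁ ≠ 0 leaves
      -- y = 0.
      independent : LinearlyIndependent F (R ∷ v₁ ∷ v₂ ∷ [])
      independent (α ∷ y ∷ z ∷ []) e0 = cong₂ _∷_ α≡0 (cong₂ _∷_ y≡0 (cong₂ _∷_ z≡0 refl))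
        where
        z≡0 : z ≡ 0#
        z≡0 = begin
          z ≡⟨ solve 3 (λ α y z → z ⊜ α ⊗ 𝟘 ⊕ (y ⊗ 𝟘 ⊕ (z ⊗ 𝟙 ⊕ 𝟘))) refl α y z ⟩
          α * 0# + (y * 0# + (z * 1# + 0#)) ≡⟨ cong₂ (λ a b → α * a + b) GR≡0 (cong₂ (λ a b → y * a + (z * b + 0#)) (∙-⨯ʳ e G) Gv₂≡1) ⟨
          α * G ∙ R + (y * G ∙ v₁ + (z * G ∙ v₂ + 0#)) ≡⟨ ∙-comb G (R ∷ v₁ ∷ v₂ ∷ []) (α ∷ y ∷ z ∷ []) ⟨
          G ∙ comb (R ∷ v₁ ∷ v₂ ∷ []) (α ∷ y ∷ z ∷ []) ≡⟨ trans (cong (G ∙_) e0) (∙-𝟎 G) ⟩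
          0# ∎
        α≡0 : α ≡ 0#
        α≡0 = begin
          α ≡⟨ solve 3 (λ α y w → α ⊜ α ⊗ 𝟙 ⊕ (y ⊗ 𝟘 ⊕ (𝟘 ⊗ w ⊕ 𝟘))) refl α y (e ∙ v₂) ⟩
          α * 1# + (y * 0# + (0# * e ∙ v₂ + 0#)) ≡⟨ cong₂ (λ a b → α * a + b) eR≡1 (cong₂ (λ a b → y * a + (b * e ∙ v₂ + 0#)) (∙-⨯ˡ e G) z≡0) ⟨
          α * e ∙ R + (y * e ∙ v₁ + (z * e ∙ v₂ + 0#)) ≡⟨ ∙-comb e (R ∷ v₁ ∷ v₂ ∷ []) (α ∷ y ∷ z ∷ []) ⟨
          e ∙ comb (R ∷ v₁ ∷ v₂ ∷ []) (α ∷ y ∷ z ∷ []) ≡⟨ trans (cong (e ∙_) e0) (∙-𝟎 e) ⟩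
          0# ∎
        y≡0 : y ≡ 0#
        y≡0 = ⊡-zero-scalar v₁≢𝟎 (begin
          y ⊡ v₁ ≡⟨ trans (⊞-identityˡ _) (⊞-identityʳ _) ⟨
          𝟎 ⊞ (y ⊡ v₁ ⊞ 𝟎) ≡⟨ cong₂ (λ s t → s ⊞ (y ⊡ v₁ ⊞ t)) (⊡-zeroˡ R) (trans (⊞-identityʳ _) (⊡-zeroˡ v₂)) ⟨
          comb (R ∷ v₁ ∷ v₂ ∷ []) (0# ∷ y ∷ 0# ∷ []) ≡⟨ cong₂ (λ a b → comb (R ∷ v₁ ∷ v₂ ∷ []) (a ∷ y ∷ b ∷ [])) α≡0 z≡0 ⟨
          comb (R ∷ v₁ ∷ v₂ ∷ []) (α ∷ y ∷ z ∷ []) ≡⟨ e0 ⟩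
          𝟎 ∎)

  record Parametrisation (R : V 3) : Set where
    field
      matrix : Vec (V 3) 3
      independent : LinearlyIndependent F matrix
      ∞↦R : ∃ λ c → c ≢ 0# × comb matrix (0# ∷ 0# ∷ 1# ∷ []) ≡ c ⊡ R
      sound : ∀ {y} → StandardNRC F 2 y → value (comb matrix y) ≡ 0#
      complete : ∀ x → x ≢ 𝟎 → value x ≡ 0# → ∃ λ y → StandardNRC F 2 y × _~_ F x (comb matrix y)

  parametrise : NonDegenerate → ∀ {R} → R ≢ 𝟎 → value R ≡ 0# → Parametrisation R
  parametrise nonDegenerate {R} R≢𝟎 fR≡0 = from-duals (dual R≢𝟎) (dual G≢𝟎)
    where
    G≢𝟎 : gradient R ≢ 𝟎
    G≢𝟎 G≡𝟎 = nonDegenerate (point R R≢𝟎) (fR≡0 , G≡𝟎)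
    GR≡0 : gradient R ∙ R ≡ 0#
    GR≡0 = trans (polar-self R) (trans (cong₂ _+_ fR≡0 fR≡0) (+-identityˡ 0#))
    from-duals : ∃ (λ e → e ∙ R ≡ 1#) → ∃ (λ v → v ∙ gradient R ≡ 1#) → Parametrisation R
    from-duals (e , eR≡1) (v₂ , v₂G≡1) = record
      { matrix = A.parametrisation ; independent = A.parametrisation-independent ; ∞↦R = A.infinity-zero
      ; sound = A.parametrised⇒zero ; complete = A.zero⇒parametrised }
      where
      Gv₂≡1 = trans (∙-comm (gradient R) v₂) v₂G≡1
      module T = Tangent R e (gradient R) v₂ eR≡1 GR≡0 Gv₂≡1 G≢𝟎
      module A = AdaptedBasis nonDegenerate R T.v₁ v₂ fR≡0 (∙-⨯ʳ e (gradient R)) Gv₂≡1 T.independent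

-- Chevalley's theorem for ternary quadratic forms

-- The field has `suc m` elements so that the exponent q - 1 of the argument is m.
module Chevalley {m : ℕ} (1≤m : 1 ≤ m) (F : FiniteField (suc m)) where
  open FieldTheory F
  open ≡-Reasoning

  private
    n = suc m

  -- A predicate on functions rather than a type of polynomials: a proof is a way of writing the
  -- function as a sum of monomials, and `pointwise` absorbs the rearrangements.
  data Degree≤ (d : ℕ) : (Carrier → Carrier → Carrier → Carrier) → Set where
    monomial : ∀ c i j k → i ℕ.+ (j ℕ.+ k) ≤ d → Degree≤ d (λ x y z → c * (x ^ᶠ i * (y ^ᶠ j * z ^ᶠ k)))
    _⊹_ : ∀ {f g} → Degree≤ d f → Degree≤ d g → Degree≤ d (λ x y z → f x y z + g x y z)
    pointwise : ∀ {f g} → (∀ x y z → f x y z ≡ g x y z) → Degree≤ d f → Degree≤ d g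

  degree-* : ∀ {d e f g} → Degree≤ d f → Degree≤ e g → Degree≤ (d ℕ.+ e) (λ x y z → f x y z * g x y z)
  degree-* (pointwise f≗ p) q = pointwise (λ x y z → cong (_* _) (f≗ x y z)) (degree-* p q)
  degree-* (p ⊹ p′) q = pointwise (λ x y z → sym (distribʳ _ _ _)) (degree-* p q ⊹ degree-* p′ q)
  degree-* p@(monomial _ _ _ _ _) (pointwise g≗ q) = pointwise (λ x y z → cong (_ *_) (g≗ x y z)) (degree-* p q)
  degree-* p@(monomial _ _ _ _ _) (q ⊹ q′) = pointwise (λ x y z → sym (distribˡ _ _ _)) (degree-* p q ⊹ degree-* p q′)
  degree-* {d} {e} (monomial c i j k le) (monomial c′ i′ j′ k′ le′) =
    pointwise (λ x y z → begin
      c * c′ * (x ^ᶠ (i ℕ.+ i′) * (y ^ᶠ (j ℕ.+ j′) * z ^ᶠ (k ℕ.+ k′)))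
        ≡⟨ cong (c * c′ *_) (cong₂ _*_ (^-homo-* x i i′) (cong₂ _*_ (^-homo-* y j j′) (^-homo-* z k k′))) ⟩
      c * c′ * (x ^ᶠ i * x ^ᶠ i′ * (y ^ᶠ j * y ^ᶠ j′ * (z ^ᶠ k * z ^ᶠ k′)))
        ≡⟨ solve 8 (λ a b s t u v w p → a ⊗ b ⊗ (s ⊗ t ⊗ (u ⊗ v ⊗ (w ⊗ p))) ⊜ (a ⊗ (s ⊗ (u ⊗ w))) ⊗ (b ⊗ (t ⊗ (v ⊗ p)))) refl
             c c′ (x ^ᶠ i) (x ^ᶠ i′) (y ^ᶠ j) (y ^ᶠ j′) (z ^ᶠ k) (z ^ᶠ k′) ⟩
      c * (x ^ᶠ i * (y ^ᶠ j * z ^ᶠ k)) * (c′ * (x ^ᶠ i′ * (y ^ᶠ j′ * z ^ᶠ k′))) ∎)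
    (monomial (c * c′) (i ℕ.+ i′) (j ℕ.+ j′) (k ℕ.+ k′)
      (subst (_≤ d ℕ.+ e) (sym regroup) (ℕ.+-mono-≤ le le′)))
    where
    open import Algebra.Properties.CommutativeSemigroup ℕ.+-commutativeSemigroup using (interchange)
    regroup : (i ℕ.+ i′) ℕ.+ ((j ℕ.+ j′) ℕ.+ (k ℕ.+ k′)) ≡ (i ℕ.+ (j ℕ.+ k)) ℕ.+ (i′ ℕ.+ (j′ ℕ.+ k′))
    regroup = trans (cong ((i ℕ.+ i′) ℕ.+_) (interchange j j′ k k′)) (interchange i i′ (j ℕ.+ k) (j′ ℕ.+ k′))

  degree-^ : ∀ {d f} k → Degree≤ d f → Degree≤ (k ℕ.* d) (λ x y z → f x y z ^ᶠ k)
  degree-^ zero p = pointwise (λ x y z → solve 0 (𝟙 ⊗ (𝟙 ⊗ (𝟙 ⊗ 𝟙)) ⊜ 𝟙) refl) (monomial 1# 0 0 0 z≤n)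
  degree-^ (suc k) p = degree-* p (degree-^ k p)

  total³ : (Carrier → Carrier → Carrier → Carrier) → Carrier
  total³ f = total λ x → total λ y → total λ z → f x y z

  total-cong : ∀ {f g} → (∀ x → f x ≡ g x) → total f ≡ total g
  total-cong e = sum-cong-≗ (e ∘ element)

  total-* : ∀ c f → total (λ x → c * f x) ≡ c * total f
  total-* c f = sym (*-distribˡ-sum c (f ∘ element))

  total-monomial : ∀ c i j k → total³ (λ x y z → c * (x ^ᶠ i * (y ^ᶠ j * z ^ᶠ k)))
                             ≡ c * (total (_^ᶠ i) * (total (_^ᶠ j) * total (_^ᶠ k)))
  total-monomial c i j k = begin
    total³ (λ x y z → c * (x ^ᶠ i * (y ^ᶠ j * z ^ᶠ k)))
      ≡⟨ total-cong (λ x → total-cong λ y → begin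
           total (λ z → c * (x ^ᶠ i * (y ^ᶠ j * z ^ᶠ k)))
             ≡⟨ total-cong (λ z → solve 4 (λ c x y z → c ⊗ (x ⊗ (y ⊗ z)) ⊜ (c ⊗ x ⊗ y) ⊗ z) refl c (x ^ᶠ i) (y ^ᶠ j) (z ^ᶠ k)) ⟩
           total (λ z → c * x ^ᶠ i * y ^ᶠ j * z ^ᶠ k) ≡⟨ total-* _ (_^ᶠ k) ⟩
           c * x ^ᶠ i * y ^ᶠ j * total (_^ᶠ k)
             ≡⟨ solve 4 (λ c x y z → c ⊗ x ⊗ y ⊗ z ⊜ (c ⊗ x ⊗ z) ⊗ y) refl c (x ^ᶠ i) (y ^ᶠ j) (total (_^ᶠ k)) ⟩
           c * x ^ᶠ i * total (_^ᶠ k) * y ^ᶠ j ∎) ⟩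
    total (λ x → total λ y → c * x ^ᶠ i * total (_^ᶠ k) * y ^ᶠ j)
      ≡⟨ total-cong (λ x → trans (total-* _ (_^ᶠ j))
           (solve 4 (λ c x y z → c ⊗ x ⊗ z ⊗ y ⊜ (c ⊗ (y ⊗ z)) ⊗ x) refl c (x ^ᶠ i) (total (_^ᶠ j)) (total (_^ᶠ k)))) ⟩
    total (λ x → c * (total (_^ᶠ j) * total (_^ᶠ k)) * x ^ᶠ i)
      ≡⟨ trans (total-* _ (_^ᶠ i)) (solve 4 (λ c x y z → c ⊗ (y ⊗ z) ⊗ x ⊜ c ⊗ (x ⊗ (y ⊗ z))) refl c (total (_^ᶠ i)) (total (_^ᶠ j)) (total (_^ᶠ k))) ⟩
    c * (total (_^ᶠ i) * (total (_^ᶠ j) * total (_^ᶠ k))) ∎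

  small-exponent : ∀ i j k → i ℕ.+ (j ℕ.+ k) < m ℕ.+ (m ℕ.+ m) → i < m ⊎ j < m ⊎ k < m
  small-exponent i j k lt with i ℕ.<? m | j ℕ.<? m | k ℕ.<? m
  ... | yes p | _ | _ = inj₁ p
  ... | no _ | yes p | _ = inj₂ (inj₁ p)
  ... | no _ | no _ | yes p = inj₂ (inj₂ p)
  ... | no a | no b | no c = contradiction lt (ℕ.≤⇒≯ (ℕ.+-mono-≤ (ℕ.≮⇒≥ a) (ℕ.+-mono-≤ (ℕ.≮⇒≥ b) (ℕ.≮⇒≥ c))))

  -- The sum of a monomial over all vectors factors into three power sums; as the degree is below
  -- 3m, one exponent is below m and its power sum vanishes.
  total³-zero : ∀ {d f} → d < m ℕ.+ (m ℕ.+ m) → Degree≤ d f → total³ f ≡ 0#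
  total³-zero {d} lt (monomial c i j k le) = trans (total-monomial c i j k) (go (small-exponent i j k (ℕ.≤-<-trans le lt)))
    where
    go : i < m ⊎ j < m ⊎ k < m → c * (total (_^ᶠ i) * (total (_^ᶠ j) * total (_^ᶠ k))) ≡ 0#
    go (inj₁ i<m) = trans (cong (λ w → c * (w * (total (_^ᶠ j) * total (_^ᶠ k)))) (power-sum i (s≤s i<m)))
      (solve 2 (λ c y → c ⊗ (𝟘 ⊗ y) ⊜ 𝟘) refl c (total (_^ᶠ j) * total (_^ᶠ k)))
    go (inj₂ (inj₁ j<m)) = trans (cong (λ w → c * (total (_^ᶠ i) * (w * total (_^ᶠ k)))) (power-sum j (s≤s j<m)))
      (solve 3 (λ c x y → c ⊗ (x ⊗ (𝟘 ⊗ y)) ⊜ 𝟘) refl c (total (_^ᶠ i)) (total (_^ᶠ k)))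
    go (inj₂ (inj₂ k<m)) = trans (cong (λ w → c * (total (_^ᶠ i) * (total (_^ᶠ j) * w))) (power-sum k (s≤s k<m)))
      (solve 3 (λ c x y → c ⊗ (x ⊗ (y ⊗ 𝟘)) ⊜ 𝟘) refl c (total (_^ᶠ i)) (total (_^ᶠ j)))
  total³-zero lt (pointwise f≗ p) = trans (total-cong λ x → total-cong λ y → total-cong λ z → sym (f≗ x y z)) (total³-zero lt p)
  total³-zero lt (_⊹_ {f} {g} p q) = begin
    total³ (λ x y z → f x y z + g x y z)
      ≡⟨ total-cong (λ x → trans (total-cong λ y → ∑-distrib-+ (f x y ∘ element) (g x y ∘ element))
                                 (∑-distrib-+ (λ i → total (f x (element i))) (λ i → total (g x (element i))))) ⟩
    total (λ x → (total λ y → total (f x y)) + (total λ y → total (g x y)))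
      ≡⟨ ∑-distrib-+ (λ i → total λ y → total (f (element i) y)) (λ i → total λ y → total (g (element i) y)) ⟩
    total³ f + total³ g ≡⟨ cong₂ _+_ (total³-zero lt p) (total³-zero lt q) ⟩
    0# + 0# ≡⟨ +-identityˡ 0# ⟩
    0# ∎

  private
    -- The extra a completes the k - 1 equal terms to k of them, and k · a = 0 once k is the size of
    -- the field.
    sum-except-one : ∀ {k} (t : Fin k → Carrier) i a → (∀ j → j ≢ i → t j ≡ a) → sum t + a ≡ t i + k · a
    sum-except-one {suc k} t i a rest = begin
      sum t + a ≡⟨ cong (_+ a) (sum-remove {i = i} t) ⟩
      (t i + sum (t ∘ Fin.punchIn i)) + a ≡⟨ cong (λ w → (t i + w) + a) (trans (sum-cong-≗ (λ j → rest _ (Fin.punchInᵢ≢i i j))) (sum-replicate k)) ⟩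
      (t i + k · a) + a ≡⟨ solve 3 (λ t k a → (t ⊕ k) ⊕ a ⊜ t ⊕ (a ⊕ k)) refl (t i) (k · a) a ⟩
      t i + suc k · a ∎
      where open import Algebra.Properties.CommutativeMonoid.Sum +-commutativeMonoid using (sum-remove)

    module En = Inverse enumeration

    n·≡0 : ∀ a → n · a ≡ 0#
    n·≡0 a = begin
      n · a ≡⟨ cong (n ·_) (*-identityˡ a) ⟨
      n · (1# * a) ≡⟨ ×-assoc-* n 1# a ⟨
      n · 1# * a ≡⟨ cong (_* a) n·1≡0 ⟩
      0# * a ≡⟨ zeroˡ a ⟩
      0# ∎
      where open import Algebra.Properties.Semiring.Mult (FiniteField.semiring F) using (×-assoc-*)

    total-except-0 : ∀ f a → (∀ x → x ≢ 0# → f x ≡ a) → total f + a ≡ f 0#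
    total-except-0 f a rest = begin
      total f + a ≡⟨ sum-except-one (f ∘ element) (En.to 0#) a
                                               (λ j ne → rest _ (λ e → ne (trans (sym (En.strictlyInverseˡ j)) (cong En.to e)))) ⟩
      f (element (En.to 0#)) + n · a ≡⟨ cong₂ _+_ (cong f (En.strictlyInverseʳ 0#)) (n·≡0 a) ⟩
      f 0# + 0# ≡⟨ +-identityʳ _ ⟩
      f 0# ∎

    total-0 : ∀ f → (∀ x → x ≢ 0# → f x ≡ 0#) → total f ≡ f 0#
    total-0 f rest = trans (sym (+-identityʳ _)) (total-except-0 f 0# rest)

    total-1 : ∀ f → (∀ x → f x ≡ 1#) → total f ≡ 0#
    total-1 f all = trans (trans (total-cong all) (sum-replicate n)) (n·≡0 1#)

  module _ (Q : TernaryQuadraticForm F) where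
    open TernaryQuadraticForm Q 

    private
      ev : Carrier → Carrier → Carrier → Carrier
      ev x y z = value (x ∷ y ∷ z ∷ [])

      ev-degree : Degree≤ 2 ev
      ev-degree = pointwise (λ x y z → solve 9 (λ a b c f g h x y z →
          ((((a ⊗ (x ⊗ (x ⊗ 𝟙) ⊗ (𝟙 ⊗ 𝟙)) ⊕ b ⊗ (𝟙 ⊗ (y ⊗ (y ⊗ 𝟙) ⊗ 𝟙)))
           ⊕ c ⊗ (𝟙 ⊗ (𝟙 ⊗ (z ⊗ (z ⊗ 𝟙))))) ⊕ f ⊗ (𝟙 ⊗ (y ⊗ 𝟙 ⊗ (z ⊗ 𝟙))))
           ⊕ g ⊗ (x ⊗ 𝟙 ⊗ (𝟙 ⊗ (z ⊗ 𝟙)))) ⊕ h ⊗ (x ⊗ 𝟙 ⊗ (y ⊗ 𝟙 ⊗ 𝟙))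
          ⊜ a ⊗ x ⊗ x ⊕ b ⊗ y ⊗ y ⊕ c ⊗ z ⊗ z ⊕ f ⊗ y ⊗ z ⊕ g ⊗ z ⊗ x ⊕ h ⊗ x ⊗ y) refl a b c f g h x y z)
        (((((monomial a 2 0 0 ℕ.≤-refl ⊹ monomial b 0 2 0 ℕ.≤-refl) ⊹ monomial c 0 0 2 ℕ.≤-refl)
          ⊹ monomial f 0 1 1 ℕ.≤-refl) ⊹ monomial g 1 0 1 ℕ.≤-refl) ⊹ monomial h 1 1 0 ℕ.≤-refl)

      2m<3m : m ℕ.* 2 < m ℕ.+ (m ℕ.+ m)
      2m<3m = subst (_< m ℕ.+ (m ℕ.+ m)) (trans (cong (m ℕ.+_) (sym (ℕ.+-identityʳ m))) (ℕ.*-comm 2 m)) (ℕ.m<n+m (m ℕ.+ m) 1≤m)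

      nonzero-power : ∀ {x} → x ≢ 0# → x ^ᶠ m ≡ 1#
      nonzero-power {x} x≢0 = *-cancelˡ x≢0 (trans (fermat x) (sym (*-identityʳ x)))

      zero-power : ∀ {k} → 1 ≤ k → 0# ^ᶠ k ≡ 0#
      zero-power (s≤s _) = zeroˡ _

    -- If only the origin is a zero, then f^m is 1 away from the origin, so its
    -- sum over all vectors is -1; but its degree 2m is less than 3m.
    rational-point : ∃ λ P → zeros P
    rational-point with any-finite? (vec-finite enumeration 3) (λ v → ¬? (Vec.≡-dec _≟_ v (0ᵛ F)) ×-dec (value v ≟ 0#))
    ... | yes (v , v≢0 , fv≡0) = point v v≢0 , fv≡0
    ... | no none = contradiction (begin
      1# ≡⟨ +-identityˡ 1# ⟨
      0# + 1# ≡⟨ cong (_+ 1#) (trans (sym total-value) (total³-zero 2m<3m (degree-^ m ev-degree))) ⟨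
      total (λ z → ev 0# 0# z ^ᶠ m) + 1# ≡⟨ total-except-0 (λ z → ev 0# 0# z ^ᶠ m) 1# (λ z z≢0 → away 0# 0# z (λ { refl → z≢0 refl })) ⟩
      ev 0# 0# 0# ^ᶠ m ≡⟨ cong (_^ᶠ m) (solve 6 (λ a b c f g h → a ⊗ 𝟘 ⊗ 𝟘 ⊕ b ⊗ 𝟘 ⊗ 𝟘 ⊕ c ⊗ 𝟘 ⊗ 𝟘 ⊕ f ⊗ 𝟘 ⊗ 𝟘 ⊕ g ⊗ 𝟘 ⊗ 𝟘 ⊕ h ⊗ 𝟘 ⊗ 𝟘 ⊜ 𝟘) refl a b c f g h) ⟩
      0# ^ᶠ m ≡⟨ zero-power 1≤m ⟩
      0# ∎) 1≢0
      where
      away : ∀ x y z → x ∷ y ∷ z ∷ [] ≢ 0ᵛ F → ev x y z ^ᶠ m ≡ 1#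
      away x y z v≢0 = nonzero-power (λ e → none (_ , v≢0 , e))
      -- Unless x = y = 0, the innermost sum adds 1 once for each element of F and vanishes.
      total-value : total³ (λ x y z → ev x y z ^ᶠ m) ≡ total (λ z → ev 0# 0# z ^ᶠ m)
      total-value = trans
        (total-0 (λ x → total λ y → total λ z → ev x y z ^ᶠ m) (λ x x≢0 →
          trans (total-cong (λ y → total-1 _ (λ z → away x y z (λ { refl → x≢0 refl })))) (trans (sum-replicate n) (n·≡0 0#))))
        (total-0 (λ y → total λ z → ev 0# y z ^ᶠ m) (λ y y≢0 →
          total-1 _ (λ z → away 0# y z (λ { refl → y≢0 refl }))))

-- The fundamental theorem of projective geometry

module FundamentalTheorem {m n : ℕ} (F : FiniteField m) (K : FiniteField n) where
  private
    module 𝔽 = FieldTheory F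
    module VF = VectorTheory F
  open FieldTheory K
  open VectorTheory K
  open ≡-Reasoning

  vertex : Fin 3 → Point F 2
  vertex i = point (VF.unit i) λ e → 𝔽.1≢0 (begin
    𝔽.1# ≡⟨ VF.lookup-unit i ⟨
    lookup (VF.unit i) i ≡⟨ cong (λ v → lookup v i) e ⟩
    lookup VF.𝟎 i ≡⟨ Vec.lookup-replicate i 𝔽.0# ⟩
    𝔽.0# ∎)

  -- The fundamental theorem of projective geometry for a map of planes that
  -- preserves both incidence and non-incidence, in a fixed coordinate frame.
  module Frame (w μ : Point F 2 → V 3)
    (incidence : ∀ ℓ P → dot F (coords ℓ) (coords P) ≡ 𝔽.0# ⇔ μ ℓ ∙ w P ≡ 0#)
    -- The vertices are to be the unit vectors, so coordinate i of a line vanishes exactly when it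
    -- passes through vertex i; `μ-ones` fixes the unit point.
    (μ≡0 : ∀ i ℓ → lookup (coords ℓ) i ≡ 𝔽.0# → lookup (μ ℓ) i ≡ 0#)
    (μ≢0 : ∀ i ℓ → lookup (coords ℓ) i ≢ 𝔽.0# → lookup (μ ℓ) i ≢ 0#)
    (μ-ones : ∀ ℓ → dot F (coords ℓ) (𝔽.1# ∷ 𝔽.1# ∷ 𝔽.1# ∷ []) ≡ 𝔽.0# → μ ℓ ∙ (1# ∷ 1# ∷ 1# ∷ []) ≡ 0#)
    where

    private
      coordinate₀ coordinate₁ coordinate₂ : Point F 2 → 𝔽.Carrier
      coordinate₀ P = lookup (coords P) zero
      coordinate₁ P = lookup (coords P) (suc zero)
      coordinate₂ P = lookup (coords P) (suc (suc zero))

      w₀ w₁ w₂ μ₀ μ₁ μ₂ : Point F 2 → Carrier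
      w₀ P = lookup (w P) zero
      w₁ P = lookup (w P) (suc zero)
      w₂ P = lookup (w P) (suc (suc zero))
      μ₀ ℓ = lookup (μ ℓ) zero
      μ₁ ℓ = lookup (μ ℓ) (suc zero)
      μ₂ ℓ = lookup (μ ℓ) (suc (suc zero))

      expand : ∀ (u v : V 3) → u ∙ v ≡ lookup u zero * lookup v zero + (lookup u (suc zero) * lookup v (suc zero)
                               + lookup u (suc (suc zero)) * lookup v (suc (suc zero)))
      expand (a ∷ b ∷ c ∷ []) (x ∷ y ∷ z ∷ []) = cong (λ t → a * x + (b * y + t)) (+-identityʳ (c * z))

      incident : ∀ ℓ P → dot F (coords ℓ) (coords P) ≡ 𝔽.0# → μ₀ ℓ * w₀ P + (μ₁ ℓ * w₁ P + μ₂ ℓ * w₂ P) ≡ 0#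
      incident ℓ P e = trans (sym (expand (μ ℓ) (w P))) (Equivalence.to (incidence ℓ P) e)

      μ-unit : ∀ ℓ → coordinate₀ ℓ 𝔽.+ (coordinate₁ ℓ 𝔽.+ coordinate₂ ℓ) ≡ 𝔽.0# → μ₀ ℓ + (μ₁ ℓ + μ₂ ℓ) ≡ 0#
      μ-unit ℓ@(point (x ∷ y ∷ z ∷ []) _) e = begin
        μ₀ ℓ + (μ₁ ℓ + μ₂ ℓ) ≡⟨ solve 3 (λ a b c → a ⊕ (b ⊕ c) ⊜ a ⊗ 𝟙 ⊕ (b ⊗ 𝟙 ⊕ c ⊗ 𝟙)) refl (μ₀ ℓ) (μ₁ ℓ) (μ₂ ℓ) ⟩
        μ₀ ℓ * 1# + (μ₁ ℓ * 1# + μ₂ ℓ * 1#) ≡⟨ expand (μ ℓ) (1# ∷ 1# ∷ 1# ∷ []) ⟨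
        μ ℓ ∙ (1# ∷ 1# ∷ 1# ∷ []) ≡⟨ μ-ones ℓ (trans (𝔽.solve 3 (λ x y z → x ⊗ 𝟙 ⊕ (y ⊗ 𝟙 ⊕ (z ⊗ 𝟙 ⊕ 𝟘)) ⊜ x ⊕ (y ⊕ z)) refl x y z) e) ⟩
        0# ∎

      vertex-∙ : ∀ i P → μ (vertex i) ∙ w P ≡ lookup (μ (vertex i)) i * lookup (w P) i
      vertex-∙ i P = ∙-diagonal (μ (vertex i)) (w P) i (λ j j≢i → μ≡0 j (vertex i) (VF.lookup-unit-≢ i j j≢i))

      w≡0 : ∀ i P → lookup (coords P) i ≡ 𝔽.0# → lookup (w P) i ≡ 0#
      w≡0 i P e = *-zero-divisor (μ≢0 i (vertex i) (𝔽.1≢0 ∘ trans (sym (VF.lookup-unit i))))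
        (trans (sym (vertex-∙ i P)) (Equivalence.to (incidence (vertex i) P) (trans (VF.unit-∙ i (coords P)) e)))

      w≢0 : ∀ i P → lookup (coords P) i ≢ 𝔽.0# → lookup (w P) i ≢ 0#
      w≢0 i P ne e = ne (trans (sym (VF.unit-∙ i (coords P))) (Equivalence.from (incidence (vertex i) P)
        (trans (vertex-∙ i P) (trans (cong (lookup (μ (vertex i)) i *_) e) (zeroʳ _)))))

      μ₀≢0 = μ≢0 zero
      μ₁≢0 = μ≢0 (suc zero)
      μ₂≡0 = μ≡0 (suc (suc zero))
      w₀≡0 = w≡0 zero
      w₂≡0 = w≡0 (suc (suc zero))
      w₀≢0 = w≢0 zero
      w₁≢0 = w≢0 (suc zero)
      w₂≢0 = w≢0 (suc (suc zero))

      -1≢0 : 𝔽.- 𝔽.1# ≢ 𝔽.0#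
      -1≢0 e = 𝔽.1≢0 (trans (𝔽.solve 0 (𝟙 ⊜ ⊝ (⊝ 𝟙)) refl) (trans (cong 𝔽.-_ e) (𝔽.solve 0 (⊝ 𝟘 ⊜ 𝟘) refl)))

      first : ∀ y z → Point F 2
      first y z = point (𝔽.1# ∷ y ∷ z ∷ []) (𝔽.1≢0 ∘ cong head)

      second : ∀ x z → Point F 2
      second x z = point (x ∷ 𝔽.1# ∷ z ∷ []) (𝔽.1≢0 ∘ cong (head ∘ tail))

      slope : 𝔽.Carrier → Point F 2
      slope c = point (c ∷ 𝔽.- 𝔽.1# ∷ 𝔽.0# ∷ []) (-1≢0 ∘ cong (head ∘ tail))

      third : ∀ x y → Point F 2
      third x y = point (x ∷ y ∷ 𝔽.1# ∷ []) (𝔽.1≢0 ∘ cong (head ∘ tail ∘ tail))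

    -- The line x = a z goes to x = σ a z, and y = b z to y = τ b z.
    σ : 𝔽.Carrier → Carrier
    σ a = - (proj₁ (invertible (μ₀ ℓ) (μ₀≢0 ℓ 𝔽.1≢0)) * μ₂ ℓ)
      where ℓ = first 𝔽.0# (𝔽.- a)

    private
      τ : 𝔽.Carrier → Carrier
      τ b = - (proj₁ (invertible (μ₁ ℓ) (μ₁≢0 ℓ 𝔽.1≢0)) * μ₂ ℓ)
        where ℓ = second 𝔽.0# (𝔽.- b)

      divide : ∀ {c} (c≢0 : c ≢ 0#) {d x z} → c * x + d * z ≡ 0# → x ≡ - (proj₁ (invertible c c≢0) * d) * z
      divide {c} c≢0 {d} {x} {z} e = *-cancelˡ c≢0 (difference-zero (begin
        c * x + - (c * (- (c⁻¹ * d) * z)) ≡⟨ solve 5 (λ c k d x z → c ⊗ x ⊕ ⊝ (c ⊗ (⊝ (k ⊗ d) ⊗ z)) ⊜ c ⊗ x ⊕ (k ⊗ c) ⊗ (d ⊗ z)) refl c c⁻¹ d x z ⟩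
        c * x + c⁻¹ * c * (d * z) ≡⟨ cong (λ w → c * x + w * (d * z)) (proj₂ (invertible c c≢0)) ⟩
        c * x + 1# * (d * z) ≡⟨ cong (c * x +_) (*-identityˡ (d * z)) ⟩
        c * x + d * z ≡⟨ e ⟩
        0# ∎))
        where c⁻¹ = proj₁ (invertible c c≢0)

    abscissa : ∀ a P → coordinate₀ P ≡ a 𝔽.* coordinate₂ P → w₀ P ≡ σ a * w₂ P
    abscissa a P@(point (_ ∷ y ∷ z ∷ []) _) refl = divide (μ₀≢0 ℓ 𝔽.1≢0) (begin
      μ₀ ℓ * w₀ P + μ₂ ℓ * w₂ P ≡⟨ solve 3 (λ a b c → a ⊕ b ⊜ a ⊕ (𝟘 ⊗ c ⊕ b)) refl (μ₀ ℓ * w₀ P) (μ₂ ℓ * w₂ P) (w₁ P) ⟩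
      μ₀ ℓ * w₀ P + (0# * w₁ P + μ₂ ℓ * w₂ P) ≡⟨ cong (λ m → μ₀ ℓ * w₀ P + (m * w₁ P + μ₂ ℓ * w₂ P)) (μ≡0 (suc zero) ℓ refl) ⟨
      μ₀ ℓ * w₀ P + (μ₁ ℓ * w₁ P + μ₂ ℓ * w₂ P) ≡⟨ incident ℓ P (𝔽.solve 3 (λ a y z → 𝟙 ⊗ (a ⊗ z) ⊕ (𝟘 ⊗ y ⊕ (⊝ a ⊗ z ⊕ 𝟘)) ⊜ 𝟘) refl a y z) ⟩
      0# ∎)
      where ℓ = first 𝔽.0# (𝔽.- a)

    private
      ordinate′ : ∀ b P → coordinate₁ P ≡ b 𝔽.* coordinate₂ P → w₁ P ≡ τ b * w₂ P
      ordinate′ b P@(point (x ∷ _ ∷ z ∷ []) _) refl = divide (μ₁≢0 ℓ 𝔽.1≢0) (begin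
        μ₁ ℓ * w₁ P + μ₂ ℓ * w₂ P ≡⟨ solve 3 (λ a b c → a ⊕ b ⊜ 𝟘 ⊗ c ⊕ (a ⊕ b)) refl (μ₁ ℓ * w₁ P) (μ₂ ℓ * w₂ P) (w₀ P) ⟩
        0# * w₀ P + (μ₁ ℓ * w₁ P + μ₂ ℓ * w₂ P) ≡⟨ cong (λ m → m * w₀ P + (μ₁ ℓ * w₁ P + μ₂ ℓ * w₂ P)) (μ≡0 zero ℓ refl) ⟨
        μ₀ ℓ * w₀ P + (μ₁ ℓ * w₁ P + μ₂ ℓ * w₂ P) ≡⟨ incident ℓ P (𝔽.solve 3 (λ a y z → 𝟘 ⊗ y ⊕ (𝟙 ⊗ (a ⊗ z) ⊕ (⊝ a ⊗ z ⊕ 𝟘)) ⊜ 𝟘) refl b x z) ⟩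
        0# ∎)
        where ℓ = second 𝔽.0# (𝔽.- b)

      diagonal : ∀ P → coordinate₀ P ≡ coordinate₁ P → w₀ P ≡ w₁ P
      diagonal P@(point (x ∷ _ ∷ z ∷ []) _) refl = *-cancelˡ (μ₀≢0 ℓ 𝔽.1≢0) (difference-zero (begin
        μ₀ ℓ * w₀ P + - (μ₀ ℓ * w₁ P)
          ≡⟨ solve 5 (λ m k a b c → m ⊗ a ⊕ ⊝ (m ⊗ b) ⊜ (m ⊗ a ⊕ (k ⊗ b ⊕ 𝟘 ⊗ c)) ⊕ ⊝ ((m ⊕ (k ⊕ 𝟘)) ⊗ b)) refl (μ₀ ℓ) (μ₁ ℓ) (w₀ P) (w₁ P) (w₂ P) ⟩
        (μ₀ ℓ * w₀ P + (μ₁ ℓ * w₁ P + 0# * w₂ P)) + - ((μ₀ ℓ + (μ₁ ℓ + 0#)) * w₁ P)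
          ≡⟨ cong (λ m → (μ₀ ℓ * w₀ P + (μ₁ ℓ * w₁ P + m * w₂ P)) + - ((μ₀ ℓ + (μ₁ ℓ + m)) * w₁ P)) (μ≡0 (suc (suc zero)) ℓ refl) ⟨
        (μ₀ ℓ * w₀ P + (μ₁ ℓ * w₁ P + μ₂ ℓ * w₂ P)) + - ((μ₀ ℓ + (μ₁ ℓ + μ₂ ℓ)) * w₁ P)
          ≡⟨ cong₂ (λ a b → a + - (b * w₁ P))
               (incident ℓ P (𝔽.solve 2 (λ y z → 𝟙 ⊗ y ⊕ (⊝ 𝟙 ⊗ y ⊕ (𝟘 ⊗ z ⊕ 𝟘)) ⊜ 𝟘) refl x z))
               (μ-unit ℓ (𝔽.solve 0 (𝟙 ⊕ (⊝ 𝟙 ⊕ 𝟘) ⊜ 𝟘) refl)) ⟩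
        0# + - (0# * w₁ P) ≡⟨ solve 1 (λ b → 𝟘 ⊕ ⊝ (𝟘 ⊗ b) ⊜ 𝟘) refl (w₁ P) ⟩
        0# ∎))
        where ℓ = first (𝔽.- 𝔽.1#) 𝔽.0#

      -- The point (a, a, 1) lies on the diagonal x = y, whose image is again the diagonal.
      σ≡τ : ∀ a → σ a ≡ τ a
      σ≡τ a = *-cancelˡ (w₂≢0 P 𝔽.1≢0) (begin
        w₂ P * σ a ≡⟨ *-comm _ _ ⟩
        σ a * w₂ P ≡⟨ abscissa a P (sym (𝔽.*-identityʳ a)) ⟨
        w₀ P ≡⟨ diagonal P refl ⟩
        w₁ P ≡⟨ ordinate′ a P (sym (𝔽.*-identityʳ a)) ⟩
        τ a * w₂ P ≡⟨ *-comm _ _ ⟩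
        w₂ P * τ a ∎)
        where P = third a a

    ordinate : ∀ b P → coordinate₁ P ≡ b 𝔽.* coordinate₂ P → w₁ P ≡ σ b * w₂ P
    ordinate b P e = trans (ordinate′ b P e) (cong (_* w₂ P) (sym (σ≡τ b)))

    σ-0 : σ 𝔽.0# ≡ 0#
    σ-0 = trans (cong (λ m → - (proj₁ (invertible (μ₀ (first 𝔽.0# (𝔽.- 𝔽.0#))) (μ₀≢0 (first 𝔽.0# (𝔽.- 𝔽.0#)) 𝔽.1≢0)) * m)) (μ₂≡0 (first 𝔽.0# (𝔽.- 𝔽.0#)) (𝔽.solve 0 (⊝ 𝟘 ⊜ 𝟘) refl)))
      (solve 1 (λ a → ⊝ (a ⊗ 𝟘) ⊜ 𝟘) refl (proj₁ (invertible (μ₀ (first 𝔽.0# (𝔽.- 𝔽.0#))) (μ₀≢0 (first 𝔽.0# (𝔽.- 𝔽.0#)) 𝔽.1≢0))))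

    σ-1 : σ 𝔽.1# ≡ 1#
    σ-1 = begin
      - (c * μ₂ ℓ) ≡⟨ solve 3 (λ c m k → ⊝ (c ⊗ k) ⊜ c ⊗ m ⊕ ⊝ (c ⊗ (m ⊕ (𝟘 ⊕ k)))) refl c (μ₀ ℓ) (μ₂ ℓ) ⟩
      c * μ₀ ℓ + - (c * (μ₀ ℓ + (0# + μ₂ ℓ))) ≡⟨ cong (λ m → c * μ₀ ℓ + - (c * (μ₀ ℓ + (m + μ₂ ℓ)))) (μ≡0 (suc zero) ℓ refl) ⟨
      c * μ₀ ℓ + - (c * (μ₀ ℓ + (μ₁ ℓ + μ₂ ℓ))) ≡⟨ cong₂ (λ a b → a + - (c * b)) (proj₂ (invertible (μ₀ ℓ) (μ₀≢0 ℓ 𝔽.1≢0)))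
                                                          (μ-unit ℓ (𝔽.solve 0 (𝟙 ⊕ (𝟘 ⊕ ⊝ 𝟙) ⊜ 𝟘) refl)) ⟩
      1# + - (c * 0#) ≡⟨ solve 1 (λ c → 𝟙 ⊕ ⊝ (c ⊗ 𝟘) ⊜ 𝟙) refl c ⟩
      1# ∎
      where
      ℓ = first 𝔽.0# (𝔽.- 𝔽.1#)
      c = proj₁ (invertible (μ₀ ℓ) (μ₀≢0 ℓ 𝔽.1≢0))

    private
      on-line : ∀ ℓ a b → dot F (coords ℓ) (a ∷ b ∷ 𝔽.1# ∷ []) ≡ 𝔽.0# → μ₀ ℓ * σ a + (μ₁ ℓ * σ b + μ₂ ℓ) ≡ 0#
      on-line ℓ a b e = *-zero-divisor (w₂≢0 P 𝔽.1≢0) (begin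
        w₂ P * (μ₀ ℓ * σ a + (μ₁ ℓ * σ b + μ₂ ℓ))
          ≡⟨ solve 6 (λ w l m n a b → w ⊗ (l ⊗ a ⊕ (m ⊗ b ⊕ n)) ⊜ l ⊗ (a ⊗ w) ⊕ (m ⊗ (b ⊗ w) ⊕ n ⊗ w)) refl (w₂ P) (μ₀ ℓ) (μ₁ ℓ) (μ₂ ℓ) (σ a) (σ b) ⟩
        μ₀ ℓ * (σ a * w₂ P) + (μ₁ ℓ * (σ b * w₂ P) + μ₂ ℓ * w₂ P)
          ≡⟨ cong₂ (λ u v → μ₀ ℓ * u + (μ₁ ℓ * v + μ₂ ℓ * w₂ P)) (abscissa a P (sym (𝔽.*-identityʳ a))) (ordinate b P (sym (𝔽.*-identityʳ b))) ⟨
        μ₀ ℓ * w₀ P + (μ₁ ℓ * w₁ P + μ₂ ℓ * w₂ P)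
          ≡⟨ incident ℓ P e ⟩
        0# ∎)
        where P = third a b

      slope-μ : ∀ c → μ₀ (slope c) ≡ - (μ₁ (slope c) * σ c)
      slope-μ c = difference-zero (begin
        μ₀ ℓ + - - (μ₁ ℓ * σ c) ≡⟨ solve 2 (λ a b → a ⊕ ⊝ (⊝ b) ⊜ a ⊗ 𝟙 ⊕ (b ⊕ 𝟘)) refl (μ₀ ℓ) (μ₁ ℓ * σ c) ⟩
        μ₀ ℓ * 1# + (μ₁ ℓ * σ c + 0#) ≡⟨ cong₂ (λ s m → μ₀ ℓ * s + (μ₁ ℓ * σ c + m)) σ-1 (μ≡0 (suc (suc zero)) ℓ refl) ⟨
        μ₀ ℓ * σ 𝔽.1# + (μ₁ ℓ * σ c + μ₂ ℓ) ≡⟨ on-line ℓ 𝔽.1# c (𝔽.solve 1 (λ c → c ⊗ 𝟙 ⊕ (⊝ 𝟙 ⊗ c ⊕ (𝟘 ⊗ 𝟙 ⊕ 𝟘)) ⊜ 𝟘) refl c) ⟩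
        0# ∎)
        where ℓ = slope c

    -- The line y = c x contains (1, c, 1), so its image is y = σ c x; it also contains (a, c a, 1).
    σ-* : ∀ c a → σ (c 𝔽.* a) ≡ σ c * σ a
    σ-* c a = *-cancelˡ (μ₁≢0 ℓ -1≢0) (difference-zero (begin
      μ₁ ℓ * σ (c 𝔽.* a) + - (μ₁ ℓ * (σ c * σ a))
        ≡⟨ solve 4 (λ m s c a → m ⊗ s ⊕ ⊝ (m ⊗ (c ⊗ a)) ⊜ ⊝ (m ⊗ c) ⊗ a ⊕ (m ⊗ s ⊕ 𝟘)) refl (μ₁ ℓ) (σ (c 𝔽.* a)) (σ c) (σ a) ⟩
      - (μ₁ ℓ * σ c) * σ a + (μ₁ ℓ * σ (c 𝔽.* a) + 0#)
        ≡⟨ cong₂ (λ s m → s * σ a + (μ₁ ℓ * σ (c 𝔽.* a) + m)) (slope-μ c) (μ≡0 (suc (suc zero)) ℓ refl) ⟨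
      μ₀ ℓ * σ a + (μ₁ ℓ * σ (c 𝔽.* a) + μ₂ ℓ)
        ≡⟨ on-line ℓ a (c 𝔽.* a) (𝔽.solve 2 (λ c a → c ⊗ a ⊕ (⊝ 𝟙 ⊗ (c ⊗ a) ⊕ (𝟘 ⊗ 𝟙 ⊕ 𝟘)) ⊜ 𝟘) refl c a) ⟩
      0# ∎))
      where ℓ = slope c

    -- The line y = x + b contains (0, b, 1), (a, a + b, 1) and the point D = (1, 1, 0) at infinity
    -- of the diagonal. The last makes the first two coordinates of its image opposite, so that the
    -- image has slope 1.
    σ-+ : ∀ a b → σ (a 𝔽.+ b) ≡ σ a + σ b
    σ-+ a b = *-cancelˡ (μ₀≢0 ℓ 𝔽.1≢0) (difference-zero (begin
      μ₀ ℓ * σ (a 𝔽.+ b) + - (μ₀ ℓ * (σ a + σ b))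
        ≡⟨ solve 6 (λ m k n s a b → m ⊗ s ⊕ ⊝ (m ⊗ (a ⊕ b)) ⊜
             (((m ⊕ k) ⊗ s ⊕ ⊝ (m ⊗ a ⊕ (k ⊗ s ⊕ n))) ⊕ (m ⊗ 𝟘 ⊕ (k ⊗ b ⊕ n))) ⊕ ⊝ ((m ⊕ k) ⊗ b)) refl (μ₀ ℓ) (μ₁ ℓ) (μ₂ ℓ) (σ (a 𝔽.+ b)) (σ a) (σ b) ⟩
      (((μ₀ ℓ + μ₁ ℓ) * σ (a 𝔽.+ b) + - (μ₀ ℓ * σ a + (μ₁ ℓ * σ (a 𝔽.+ b) + μ₂ ℓ))) + (μ₀ ℓ * 0# + (μ₁ ℓ * σ b + μ₂ ℓ))) + - ((μ₀ ℓ + μ₁ ℓ) * σ b)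
        ≡⟨ cong₂ (λ u v → (((μ₀ ℓ + μ₁ ℓ) * σ (a 𝔽.+ b) + - u) + v) + - ((μ₀ ℓ + μ₁ ℓ) * σ b))
             (on-line ℓ a (a 𝔽.+ b) (𝔽.solve 2 (λ a b → 𝟙 ⊗ a ⊕ (⊝ 𝟙 ⊗ (a ⊕ b) ⊕ (b ⊗ 𝟙 ⊕ 𝟘)) ⊜ 𝟘) refl a b))
             (trans (cong (λ z → μ₀ ℓ * z + (μ₁ ℓ * σ b + μ₂ ℓ)) (sym σ-0))
               (on-line ℓ 𝔽.0# b (𝔽.solve 1 (λ b → 𝟙 ⊗ 𝟘 ⊕ (⊝ 𝟙 ⊗ b ⊕ (b ⊗ 𝟙 ⊕ 𝟘)) ⊜ 𝟘) refl b))) ⟩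
      (((μ₀ ℓ + μ₁ ℓ) * σ (a 𝔽.+ b) + - 0#) + 0#) + - ((μ₀ ℓ + μ₁ ℓ) * σ b)
        ≡⟨ cong (λ s → ((s * σ (a 𝔽.+ b) + - 0#) + 0#) + - (s * σ b)) opposite ⟩
      ((0# * σ (a 𝔽.+ b) + - 0#) + 0#) + - (0# * σ b)
        ≡⟨ solve 2 (λ s b → ((𝟘 ⊗ s ⊕ ⊝ 𝟘) ⊕ 𝟘) ⊕ ⊝ (𝟘 ⊗ b) ⊜ 𝟘) refl (σ (a 𝔽.+ b)) (σ b) ⟩
      0# ∎))
      where
      ℓ = first (𝔽.- 𝔽.1#) b
      D = first 𝔽.1# 𝔽.0#
      opposite : μ₀ ℓ + μ₁ ℓ ≡ 0#
      opposite = *-zero-divisor (w₀≢0 D 𝔽.1≢0) (begin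
        w₀ D * (μ₀ ℓ + μ₁ ℓ) ≡⟨ solve 4 (λ w m k n → w ⊗ (m ⊕ k) ⊜ m ⊗ w ⊕ (k ⊗ w ⊕ n ⊗ 𝟘)) refl (w₀ D) (μ₀ ℓ) (μ₁ ℓ) (μ₂ ℓ) ⟩
        μ₀ ℓ * w₀ D + (μ₁ ℓ * w₀ D + μ₂ ℓ * 0#) ≡⟨ cong₂ (λ u v → μ₀ ℓ * w₀ D + (μ₁ ℓ * u + μ₂ ℓ * v)) (diagonal D refl) (sym (w₂≡0 D refl)) ⟩
        μ₀ ℓ * w₀ D + (μ₁ ℓ * w₁ D + μ₂ ℓ * w₂ D)
          ≡⟨ incident ℓ D (𝔽.solve 1 (λ b → 𝟙 ⊗ 𝟙 ⊕ (⊝ 𝟙 ⊗ 𝟙 ⊕ (b ⊗ 𝟘 ⊕ 𝟘)) ⊜ 𝟘) refl b) ⟩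
        0# ∎)

    isRingHomomorphism : IsRingHomomorphism (FiniteField.rawRing F) (FiniteField.rawRing K) σ
    isRingHomomorphism = record
      { isSemiringHomomorphism = record
        { isNearSemiringHomomorphism = record
          { +-isMonoidHomomorphism = record
            { isMagmaHomomorphism = record { isRelHomomorphism = record { cong = cong σ } ; homo = σ-+ }
            ; ε-homo = σ-0 }
          ; *-homo = σ-* }
        ; 1#-homo = σ-1 }
      ; -‿homo = λ a → difference-zero (begin
          σ (𝔽.- a) + - - σ a ≡⟨ cong (σ (𝔽.- a) +_) (solve 1 (λ x → ⊝ (⊝ x) ⊜ x) refl (σ a)) ⟩
          σ (𝔽.- a) + σ a ≡⟨ σ-+ (𝔽.- a) a ⟨
          σ (𝔽.- a 𝔽.+ a) ≡⟨ cong σ (𝔽.-‿inverseˡ a) ⟩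
          σ 𝔽.0# ≡⟨ σ-0 ⟩
          0# ∎) }

    private
      σ-factor : ∀ {z} → z ≢ 𝔽.0# → ∃ λ d → d * σ z ≡ 1#
      σ-factor {z} z≢0 = let y , yz≡1 = 𝔽.invertible z z≢0 in σ y , trans (sym (σ-* y z)) (trans (cong σ yz≡1) σ-1)

      quotient : ∀ x {z} → z ≢ 𝔽.0# → ∃ λ a → x ≡ a 𝔽.* z
      quotient x {z} z≢0 = let y , yz≡1 = 𝔽.invertible z z≢0 in
        x 𝔽.* y , sym (trans (𝔽.*-assoc x y z) (trans (cong (x 𝔽.*_) yz≡1) (𝔽.*-identityʳ x)))

      rescale : ∀ w a d {z} → d * σ z ≡ 1# → σ a * w ≡ w * d * σ (a 𝔽.* z)
      rescale w a d {z} dσz≡1 = begin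
        σ a * w ≡⟨ solve 2 (λ a w → a ⊗ w ⊜ w ⊗ a ⊗ 𝟙) refl (σ a) w ⟩
        w * σ a * 1# ≡⟨ cong (w * σ a *_) dσz≡1 ⟨
        w * σ a * (d * σ z) ≡⟨ solve 4 (λ w a d z → w ⊗ a ⊗ (d ⊗ z) ⊜ w ⊗ d ⊗ (a ⊗ z)) refl w (σ a) d (σ z) ⟩
        w * d * (σ a * σ z) ≡⟨ cong (w * d *_) (σ-* a z) ⟨
        w * d * σ (a 𝔽.* z) ∎

      restore : ∀ w d {z} → d * σ z ≡ 1# → w ≡ w * d * σ z
      restore w d {z} dσz≡1 = sym (trans (*-assoc w d (σ z)) (trans (cong (w *_) dσz≡1) (*-identityʳ w)))

    -- A point with z ≠ 0 is determined by abscissa and ordinate. If z = 0 and x ≠ 0, it lies on the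
    -- line y = c x with c = y / x, whose image `slope-μ` describes. What remains is a vertex.
    frame-coordinates : ∀ P → _~_ K (w P) (map σ (coords P))
    frame-coordinates P@(point (x ∷ y ∷ z ∷ []) P≢0) = by-cases (z 𝔽.≟ 𝔽.0#) (x 𝔽.≟ 𝔽.0#)
      where
      from-components : ∀ {c} {u v : V 3} → c ≢ 0# → lookup u zero ≡ c * lookup v zero → lookup u (suc zero) ≡ c * lookup v (suc zero) →
                        lookup u (suc (suc zero)) ≡ c * lookup v (suc (suc zero)) → _~_ K u v
      from-components {c} {_ ∷ _ ∷ _ ∷ []} {_ ∷ _ ∷ _ ∷ []} c≢0 e₀ e₁ e₂ = c , c≢0 , cong₂ _∷_ e₀ (cong₂ _∷_ e₁ (cong₂ _∷_ e₂ refl))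
      by-cases : Dec (z ≡ 𝔽.0#) → Dec (x ≡ 𝔽.0#) → _~_ K (w P) (σ x ∷ σ y ∷ σ z ∷ [])
      by-cases (no z≢0) _ =
        let d , dσz≡1 = σ-factor z≢0
            a , x≡ = quotient x z≢0
            b , y≡ = quotient y z≢0
        in from-components (*-nonzero (w₂≢0 P z≢0) (factor-nonzero dσz≡1))
          (trans (abscissa a P x≡) (trans (rescale (w₂ P) a d dσz≡1) (cong (λ x → w₂ P * d * σ x) (sym x≡))))
          (trans (ordinate b P y≡) (trans (rescale (w₂ P) b d dσz≡1) (cong (λ y → w₂ P * d * σ y) (sym y≡))))
          (restore (w₂ P) d dσz≡1)
      by-cases (yes z≡0) (no x≢0) =
        let d , dσx≡1 = σ-factor x≢0
            c , y≡ = quotient y x≢0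
            ℓ = slope c
            w₁≡ : w₁ P ≡ σ c * w₀ P
            w₁≡ = *-cancelˡ (μ₁≢0 ℓ -1≢0) (difference-zero (begin
              μ₁ ℓ * w₁ P + - (μ₁ ℓ * (σ c * w₀ P))
                ≡⟨ solve 5 (λ m s a b e → m ⊗ b ⊕ ⊝ (m ⊗ (s ⊗ a)) ⊜ ⊝ (m ⊗ s) ⊗ a ⊕ (m ⊗ b ⊕ 𝟘 ⊗ e)) refl (μ₁ ℓ) (σ c) (w₀ P) (w₁ P) (w₂ P) ⟩
              - (μ₁ ℓ * σ c) * w₀ P + (μ₁ ℓ * w₁ P + 0# * w₂ P)
                ≡⟨ cong₂ (λ s m → s * w₀ P + (μ₁ ℓ * w₁ P + m * w₂ P)) (slope-μ c) (μ≡0 (suc (suc zero)) ℓ refl) ⟨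
              μ₀ ℓ * w₀ P + (μ₁ ℓ * w₁ P + μ₂ ℓ * w₂ P)
                ≡⟨ incident ℓ P (trans (cong (λ y → c 𝔽.* x 𝔽.+ (𝔽.- 𝔽.1# 𝔽.* y 𝔽.+ (𝔽.0# 𝔽.* z 𝔽.+ 𝔽.0#))) y≡)
                     (𝔽.solve 3 (λ c x z → c ⊗ x ⊕ (⊝ 𝟙 ⊗ (c ⊗ x) ⊕ (𝟘 ⊗ z ⊕ 𝟘)) ⊜ 𝟘) refl c x z)) ⟩
              0# ∎))
        in from-components (*-nonzero (w₀≢0 P x≢0) (factor-nonzero dσx≡1))
          (restore (w₀ P) d dσx≡1)
          (trans w₁≡ (trans (rescale (w₀ P) c d dσx≡1) (cong (λ y → w₀ P * d * σ y) (sym y≡))))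
          (trans (w₂≡0 P z≡0) (sym (trans (cong (w₀ P * d *_) (trans (cong σ z≡0) σ-0)) (zeroʳ _))))
      by-cases (yes z≡0) (yes x≡0) =
        let d , dσy≡1 = σ-factor y≢0
        in from-components (*-nonzero (w₁≢0 P y≢0) (factor-nonzero dσy≡1))
          (trans (w₀≡0 P x≡0) (sym (trans (cong (w₁ P * d *_) (trans (cong σ x≡0) σ-0)) (zeroʳ _))))
          (restore (w₁ P) d dσy≡1)
          (trans (w₂≡0 P z≡0) (sym (trans (cong (w₁ P * d *_) (trans (cong σ z≡0) σ-0)) (zeroʳ _))))
        where
        y≢0 : y ≢ 𝔽.0#
        y≢0 y≡0 = P≢0 (cong₂ _∷_ x≡0 (cong₂ _∷_ y≡0 (cong₂ _∷_ z≡0 refl)))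

  -- The images of the frame e₀, e₁, e₂, e₀ + e₁ + e₂ become the frame of K³.
  module _ (ψ ψ* : Point F 2 → Point K 2)
           (incidence : ∀ ℓ P → dot F (coords ℓ) (coords P) ≡ 𝔽.0# ⇔ coords (ψ* ℓ) ∙ coords (ψ P) ≡ 0#) where
    private
      ones : Point F 2
      ones = point (𝔽.1# ∷ 𝔽.1# ∷ 𝔽.1# ∷ []) (𝔽.1≢0 ∘ cong head)

      ⟨_,_⟩ : Point F 2 → Point F 2 → Carrier
      ⟨ ℓ , P ⟩ = coords (ψ* ℓ) ∙ coords (ψ P)

      dot-vertex : ∀ (ℓ : Point F 2) i → dot F (coords ℓ) (VF.unit i) ≡ lookup (coords ℓ) i
      dot-vertex ℓ i = trans (VF.∙-comm (coords ℓ) (VF.unit i)) (VF.unit-∙ i (coords ℓ))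

      on-vertex : ∀ ℓ i → lookup (coords ℓ) i ≡ 𝔽.0# → ⟨ ℓ , vertex i ⟩ ≡ 0#
      on-vertex ℓ i e = Equivalence.to (incidence ℓ (vertex i)) (trans (dot-vertex ℓ i) e)

      off-vertex : ∀ ℓ i → lookup (coords ℓ) i ≢ 𝔽.0# → ⟨ ℓ , vertex i ⟩ ≢ 0#
      off-vertex ℓ i ne e = ne (trans (sym (dot-vertex ℓ i)) (Equivalence.from (incidence ℓ (vertex i)) e))

      unit≢0 : ∀ (i : Fin 3) → lookup (VF.unit i) i ≢ 𝔽.0#
      unit≢0 i = 𝔽.1≢0 ∘ trans (sym (VF.lookup-unit i))

      p : Fin 3 → V 3
      p i = coords (ψ (vertex i))

      image : Vec (V 3) 3
      image = tabulate p

      -- Read as a line, vertex i is the side through the two other vertices. Pairing with its image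
      -- therefore isolates coordinate i, which makes the three images independent.
      vertex-∙ : ∀ i (cs : V 3) → coords (ψ* (vertex i)) ∙ comb image cs ≡ lookup cs i * ⟨ vertex i , vertex i ⟩
      vertex-∙ i cs = begin
        q ∙ comb image cs ≡⟨ ∙-comb q image cs ⟩
        cs ∙ map (q ∙_) image ≡⟨ cong (cs ∙_) (Vec.tabulate-∘ (q ∙_) p) ⟨
        cs ∙ tabulate ⟨ℓ⟩ ≡⟨ ∙-comm cs (tabulate ⟨ℓ⟩) ⟩
        tabulate ⟨ℓ⟩ ∙ cs ≡⟨ ∙-diagonal (tabulate ⟨ℓ⟩) cs i (λ j j≢i → trans (Vec.lookup∘tabulate ⟨ℓ⟩ j) (on-vertex (vertex i) j (VF.lookup-unit-≢ i j j≢i))) ⟩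
        lookup (tabulate ⟨ℓ⟩) i * lookup cs i ≡⟨ trans (cong (_* lookup cs i) (Vec.lookup∘tabulate ⟨ℓ⟩ i)) (*-comm _ _) ⟩
        lookup cs i * ⟨ vertex i , vertex i ⟩ ∎
        where
        q = coords (ψ* (vertex i))
        ⟨ℓ⟩ : Fin 3 → Carrier
        ⟨ℓ⟩ j = ⟨ vertex i , vertex j ⟩

      image-independent : LinearlyIndependent K image
      image-independent cs e = lookup-𝟎 cs λ i → *-zero-divisor (off-vertex (vertex i) i (unit≢0 i)) (begin
        ⟨ vertex i , vertex i ⟩ * lookup cs i ≡⟨ *-comm _ _ ⟩
        lookup cs i * ⟨ vertex i , vertex i ⟩ ≡⟨ vertex-∙ i cs ⟨
        coords (ψ* (vertex i)) ∙ comb image cs ≡⟨ trans (cong (coords (ψ* (vertex i)) ∙_) e) (∙-𝟎 (coords (ψ* (vertex i)))) ⟩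
        0# ∎)

      module Normalised (α : V 3) (ones≡ : comb image α ≡ coords (ψ ones)) where
        -- The unit point lies on no side of the triangle, and non-incidence is preserved.
        α≢0 : ∀ i → lookup α i ≢ 0#
        α≢0 i αᵢ≡0 = unit≢0 i (begin
          lookup (VF.unit i) i ≡⟨ ones-∙ i ⟨
          dot F (VF.unit i) (coords ones) ≡⟨ Equivalence.from (incidence (vertex i) ones) (begin
            coords (ψ* (vertex i)) ∙ coords (ψ ones) ≡⟨ cong (coords (ψ* (vertex i)) ∙_) ones≡ ⟨
            coords (ψ* (vertex i)) ∙ comb image α ≡⟨ vertex-∙ i α ⟩
            lookup α i * ⟨ vertex i , vertex i ⟩ ≡⟨ cong (_* ⟨ vertex i , vertex i ⟩) αᵢ≡0 ⟩
            0# * ⟨ vertex i , vertex i ⟩ ≡⟨ zeroˡ _ ⟩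
            0# ∎) ⟩
          𝔽.0# ∎)
          where
          ones-∙ : ∀ i → dot F (VF.unit i) (coords ones) ≡ lookup (VF.unit i) i
          ones-∙ i = trans (VF.unit-∙ i (coords ones)) (trans (Vec.lookup-replicate i 𝔽.1#) (sym (VF.lookup-unit i)))

        A : Vec (V 3) 3
        A = tabulate λ i → lookup α i ⊡ p i

        comb-scaled : ∀ {k} (p : Fin k → V 3) (α cs : V k) → comb (tabulate λ i → lookup α i ⊡ p i) cs ≡ comb (tabulate p) (zipWith _*_ cs α)
        comb-scaled p [] [] = refl
        comb-scaled p (a ∷ α) (c ∷ cs) = cong₂ _⊞_ (sym (⊡-assoc c a (p zero))) (comb-scaled (p ∘ suc) α cs)

        A-independent : LinearlyIndependent K A
        A-independent cs e = lookup-𝟎 cs λ i → *-zero-divisor (α≢0 i) (begin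
          lookup α i * lookup cs i ≡⟨ *-comm _ _ ⟩
          lookup cs i * lookup α i ≡⟨ Vec.lookup-zipWith _*_ i cs α ⟨
          lookup (zipWith _*_ cs α) i ≡⟨ cong (λ v → lookup v i) (image-independent (zipWith _*_ cs α) (trans (sym (comb-scaled p α cs)) e)) ⟩
          lookup 𝟎 i ≡⟨ Vec.lookup-replicate i 0# ⟩
          0# ∎)

        w : Point F 2 → V 3
        w P = proj₁ (independent⇒spanning A A-independent (coords (ψ P)))

        A-w : ∀ P → comb A (w P) ≡ coords (ψ P)
        A-w P = proj₂ (independent⇒spanning A A-independent (coords (ψ P)))

        -- The coordinates of the line `ψ* ℓ` dual to the basis `A`: its values on the rescaled
        -- vertices.
        μ : Point F 2 → V 3
        μ ℓ = tabulate λ i → lookup α i * ⟨ ℓ , vertex i ⟩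

        μ-∙ : ∀ ℓ (v : V 3) {u} → comb A v ≡ u → μ ℓ ∙ v ≡ coords (ψ* ℓ) ∙ u
        μ-∙ ℓ v {u} e = begin
          μ ℓ ∙ v ≡⟨ ∙-comm (μ ℓ) v ⟩
          v ∙ tabulate (λ i → lookup α i * ⟨ ℓ , vertex i ⟩) ≡⟨ cong (v ∙_) (Vec.tabulate-cong (λ i → ∙-⊡ q (lookup α i) (p i))) ⟨
          v ∙ tabulate (λ i → q ∙ (lookup α i ⊡ p i)) ≡⟨ cong (v ∙_) (Vec.tabulate-∘ (q ∙_) (λ i → lookup α i ⊡ p i)) ⟩
          v ∙ map (q ∙_) A ≡⟨ ∙-comb q A v ⟨
          q ∙ comb A v ≡⟨ cong (q ∙_) e ⟩
          q ∙ u ∎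
          where q = coords (ψ* ℓ)

        A-ones : comb A (1# ∷ 1# ∷ 1# ∷ []) ≡ coords (ψ ones)
        A-ones = trans (comb-scaled p α (1# ∷ 1# ∷ 1# ∷ [])) (trans (cong (comb image) (⊡-identity′ α)) ones≡)
          where
          ⊡-identity′ : ∀ v → zipWith _*_ (1# ∷ 1# ∷ 1# ∷ []) v ≡ v
          ⊡-identity′ (x ∷ y ∷ z ∷ []) = cong₂ _∷_ (*-identityˡ x) (cong₂ _∷_ (*-identityˡ y) (cong₂ _∷_ (*-identityˡ z) refl))

        μ-incidence : ∀ ℓ P → dot F (coords ℓ) (coords P) ≡ 𝔽.0# ⇔ μ ℓ ∙ w P ≡ 0#
        μ-incidence ℓ P = subst (λ x → dot F (coords ℓ) (coords P) ≡ 𝔽.0# ⇔ x ≡ 0#) (sym (μ-∙ ℓ (w P) (A-w P))) (incidence ℓ P)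

        lookup-μ : ∀ i ℓ → lookup (μ ℓ) i ≡ lookup α i * ⟨ ℓ , vertex i ⟩
        lookup-μ i ℓ = Vec.lookup∘tabulate (λ i → lookup α i * ⟨ ℓ , vertex i ⟩) i

        module Fr = Frame w μ μ-incidence
          (λ i ℓ e → trans (lookup-μ i ℓ) (trans (cong (lookup α i *_) (on-vertex ℓ i e)) (zeroʳ _)))
          (λ i ℓ ne e → *-nonzero (α≢0 i) (off-vertex ℓ i ne) (trans (sym (lookup-μ i ℓ)) e))
          (λ ℓ e → trans (μ-∙ ℓ (1# ∷ 1# ∷ 1# ∷ []) A-ones) (Equivalence.to (incidence ℓ ones) e))

        ψ-coordinates : ∀ P → _~_ K (coords (ψ P)) (comb A (map Fr.σ (coords P)))
        ψ-coordinates P = let c , c≢0 , e = Fr.frame-coordinates P in c , c≢0 , (begin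
          coords (ψ P) ≡⟨ A-w P ⟨
          comb A (w P) ≡⟨ cong (comb A) e ⟩
          comb A (c ⊡ map Fr.σ (coords P)) ≡⟨ IsLinear.⊡-homo (comb-linear A) c (map Fr.σ (coords P)) ⟩
          c ⊡ comb A (map Fr.σ (coords P)) ∎)

    Semilinear : Set
    Semilinear = ∃ λ (A : Vec (V 3) 3) → LinearlyIndependent K A × ∃ λ (σ : 𝔽.Carrier → Carrier) →
      IsRingHomomorphism (FiniteField.rawRing F) (FiniteField.rawRing K) σ ×
      (∀ P → _~_ K (coords (ψ P)) (comb A (map σ (coords P))))

    semilinear : Semilinear
    semilinear = from-ones (independent⇒spanning image image-independent (coords (ψ ones)))
      where
      from-ones : Span K image (coords (ψ ones)) → Semilinear
      from-ones (α , ones≡) = A , A-independent , Fr.σ , Fr.isRingHomomorphism , ψ-coordinates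
        where open Normalised α ones≡

-- Coordinates on the Bruck-Bose representation

module TraceTheory {q : ℕ} (primePower : PrimePower q) (2≤q : 2 ≤ q) (E : CubicExtension q) where
  open CubicTheory primePower 2≤q E public
  module VF = VectorTheory F
  open 𝕂 public
  open VectorTheory K public
  module Extend = HomTheory {A = F} {B = K} embed +-homo *-homo 0#-homo
  module Frobenius = HomTheory {A = K} {B = K} φ φ-+ φ-* φ-0
  open ≡-Reasoning

  ext : ∀ {n} → VF.V n → V n
  ext = extend E

  frob : ∀ {n} → V n → V n
  frob = frobenius E

  frob³ : ∀ {n} (v : V n) → frob (frob (frob v)) ≡ v
  frob³ [] = refl
  frob³ (x ∷ v) = cong₂ _∷_ (φ³ x) (frob³ v)

  frob-ext : ∀ {n} (v : VF.V n) → frob (ext v) ≡ ext v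
  frob-ext [] = refl
  frob-ext (x ∷ v) = cong₂ _∷_ (φ-embed x) (frob-ext v)

  ext-injective : ∀ {n} → Injective _≡_ _≡_ (ext {n})
  ext-injective {x = []} {[]} e = refl
  ext-injective {x = x ∷ u} {y ∷ v} e = cong₂ _∷_ (embed-injective (cong head e)) (ext-injective (cong tail e))

  frob-fixed : ∀ {n} (v : V n) → frob v ≡ v → ∃ λ u → ext u ≡ v
  frob-fixed [] e = [] , refl
  frob-fixed (x ∷ v) e =
    let a , a≡x = fixed⇒embedded (cong head e)
        u , u≡v = frob-fixed v (cong tail e)
    in a ∷ u , cong₂ _∷_ a≡x u≡v

  trᵛ : ∀ {n} → V n → V n
  trᵛ v = v ⊞ (frob v ⊞ frob (frob v))

  trᵛ-⊞ : ∀ {n} (u v : V n) → trᵛ (u ⊞ v) ≡ trᵛ u ⊞ trᵛ v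
  trᵛ-⊞ u v = begin
    (u ⊞ v) ⊞ (frob (u ⊞ v) ⊞ frob (frob (u ⊞ v)))
      ≡⟨ cong ((u ⊞ v) ⊞_) (cong₂ _⊞_ (Frobenius.map-⊞ u v) (trans (cong frob (Frobenius.map-⊞ u v)) (Frobenius.map-⊞ (frob u) (frob v)))) ⟩
    (u ⊞ v) ⊞ ((frob u ⊞ frob v) ⊞ (frob (frob u) ⊞ frob (frob v)))
      ≡⟨ cong ((u ⊞ v) ⊞_) (⊞-interchange (frob u) (frob v) (frob (frob u)) (frob (frob v))) ⟩
    (u ⊞ v) ⊞ ((frob u ⊞ frob (frob u)) ⊞ (frob v ⊞ frob (frob v)))
      ≡⟨ ⊞-interchange u v (frob u ⊞ frob (frob u)) (frob v ⊞ frob (frob v)) ⟩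
    trᵛ u ⊞ trᵛ v ∎

  trᵛ-⊡ : ∀ {n} c (v : V n) → trᵛ (c ⊡ v) ≡ c ⊡ v ⊞ (φ c ⊡ frob v ⊞ φ (φ c) ⊡ frob (frob v))
  trᵛ-⊡ c v = cong (c ⊡ v ⊞_) (cong₂ _⊞_ (Frobenius.map-⊡ c v)
    (trans (cong frob (Frobenius.map-⊡ c v)) (Frobenius.map-⊡ (φ c) (frob v))))

  trᵛ-embed : ∀ {n} c (v : V n) → trᵛ (embed c ⊡ v) ≡ embed c ⊡ trᵛ v
  trᵛ-embed c v = begin
    trᵛ (embed c ⊡ v) ≡⟨ trᵛ-⊡ (embed c) v ⟩
    embed c ⊡ v ⊞ (φ (embed c) ⊡ frob v ⊞ φ (φ (embed c)) ⊡ frob (frob v))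
      ≡⟨ cong₂ (λ a b → embed c ⊡ v ⊞ (a ⊡ frob v ⊞ b ⊡ frob (frob v))) (φ-embed c) (trans (cong φ (φ-embed c)) (φ-embed c)) ⟩
    embed c ⊡ v ⊞ (embed c ⊡ frob v ⊞ embed c ⊡ frob (frob v))
      ≡⟨ trans (⊡-distribˡ (embed c) v (frob v ⊞ frob (frob v))) (cong (embed c ⊡ v ⊞_) (⊡-distribˡ (embed c) (frob v) (frob (frob v)))) ⟨
    embed c ⊡ trᵛ v ∎

  trᵛ-scaled-fixed : ∀ {n} c (v : V n) → frob v ≡ v → trᵛ (c ⊡ v) ≡ tr c ⊡ v
  trᵛ-scaled-fixed c v e = begin
    trᵛ (c ⊡ v) ≡⟨ trᵛ-⊡ c v ⟩
    c ⊡ v ⊞ (φ c ⊡ frob v ⊞ φ (φ c) ⊡ frob (frob v)) ≡⟨ cong₂ (λ a b → c ⊡ v ⊞ (φ c ⊡ a ⊞ φ (φ c) ⊡ b)) e (trans (cong frob e) e) ⟩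
    c ⊡ v ⊞ (φ c ⊡ v ⊞ φ (φ c) ⊡ v) ≡⟨ trans (⊡-distribʳ c (φ c + φ (φ c)) v) (cong (c ⊡ v ⊞_) (⊡-distribʳ (φ c) (φ (φ c)) v)) ⟨
    tr c ⊡ v ∎

  frob-trᵛ : ∀ {n} (v : V n) → frob (trᵛ v) ≡ trᵛ v
  frob-trᵛ [] = refl
  frob-trᵛ (x ∷ v) = cong₂ _∷_ (φ-tr x) (frob-trᵛ v)

  trᵛ-frob : ∀ {n} (v : V n) → trᵛ (frob v) ≡ trᵛ v
  trᵛ-frob v = begin
    frob v ⊞ (frob (frob v) ⊞ frob (frob (frob v))) ≡⟨ cong (λ w → frob v ⊞ (frob (frob v) ⊞ w)) (frob³ v) ⟩
    frob v ⊞ (frob (frob v) ⊞ v) ≡⟨ ⊞-assoc (frob v) (frob (frob v)) v ⟨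
    (frob v ⊞ frob (frob v)) ⊞ v ≡⟨ ⊞-comm _ v ⟩
    trᵛ v ∎

  -- Since φ³ is the identity, the vector on the left is the conjugate of φ²(c) v, and conjugates
  -- have the same trace.
  trᵛ-conjugate : ∀ {n} c (v : V n) → trᵛ (c ⊡ frob v) ≡ trᵛ (φ (φ c) ⊡ v)
  trᵛ-conjugate c v = begin
    trᵛ (c ⊡ frob v) ≡⟨ cong (λ a → trᵛ (a ⊡ frob v)) (φ³ c) ⟨
    trᵛ (φ (φ (φ c)) ⊡ frob v) ≡⟨ cong trᵛ (Frobenius.map-⊡ (φ (φ c)) v) ⟨
    trᵛ (frob (φ (φ c) ⊡ v)) ≡⟨ trᵛ-frob (φ (φ c) ⊡ v) ⟩
    trᵛ (φ (φ c) ⊡ v) ∎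

  trᵛ-collapse : ∀ {n} a b c (v : V n) → ∃ λ k → trᵛ (a ⊡ v) ⊞ (trᵛ (b ⊡ frob v) ⊞ trᵛ (c ⊡ frob (frob v))) ≡ trᵛ (k ⊡ v)
  trᵛ-collapse a b c v = a + (φ (φ b) + φ (φ (φ (φ c)))) , (begin
    trᵛ (a ⊡ v) ⊞ (trᵛ (b ⊡ frob v) ⊞ trᵛ (c ⊡ frob (frob v)))
      ≡⟨ cong₂ (λ s t → trᵛ (a ⊡ v) ⊞ (s ⊞ t)) (trᵛ-conjugate b v) (trans (trᵛ-conjugate c (frob v)) (trᵛ-conjugate (φ (φ c)) v)) ⟩
    trᵛ (a ⊡ v) ⊞ (trᵛ (b′ ⊡ v) ⊞ trᵛ (c′ ⊡ v))
      ≡⟨ trans (trᵛ-⊞ (a ⊡ v) (b′ ⊡ v ⊞ c′ ⊡ v)) (cong (trᵛ (a ⊡ v) ⊞_) (trᵛ-⊞ (b′ ⊡ v) (c′ ⊡ v))) ⟨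
    trᵛ (a ⊡ v ⊞ (b′ ⊡ v ⊞ c′ ⊡ v))
      ≡⟨ cong trᵛ (trans (⊡-distribʳ a (b′ + c′) v) (cong (a ⊡ v ⊞_) (⊡-distribʳ b′ c′ v))) ⟨
    trᵛ ((a + (b′ + c′)) ⊡ v) ∎)
    where
    b′ = φ (φ b)
    c′ = φ (φ (φ (φ c)))

  -- With trᵛ-collapse: an element of the span of the conjugates of v that is
  -- fixed by Frobenius is a trace.
  trᵛ-unit : ∀ {n} (v : V n) → frob v ≡ v → trᵛ (proj₁ trace-one ⊡ v) ≡ v
  trᵛ-unit v e = trans (trᵛ-scaled-fixed (proj₁ trace-one) v e) (trans (cong (_⊡ v) (proj₂ trace-one)) (⊡-identity v))

  ∙-trᵛ : ∀ {n} (u : VF.V n) (v : V n) → ext u ∙ v ≡ 0# → ext u ∙ trᵛ v ≡ 0#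
  ∙-trᵛ u v e = begin
    ext u ∙ trᵛ v ≡⟨ trans (∙-⊞ (ext u) v _) (cong (ext u ∙ v +_) (∙-⊞ (ext u) (frob v) (frob (frob v)))) ⟩
    ext u ∙ v + (ext u ∙ frob v + ext u ∙ frob (frob v)) ≡⟨ cong₂ _+_ e (cong₂ _+_ (conj v e) (conj (frob v) (conj v e))) ⟩
    0# + (0# + 0#) ≡⟨ trans (+-identityˡ _) (+-identityˡ _) ⟩
    0# ∎
    where
    conj : ∀ w → ext u ∙ w ≡ 0# → ext u ∙ frob w ≡ 0#
    conj w e = begin
      ext u ∙ frob w ≡⟨ cong (_∙ frob w) (frob-ext u) ⟨
      frob (ext u) ∙ frob w ≡⟨ Frobenius.map-∙ (ext u) w ⟨
      φ (ext u ∙ w) ≡⟨ trans (cong φ e) φ-0 ⟩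
      0# ∎

  module _ (Σ∞ : Point F 6) (𝓢 : RegularSpread E Σ∞) where
    open RegularSpread 𝓢

    g₁ g₂ : V 7
    g₁ = head (Flat.basis g)
    g₂ = head (tail (Flat.basis g))

    OnPlane : V 7 → VF.V 7 → Set
    OnPlane X v = dot F (coords Σ∞) v ≡ 𝔽.0# × Span K (X ∷ frob X ∷ frob (frob X) ∷ []) (ext v)

    -- F⁷ ≅ K² × F with Σ∞ the subspace K² and the spread planes its K-lines:
    -- (x , y , z) corresponds to Tr(x g₁ + y g₂) + z e for a point e off Σ∞.
    record Coordinates : Set where
      field
        Θ : VF.V 7 → V 3
        Θ-⊞ : ∀ u v → Θ (u VF.⊞ v) ≡ Θ u ⊞ Θ v
        Θ-⊡ : ∀ c v → Θ (c VF.⊡ v) ≡ embed c ⊡ Θ v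
        Θ-injective : Injective _≡_ _≡_ Θ
        Θ-third : ∀ v → head (tail (tail (Θ v))) ≡ embed (dot F (coords Σ∞) v)
        Θ-onto : ∀ x y z → ∃ λ v → Θ v ≡ x ∷ y ∷ embed z ∷ []
        Θ-plane : ∀ x y v → OnPlane (comb (Flat.basis g) (x ∷ y ∷ [])) v ⇔ Θ v ∝ (x ∷ y ∷ 0# ∷ [])

    private
      h = coords Σ∞

    module Construction (e : VF.V 7) (he≡1 : dot F h e ≡ 𝔽.1#) (b₁ b₂ : V 7) (basis≡ : Flat.basis g ≡ b₁ ∷ b₂ ∷ []) where
      open VF using () renaming (_⊞_ to _⊞ᶠ_; _⊡_ to _⊡ᶠ_)

      Triple : Set
      Triple = Carrier × Carrier × 𝔽.Carrier

      mix : Carrier → Carrier → V 7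
      mix x y = x ⊡ b₁ ⊞ y ⊡ b₂

      mix≡comb : ∀ x y → comb (Flat.basis g) (x ∷ y ∷ []) ≡ mix x y
      mix≡comb x y = trans (cong (λ b → comb b (x ∷ y ∷ [])) basis≡) (cong (x ⊡ b₁ ⊞_) (⊞-identityʳ (y ⊡ b₂)))

      J : Triple → V 7
      J (x , y , z) = trᵛ (mix x y) ⊞ embed z ⊡ ext e

      frob-J : ∀ t → frob (J t) ≡ J t
      frob-J (x , y , z) = trans (Frobenius.map-⊞ (trᵛ (mix x y)) (embed z ⊡ ext e))
        (cong₂ _⊞_ (frob-trᵛ (mix x y)) (trans (Frobenius.map-⊡ (embed z) (ext e)) (cong₂ _⊡_ (φ-embed z) (frob-ext e))))

      opaque
        Ψ : Triple → VF.V 7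
        Ψ t = proj₁ (frob-fixed (J t) (frob-J t))

        ext-Ψ : ∀ t → ext (Ψ t) ≡ J t
        ext-Ψ t = proj₂ (frob-fixed (J t) (frob-J t))

      trᵛ-mix : ∀ x y → trᵛ (mix x y) ≡ trᵛ (x ⊡ b₁) ⊞ trᵛ (y ⊡ b₂)
      trᵛ-mix x y = trᵛ-⊞ (x ⊡ b₁) (y ⊡ b₂)

      -- A vector v over F is Tr(λ₁ v) when tr λ₁ = 1. Expanding v in the conjugates of b₁ and b₂
      -- and moving all scalars onto b₁ and b₂ themselves leaves the trace of one combination.
      on-hyperplane : ∀ v → dot F h v ≡ 𝔽.0# → ∃ λ x → ∃ λ y → ext v ≡ trᵛ (mix x y)
      on-hyperplane v hv≡0 = collapse (g-spanning (ext v) hyper)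
        where
        hyper : InΣ∞ᴷ E Σ∞ (ext v)
        hyper = trans (sym (Extend.map-∙ h v)) (trans (cong embed hv≡0) 0#-homo)
        λ₁ = proj₁ trace-one
        conj≡ : conjugates ≡ b₁ ∷ b₂ ∷ frob b₁ ∷ frob b₂ ∷ frob (frob b₁) ∷ frob (frob b₂) ∷ []
        conj≡ = cong (λ b → b ++ map (frobenius E) b ++ map (λ v → frobenius E (frobenius E v)) b) basis≡
        collapse : Span K conjugates (ext v) → ∃ λ x → ∃ λ y → ext v ≡ trᵛ (mix x y)
        collapse (a₁ ∷ a₂ ∷ a₃ ∷ a₄ ∷ a₅ ∷ a₆ ∷ [] , span) =
          let k , k≡ = trᵛ-collapse (λ₁ * a₁) (λ₁ * a₃) (λ₁ * a₅) b₁
              l , l≡ = trᵛ-collapse (λ₁ * a₂) (λ₁ * a₄) (λ₁ * a₆) b₂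
          in k , l , (begin
            ext v ≡⟨ trᵛ-unit (ext v) (frob-ext v) ⟨
            trᵛ (λ₁ ⊡ ext v) ≡⟨ cong (λ w → trᵛ (λ₁ ⊡ w)) (trans (sym span) (cong (λ b → comb b (a₁ ∷ a₂ ∷ a₃ ∷ a₄ ∷ a₅ ∷ a₆ ∷ [])) conj≡)) ⟩
            trᵛ (λ₁ ⊡ comb (b₁ ∷ b₂ ∷ frob b₁ ∷ frob b₂ ∷ frob (frob b₁) ∷ frob (frob b₂) ∷ []) (a₁ ∷ a₂ ∷ a₃ ∷ a₄ ∷ a₅ ∷ a₆ ∷ []))
              ≡⟨ cong trᵛ (IsLinear.⊡-homo (comb-linear (b₁ ∷ b₂ ∷ frob b₁ ∷ frob b₂ ∷ frob (frob b₁) ∷ frob (frob b₂) ∷ [])) λ₁ (a₁ ∷ a₂ ∷ a₃ ∷ a₄ ∷ a₅ ∷ a₆ ∷ [])) ⟨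
            trᵛ (c₁ ⊞ (c₂ ⊞ (c₃ ⊞ (c₄ ⊞ (c₅ ⊞ (c₆ ⊞ 𝟎))))))
              ≡⟨ trans (trᵛ-⊞ c₁ _) (cong (trᵛ c₁ ⊞_) (trans (trᵛ-⊞ c₂ _) (cong (trᵛ c₂ ⊞_) (trans (trᵛ-⊞ c₃ _) (cong (trᵛ c₃ ⊞_)
                   (trans (trᵛ-⊞ c₄ _) (cong (trᵛ c₄ ⊞_) (trans (trᵛ-⊞ c₅ _) (cong (λ w → trᵛ c₅ ⊞ trᵛ w) (⊞-identityʳ c₆)))))))))) ⟩
            trᵛ c₁ ⊞ (trᵛ c₂ ⊞ (trᵛ c₃ ⊞ (trᵛ c₄ ⊞ (trᵛ c₅ ⊞ trᵛ c₆))))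
              ≡⟨ shuffle (trᵛ c₁) (trᵛ c₂) (trᵛ c₃) (trᵛ c₄) (trᵛ c₅) (trᵛ c₆) ⟩
            (trᵛ c₁ ⊞ (trᵛ c₃ ⊞ trᵛ c₅)) ⊞ (trᵛ c₂ ⊞ (trᵛ c₄ ⊞ trᵛ c₆)) ≡⟨ cong₂ _⊞_ k≡ l≡ ⟩
            trᵛ (k ⊡ b₁) ⊞ trᵛ (l ⊡ b₂) ≡⟨ trᵛ-mix k l ⟨
            trᵛ (mix k l) ∎)
          where
          c₁ = (λ₁ * a₁) ⊡ b₁
          c₂ = (λ₁ * a₂) ⊡ b₂
          c₃ = (λ₁ * a₃) ⊡ frob b₁
          c₄ = (λ₁ * a₄) ⊡ frob b₂
          c₅ = (λ₁ * a₅) ⊡ frob (frob b₁)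
          c₆ = (λ₁ * a₆) ⊡ frob (frob b₂)
          shuffle : ∀ {n} (a b c d e f : V n) → a ⊞ (b ⊞ (c ⊞ (d ⊞ (e ⊞ f)))) ≡ (a ⊞ (c ⊞ e)) ⊞ (b ⊞ (d ⊞ f))
          shuffle [] [] [] [] [] [] = refl
          shuffle (a ∷ as) (b ∷ bs) (c ∷ cs) (d ∷ ds) (e ∷ es) (f ∷ fs) = cong₂ _∷_
            (solve 6 (λ a b c d e f → a ⊕ (b ⊕ (c ⊕ (d ⊕ (e ⊕ f)))) ⊜ (a ⊕ (c ⊕ e)) ⊕ (b ⊕ (d ⊕ f))) refl a b c d e f)
            (shuffle as bs cs ds es fs)

      opaque
        surjective : ∀ v → ∃ λ t → Ψ t ≡ v
        surjective v = assemble (on-hyperplane v₀ hv₀≡0)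
          where
          z : 𝔽.Carrier
          z = dot F h v
          v₀ : VF.V 7
          v₀ = v ⊞ᶠ (𝔽.- 𝔽.1#) ⊡ᶠ (z ⊡ᶠ e)
          hv₀≡0 : dot F h v₀ ≡ 𝔽.0#
          hv₀≡0 = trans (VF.∙-⊞ h v ((𝔽.- 𝔽.1#) ⊡ᶠ (z ⊡ᶠ e))) (trans (cong (z 𝔽.+_)
                      (trans (VF.∙-⊡ h (𝔽.- 𝔽.1#) (z ⊡ᶠ e)) (cong (𝔽.- 𝔽.1# 𝔽.*_) (trans (VF.∙-⊡ h z e) (cong (z 𝔽.*_) he≡1)))))
                    (𝔽.solve 1 (λ z → z ⊕ ⊝ 𝟙 ⊗ (z ⊗ 𝟙) ⊜ 𝟘) refl z))
          assemble : (∃ λ x → ∃ λ y → ext v₀ ≡ trᵛ (mix x y)) → ∃ λ t → Ψ t ≡ v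
          assemble (x , y , v₀≡) = (x , y , z) , ext-injective (begin
            ext (Ψ (x , y , z)) ≡⟨ ext-Ψ (x , y , z) ⟩
            trᵛ (mix x y) ⊞ embed z ⊡ ext e ≡⟨ cong₂ _⊞_ v₀≡ (Extend.map-⊡ z e) ⟨
            ext v₀ ⊞ ext (z ⊡ᶠ e) ≡⟨ Extend.map-⊞ v₀ (z ⊡ᶠ e) ⟨
            ext (v₀ ⊞ᶠ z ⊡ᶠ e) ≡⟨ cong ext (VF.⊟-cancel v (z ⊡ᶠ e)) ⟩
            ext v ∎)

      Triple-finite : Triple ↔ Fin (q ℕ.^ 7)
      Triple-finite = subst (λ n → Triple ↔ Fin n) count (×-finite enumeration (×-finite enumeration 𝔽.enumeration))
        where
        count : q ℕ.^ 3 ℕ.* (q ℕ.^ 3 ℕ.* q) ≡ q ℕ.^ 7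
        count = trans (cong (λ r → q ℕ.^ 3 ℕ.* (q ℕ.^ 3 ℕ.* r)) (sym (ℕ.*-identityʳ q)))
          (trans (cong (q ℕ.^ 3 ℕ.*_) (sym (ℕ.^-distribˡ-+-* q 3 1))) (sym (ℕ.^-distribˡ-+-* q 3 4)))

      opaque
        -- By counting: K × K × F and F⁷ both have q⁷ elements.
        injective : Injective _≡_ _≡_ Ψ
        injective = surjective⇒injective Triple-finite (vec-finite 𝔽.enumeration 7) Ψ surjective

      coords-of : Triple → V 3
      coords-of (x , y , z) = x ∷ y ∷ embed z ∷ []

      Ψ⁻¹ : VF.V 7 → Triple
      Ψ⁻¹ v = proj₁ (surjective v)

      Ψ-Ψ⁻¹ : ∀ v → Ψ (Ψ⁻¹ v) ≡ v
      Ψ-Ψ⁻¹ v = proj₂ (surjective v)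

      Θ : VF.V 7 → V 3
      Θ v = coords-of (Ψ⁻¹ v)

      Θ-Ψ : ∀ t → Θ (Ψ t) ≡ coords-of t
      Θ-Ψ t = cong coords-of (injective (Ψ-Ψ⁻¹ (Ψ t)))

      Θ≡ : ∀ v t → ext v ≡ J t → Θ v ≡ coords-of t
      Θ≡ v t e = trans (cong Θ (ext-injective (trans e (sym (ext-Ψ t))))) (Θ-Ψ t)

      ext-J : ∀ v → ext v ≡ J (Ψ⁻¹ v)
      ext-J v = trans (cong ext (sym (Ψ-Ψ⁻¹ v))) (ext-Ψ (Ψ⁻¹ v))

      J-+ : ∀ x y z x′ y′ z′ → J (x , y , z) ⊞ J (x′ , y′ , z′) ≡ J (x + x′ , y + y′ , z 𝔽.+ z′)
      J-+ x y z x′ y′ z′ = trans (⊞-interchange (trᵛ (mix x y)) (embed z ⊡ ext e) (trᵛ (mix x′ y′)) (embed z′ ⊡ ext e)) (cong₂ _⊞_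
        (trans (sym (trᵛ-⊞ (mix x y) (mix x′ y′))) (cong trᵛ (trans (⊞-interchange (x ⊡ b₁) (y ⊡ b₂) (x′ ⊡ b₁) (y′ ⊡ b₂))
          (sym (cong₂ _⊞_ (⊡-distribʳ x x′ b₁) (⊡-distribʳ y y′ b₂))))))
        (trans (sym (⊡-distribʳ (embed z) (embed z′) (ext e))) (cong (_⊡ ext e) (sym (+-homo z z′)))))

      J-* : ∀ c x y z → embed c ⊡ J (x , y , z) ≡ J (embed c * x , embed c * y , c 𝔽.* z)
      J-* c x y z = trans (⊡-distribˡ (embed c) (trᵛ (mix x y)) (embed z ⊡ ext e)) (cong₂ _⊞_
        (trans (sym (trᵛ-embed c (mix x y))) (cong trᵛ (trans (⊡-distribˡ (embed c) (x ⊡ b₁) (y ⊡ b₂))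
          (sym (cong₂ _⊞_ (⊡-assoc (embed c) x b₁) (⊡-assoc (embed c) y b₂))))))
        (trans (sym (⊡-assoc (embed c) (embed z) (ext e))) (cong (_⊡ ext e) (sym (*-homo c z)))))

      g-in-hyperplane : ∀ c₁ c₂ {b} → comb (Flat.basis g) (c₁ ∷ c₂ ∷ []) ≡ b → c₁ ∷ c₂ ∷ [] ≢ 𝟎 → ext h ∙ b ≡ 0#
      g-in-hyperplane c₁ c₂ {b} span ne = g-in-Σ∞ (point b (λ b≡𝟎 → ne (Flat.independent g (c₁ ∷ c₂ ∷ []) (trans span b≡𝟎)))) (c₁ ∷ c₂ ∷ [] , span)

      hb₁≡0 : ext h ∙ b₁ ≡ 0#
      hb₁≡0 = g-in-hyperplane 1# 0# (trans (mix≡comb 1# 0#) (trans (cong₂ _⊞_ (⊡-identity b₁) (⊡-zeroˡ b₂)) (⊞-identityʳ b₁))) (1≢0 ∘ cong head)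

      hb₂≡0 : ext h ∙ b₂ ≡ 0#
      hb₂≡0 = g-in-hyperplane 0# 1# (trans (mix≡comb 0# 1#) (trans (cong₂ _⊞_ (⊡-zeroˡ b₁) (⊡-identity b₂)) (⊞-identityˡ b₂))) (1≢0 ∘ cong (head ∘ tail))

      h-J : ∀ x y z → ext h ∙ J (x , y , z) ≡ embed z
      h-J x y z = begin
        ext h ∙ (trᵛ (mix x y) ⊞ embed z ⊡ ext e) ≡⟨ ∙-⊞ (ext h) (trᵛ (mix x y)) (embed z ⊡ ext e) ⟩
        ext h ∙ trᵛ (mix x y) + ext h ∙ (embed z ⊡ ext e)
          ≡⟨ cong₂ _+_ (∙-trᵛ h (mix x y) h-mix) (trans (∙-⊡ (ext h) (embed z) (ext e)) (cong (embed z *_) (trans (sym (Extend.map-∙ h e)) (trans (cong embed he≡1) 1#-homo)))) ⟩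
        0# + embed z * 1# ≡⟨ solve 1 (λ z → 𝟘 ⊕ z ⊗ 𝟙 ⊜ z) refl (embed z) ⟩
        embed z ∎
        where
        h-mix : ext h ∙ mix x y ≡ 0#
        h-mix = trans (∙-⊞ (ext h) (x ⊡ b₁) (y ⊡ b₂)) (trans (cong₂ _+_ (trans (∙-⊡ (ext h) x b₁) (cong (x *_) hb₁≡0)) (trans (∙-⊡ (ext h) y b₂) (cong (y *_) hb₂≡0)))
          (solve 2 (λ x y → x ⊗ 𝟘 ⊕ y ⊗ 𝟘 ⊜ 𝟘) refl x y))

      J-0 : ∀ x y → J (x , y , 𝔽.0#) ≡ trᵛ (mix x y)
      J-0 x y = trans (cong (trᵛ (mix x y) ⊞_) (trans (cong (_⊡ ext e) 0#-homo) (⊡-zeroˡ (ext e)))) (⊞-identityʳ (trᵛ (mix x y)))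

      mix-⊡ : ∀ k x y → k ⊡ mix x y ≡ mix (k * x) (k * y)
      mix-⊡ k x y = trans (⊡-distribˡ k (x ⊡ b₁) (y ⊡ b₂)) (sym (cong₂ _⊞_ (⊡-assoc k x b₁) (⊡-assoc k y b₂)))

      -- The argument of `on-hyperplane` for the single vector X: a vector over F in the span of the
      -- conjugates of X is the trace of some k X, and such traces have the coordinates k (x, y, 0).
      plane⇒ : ∀ x y v → OnPlane (mix x y) v → Θ v ∝ (x ∷ y ∷ 0# ∷ [])
      plane⇒ x y v (_ , (a ∷ b ∷ c ∷ [] , span)) = k , trans (Θ≡ v (k * x , k * y , 𝔽.0#) v≡)
          (cong (λ z → k * x ∷ k * y ∷ z ∷ []) (trans 0#-homo (sym (zeroʳ k))))
        where
        X = mix x y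
        λ₁ = proj₁ trace-one
        collapsed = trᵛ-collapse (λ₁ * a) (λ₁ * b) (λ₁ * c) X
        k = proj₁ collapsed
        v≡ : ext v ≡ J (k * x , k * y , 𝔽.0#)
        v≡ = begin
          ext v ≡⟨ trᵛ-unit (ext v) (frob-ext v) ⟨
          trᵛ (λ₁ ⊡ ext v) ≡⟨ cong (λ w → trᵛ (λ₁ ⊡ w)) span ⟨
          trᵛ (λ₁ ⊡ comb (X ∷ frob X ∷ frob (frob X) ∷ []) (a ∷ b ∷ c ∷ []))
            ≡⟨ cong trᵛ (IsLinear.⊡-homo (comb-linear (X ∷ frob X ∷ frob (frob X) ∷ [])) λ₁ (a ∷ b ∷ c ∷ [])) ⟨
          trᵛ ((λ₁ * a) ⊡ X ⊞ ((λ₁ * b) ⊡ frob X ⊞ ((λ₁ * c) ⊡ frob (frob X) ⊞ 𝟎)))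
            ≡⟨ trans (trᵛ-⊞ ((λ₁ * a) ⊡ X) _) (cong (trᵛ ((λ₁ * a) ⊡ X) ⊞_) (trans (trᵛ-⊞ ((λ₁ * b) ⊡ frob X) _)
                 (cong (λ w → trᵛ ((λ₁ * b) ⊡ frob X) ⊞ trᵛ w) (⊞-identityʳ ((λ₁ * c) ⊡ frob (frob X)))))) ⟩
          trᵛ ((λ₁ * a) ⊡ X) ⊞ (trᵛ ((λ₁ * b) ⊡ frob X) ⊞ trᵛ ((λ₁ * c) ⊡ frob (frob X)))
            ≡⟨ proj₂ collapsed ⟩
          trᵛ (k ⊡ X) ≡⟨ cong trᵛ (mix-⊡ k x y) ⟩
          trᵛ (mix (k * x) (k * y)) ≡⟨ J-0 (k * x) (k * y) ⟨
          J (k * x , k * y , 𝔽.0#) ∎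

      third : ∀ v → head (tail (tail (Θ v))) ≡ embed (dot F h v)
      third v = sym (trans (Extend.map-∙ h v) (trans (cong (ext h ∙_) (ext-J v)) (h-J _ _ _)))

      plane⇐ : ∀ x y v → Θ v ∝ (x ∷ y ∷ 0# ∷ []) → OnPlane (mix x y) v
      plane⇐ x y v (k , Θv≡) = hv≡0 , (k ∷ φ k ∷ φ (φ k) ∷ []) , sym (begin
        ext v ≡⟨ ext-J v ⟩
        J (Ψ⁻¹ v) ≡⟨ cong J (cong₂ _,_ (cong head Θv≡) (cong₂ _,_ (cong (head ∘ tail) Θv≡) z≡0)) ⟩
        J (k * x , k * y , 𝔽.0#) ≡⟨ J-0 (k * x) (k * y) ⟩
        trᵛ (mix (k * x) (k * y)) ≡⟨ cong trᵛ (mix-⊡ k x y) ⟨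
        trᵛ (k ⊡ X) ≡⟨ trᵛ-⊡ k X ⟩
        k ⊡ X ⊞ (φ k ⊡ frob X ⊞ φ (φ k) ⊡ frob (frob X))
          ≡⟨ cong (λ w → k ⊡ X ⊞ (φ k ⊡ frob X ⊞ w)) (⊞-identityʳ (φ (φ k) ⊡ frob (frob X))) ⟨
        comb (X ∷ frob X ∷ frob (frob X) ∷ []) (k ∷ φ k ∷ φ (φ k) ∷ []) ∎)
        where
        X = mix x y
        embed-zero : ∀ {a} → embed a ≡ 0# → a ≡ 𝔽.0#
        embed-zero e = embed-injective (trans e (sym 0#-homo))
        z≡0 : proj₂ (proj₂ (Ψ⁻¹ v)) ≡ 𝔽.0#
        z≡0 = embed-zero (trans (cong (head ∘ tail ∘ tail) Θv≡) (zeroʳ k))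
        hv≡0 : dot F h v ≡ 𝔽.0#
        hv≡0 = embed-zero (trans (sym (third v)) (trans (cong (head ∘ tail ∘ tail) Θv≡) (zeroʳ k)))

      coordinates : Coordinates
      coordinates = record
        { Θ = Θ
        ; Θ-⊞ = λ u v → trans (Θ≡ (u ⊞ᶠ v) _ (trans (Extend.map-⊞ u v) (trans (cong₂ _⊞_ (ext-J u) (ext-J v)) (J-+ _ _ _ _ _ _))))
                               (cong₂ _∷_ refl (cong₂ _∷_ refl (cong₂ _∷_ (+-homo _ _) refl)))
        ; Θ-⊡ = λ c v → trans (Θ≡ (c ⊡ᶠ v) _ (trans (Extend.map-⊡ c v) (trans (cong (embed c ⊡_) (ext-J v)) (J-* c _ _ _))))
                               (cong₂ _∷_ refl (cong₂ _∷_ refl (cong₂ _∷_ (*-homo _ _) refl)))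
        ; Θ-injective = λ {u} {v} e → trans (sym (Ψ-Ψ⁻¹ u)) (trans (cong Ψ (cong₂ _,_ (cong head e)
            (cong₂ _,_ (cong (head ∘ tail) e) (embed-injective (cong (head ∘ tail ∘ tail) e))))) (Ψ-Ψ⁻¹ v))
        ; Θ-third = third
        ; Θ-onto = λ x y z → Ψ (x , y , z) , Θ-Ψ (x , y , z)
        ; Θ-plane = λ x y v → subst (λ X → OnPlane X v ⇔ Θ v ∝ (x ∷ y ∷ 0# ∷ [])) (sym (mix≡comb x y))
                                    (mk⇔ (plane⇒ x y v) (plane⇐ x y v))
        }

    coordinates : Coordinates
    coordinates = Construction.coordinates e (trans (VF.∙-comm h e) (proj₂ e-dual)) g₁ g₂ (eta (Flat.basis g))
      where
      e-dual = VF.dual (nonzero Σ∞)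
      e = proj₁ e-dual
      eta : (b : Vec (V 7) 2) → b ≡ head b ∷ head (tail b) ∷ []
      eta (_ ∷ _ ∷ []) = refl

-- Contraction by conjugate forms

-- Polynomials act on coefficient functionals by contraction:
-- (l ⋆ v)ᵢ = Σⱼ lⱼ vᵢ₊ⱼ is the functional f ↦ v (l f).
module Contraction {n : ℕ} (K : FiniteField n) where
  open FieldTheory K
  open VectorTheory K
  open ≡-Reasoning

  infixr 7 _⋆₁_ _⋆₂_

  _⋆₁_ : ∀ {n} → V 2 → V (1 ℕ.+ n) → V n
  _⋆₁_ {zero} l v = []
  _⋆₁_ {suc n} l (x ∷ y ∷ v) = l ∙ (x ∷ y ∷ []) ∷ l ⋆₁ (y ∷ v)

  _⋆₂_ : ∀ {n} → V 3 → V (2 ℕ.+ n) → V n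
  _⋆₂_ {zero} l v = []
  _⋆₂_ {suc n} l (x ∷ y ∷ z ∷ v) = l ∙ (x ∷ y ∷ z ∷ []) ∷ l ⋆₂ (y ∷ z ∷ v)

  ⋆₁-linear : ∀ {n} l → IsLinear (_⋆₁_ {n} l)
  ⋆₁-linear l = record { ⊞-homo = additive ; ⊡-homo = homogeneous }
    where
    additive : ∀ {n} (u v : V (1 ℕ.+ n)) → l ⋆₁ (u ⊞ v) ≡ l ⋆₁ u ⊞ l ⋆₁ v
    additive {zero} u v = refl
    additive {suc n} (x ∷ y ∷ u) (r ∷ s ∷ v) = cong₂ _∷_ (∙-⊞ l (x ∷ y ∷ []) (r ∷ s ∷ [])) (additive (y ∷ u) (s ∷ v))
    homogeneous : ∀ {n} c (v : V (1 ℕ.+ n)) → l ⋆₁ (c ⊡ v) ≡ c ⊡ l ⋆₁ v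
    homogeneous {zero} c v = refl
    homogeneous {suc n} c (x ∷ y ∷ v) = cong₂ _∷_ (∙-⊡ l c (x ∷ y ∷ [])) (homogeneous c (y ∷ v))

  ⋆₂-linear : ∀ {n} l → IsLinear (_⋆₂_ {n} l)
  ⋆₂-linear l = record { ⊞-homo = additive ; ⊡-homo = homogeneous }
    where
    additive : ∀ {n} (u v : V (2 ℕ.+ n)) → l ⋆₂ (u ⊞ v) ≡ l ⋆₂ u ⊞ l ⋆₂ v
    additive {zero} u v = refl
    additive {suc n} (x ∷ y ∷ z ∷ u) (r ∷ s ∷ t ∷ v) = cong₂ _∷_ (∙-⊞ l (x ∷ y ∷ z ∷ []) (r ∷ s ∷ t ∷ [])) (additive (y ∷ z ∷ u) (s ∷ t ∷ v))
    homogeneous : ∀ {n} c (v : V (2 ℕ.+ n)) → l ⋆₂ (c ⊡ v) ≡ c ⊡ l ⋆₂ v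
    homogeneous {zero} c v = refl
    homogeneous {suc n} c (x ∷ y ∷ z ∷ v) = cong₂ _∷_ (∙-⊡ l c (x ∷ y ∷ z ∷ [])) (homogeneous c (y ∷ z ∷ v))

  -- Successive contractions amount to contraction by the product of the polynomials.
  ⋆₁-comm : ∀ {n} l m (v : V (2 ℕ.+ n)) → l ⋆₁ m ⋆₁ v ≡ m ⋆₁ l ⋆₁ v
  ⋆₁-comm {zero} l m v = refl
  ⋆₁-comm {suc n} l@(a ∷ b ∷ []) m@(r ∷ s ∷ []) (x ∷ y ∷ z ∷ v) = cong₂ _∷_
    (solve 7 (λ a b r s x y z →
      a ⊗ (r ⊗ x ⊕ (s ⊗ y ⊕ 𝟘)) ⊕ (b ⊗ (r ⊗ y ⊕ (s ⊗ z ⊕ 𝟘)) ⊕ 𝟘) ⊜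
      r ⊗ (a ⊗ x ⊕ (b ⊗ y ⊕ 𝟘)) ⊕ (s ⊗ (a ⊗ y ⊕ (b ⊗ z ⊕ 𝟘)) ⊕ 𝟘)) refl a b r s x y z)
    (⋆₁-comm l m (y ∷ z ∷ v))

  ⋆₂-comm : ∀ {n} l m (v : V (4 ℕ.+ n)) → l ⋆₂ m ⋆₂ v ≡ m ⋆₂ l ⋆₂ v
  ⋆₂-comm {zero} l m v = refl
  ⋆₂-comm {suc n} l@(a ∷ b ∷ c ∷ []) m@(r ∷ s ∷ t ∷ []) (x ∷ y ∷ z ∷ u ∷ w ∷ v) = cong₂ _∷_
    (solve 11 (λ a b c r s t x y z u w →
      a ⊗ (r ⊗ x ⊕ (s ⊗ y ⊕ (t ⊗ z ⊕ 𝟘))) ⊕ (b ⊗ (r ⊗ y ⊕ (s ⊗ z ⊕ (t ⊗ u ⊕ 𝟘))) ⊕ (c ⊗ (r ⊗ z ⊕ (s ⊗ u ⊕ (t ⊗ w ⊕ 𝟘))) ⊕ 𝟘)) ⊜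
      r ⊗ (a ⊗ x ⊕ (b ⊗ y ⊕ (c ⊗ z ⊕ 𝟘))) ⊕ (s ⊗ (a ⊗ y ⊕ (b ⊗ z ⊕ (c ⊗ u ⊕ 𝟘))) ⊕ (t ⊗ (a ⊗ z ⊕ (b ⊗ u ⊕ (c ⊗ w ⊕ 𝟘))) ⊕ 𝟘)))
      refl a b c r s t x y z u w)
    (⋆₂-comm l m (y ∷ z ∷ u ∷ w ∷ v))

  powers : ∀ n → Carrier → V n
  powers n θ = tabulate (λ i → θ ^ᶠ toℕ i)

  at-∞ : ∀ n → V (suc n)
  at-∞ n = replicate n 0# ∷ʳ 1#

  private
    -- The vector c, c θ, c θ², ...; unlike `powers`, it has a tail of the same kind, as the
    -- inductions require.
    geometric : ∀ n → Carrier → Carrier → V n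
    geometric zero c θ = []
    geometric (suc n) c θ = c ∷ geometric n (c * θ) θ

    tabulate-geometric : ∀ n c θ → tabulate {n = n} (λ i → c * θ ^ᶠ toℕ i) ≡ geometric n c θ
    tabulate-geometric zero c θ = refl
    tabulate-geometric (suc n) c θ = cong₂ _∷_ (*-identityʳ c)
      (trans (Vec.tabulate-cong (λ i → sym (*-assoc c θ (θ ^ᶠ toℕ i)))) (tabulate-geometric n (c * θ) θ))

    powers-geometric : ∀ n θ → powers n θ ≡ geometric n 1# θ
    powers-geometric n θ = trans (Vec.tabulate-cong (λ i → sym (*-identityˡ (θ ^ᶠ toℕ i)))) (tabulate-geometric n 1# θ)

    ⋆₁-geometric : ∀ n l c θ → l ⋆₁ geometric (1 ℕ.+ n) c θ ≡ (l ∙ powers 2 θ) ⊡ geometric n c θ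
    ⋆₁-geometric zero l c θ = refl
    ⋆₁-geometric (suc n) l@(a ∷ b ∷ []) c θ = cong₂ _∷_
      (solve 4 (λ a b c θ → a ⊗ c ⊕ (b ⊗ (c ⊗ θ) ⊕ 𝟘) ⊜ (a ⊗ 𝟙 ⊕ (b ⊗ (θ ⊗ 𝟙) ⊕ 𝟘)) ⊗ c) refl a b c θ)
      (⋆₁-geometric n l (c * θ) θ)

    ⋆₂-geometric : ∀ n l c θ → l ⋆₂ geometric (2 ℕ.+ n) c θ ≡ (l ∙ powers 3 θ) ⊡ geometric n c θ
    ⋆₂-geometric zero l c θ = refl
    ⋆₂-geometric (suc n) l@(a ∷ b ∷ d ∷ []) c θ = cong₂ _∷_
      (solve 5 (λ a b d c θ → a ⊗ c ⊕ (b ⊗ (c ⊗ θ) ⊕ (d ⊗ (c ⊗ θ ⊗ θ) ⊕ 𝟘)) ⊜ (a ⊗ 𝟙 ⊕ (b ⊗ (θ ⊗ 𝟙) ⊕ (d ⊗ (θ ⊗ (θ ⊗ 𝟙)) ⊕ 𝟘))) ⊗ c) refl a b d c θ)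
      (⋆₂-geometric n l (c * θ) θ)

  -- `powers` is the functional f ↦ f(θ), and contraction by l turns it into f ↦ l(θ) f(θ).
  ⋆₁-powers : ∀ n l θ → l ⋆₁ powers (1 ℕ.+ n) θ ≡ (l ∙ powers 2 θ) ⊡ powers n θ
  ⋆₁-powers n l θ = trans (cong (l ⋆₁_) (powers-geometric (1 ℕ.+ n) θ))
    (trans (⋆₁-geometric n l 1# θ) (cong ((l ∙ powers 2 θ) ⊡_) (sym (powers-geometric n θ))))

  ⋆₂-powers : ∀ n l θ → l ⋆₂ powers (2 ℕ.+ n) θ ≡ (l ∙ powers 3 θ) ⊡ powers n θ
  ⋆₂-powers n l θ = trans (cong (l ⋆₂_) (powers-geometric (2 ℕ.+ n) θ))
    (trans (⋆₂-geometric n l 1# θ) (cong ((l ∙ powers 3 θ) ⊡_) (sym (powers-geometric n θ))))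

  -- `at-∞` is the functional that reads off the leading coefficient, and leading coefficients
  -- multiply.
  ⋆₁-∞ : ∀ n l → l ⋆₁ at-∞ (1 ℕ.+ n) ≡ (l ∙ at-∞ 1) ⊡ at-∞ n
  ⋆₁-∞ zero l = cong (_∷ []) (sym (*-identityʳ (l ∙ at-∞ 1)))
  ⋆₁-∞ (suc n) l = cong₂ _∷_ (trans (∙-𝟎 l) (sym (zeroʳ _))) (⋆₁-∞ n l)

  ⋆₂-∞ : ∀ n l → l ⋆₂ at-∞ (2 ℕ.+ n) ≡ (l ∙ at-∞ 2) ⊡ at-∞ n
  ⋆₂-∞ zero l = cong (_∷ []) (sym (*-identityʳ (l ∙ at-∞ 2)))
  ⋆₂-∞ (suc n) l = cong₂ _∷_ (trans (∙-𝟎 l) (sym (zeroʳ _))) (⋆₂-∞ n l)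

-- Vectors killed by two conjugate forms

module ConjugateWindows {q : ℕ} (primePower : PrimePower q) (2≤q : 2 ≤ q) (E : CubicExtension q) where
  open TraceTheory primePower 2≤q E
  open Contraction K
  open ≡-Reasoning

  frob-⋆₁ : ∀ {n} l (v : V (1 ℕ.+ n)) → frob (l ⋆₁ v) ≡ frob l ⋆₁ frob v
  frob-⋆₁ {zero} l v = refl
  frob-⋆₁ {suc n} l (x ∷ y ∷ v) = cong₂ _∷_ (Frobenius.map-∙ l (x ∷ y ∷ [])) (frob-⋆₁ l (y ∷ v))

  frob-⋆₂ : ∀ {n} l (v : V (2 ℕ.+ n)) → frob (l ⋆₂ v) ≡ frob l ⋆₂ frob v
  frob-⋆₂ {zero} l v = refl
  frob-⋆₂ {suc n} l (x ∷ y ∷ z ∷ v) = cong₂ _∷_ (Frobenius.map-∙ l (x ∷ y ∷ z ∷ [])) (frob-⋆₂ l (y ∷ z ∷ v))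

  frob-𝟎 : ∀ {n} {v : V n} → v ≡ 𝟎 → frob v ≡ 𝟎
  frob-𝟎 e = trans (cong frob e) Frobenius.map-𝟎

  frob-∙-ext : ∀ {n} (l : V n) y → frob l ∙ ext y ≡ φ (l ∙ ext y)
  frob-∙-ext l y = trans (cong (frob l ∙_) (sym (frob-ext y))) (sym (Frobenius.map-∙ l (ext y)))

  -- The cofactor L′(y) L″(y) of L(y) in its norm.
  conjugateProduct : ∀ {n} → V n → VF.V n → Carrier
  conjugateProduct l y = frob (frob l) ∙ ext y * frob l ∙ ext y

  conjugateProduct≢0 : ∀ {n} (l : V n) y → l ∙ ext y ≢ 0# → conjugateProduct l y ≢ 0#
  conjugateProduct≢0 l y ly≢0 e = *-nonzero (ly≢0 ∘ φ-zero ∘ φ-zero) (ly≢0 ∘ φ-zero)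
    (trans (cong₂ _*_ (sym (trans (frob-∙-ext (frob l) y) (cong φ (frob-∙-ext l y)))) (sym (frob-∙-ext l y))) e)

  FIndependent : Carrier → Carrier → Set
  FIndependent x y = ∀ a b → embed a * x + embed b * y ≡ 0# → a ≡ 𝔽.0# × b ≡ 𝔽.0#

  -- If the determinant vanished, x / y would be fixed by Frobenius and hence lie in F.
  conjugate-determinant : ∀ {x y} → FIndependent x y → x * φ y + - (y * φ x) ≢ 0#
  conjugate-determinant {x} {y} ind D≡0 = by-case (y ≟ 0#)
    where
    by-case : ¬ Dec (y ≡ 0#)
    by-case (yes y≡0) = 𝔽.1≢0 (proj₂ (ind 𝔽.0# 𝔽.1# (begin
      embed 𝔽.0# * x + embed 𝔽.1# * y ≡⟨ cong₂ (λ a b → a * x + embed 𝔽.1# * b) 0#-homo y≡0 ⟩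
      0# * x + embed 𝔽.1# * 0# ≡⟨ solve 2 (λ x e → 𝟘 ⊗ x ⊕ e ⊗ 𝟘 ⊜ 𝟘) refl x (embed 𝔽.1#) ⟩
      0# ∎)))
    by-case (no y≢0) with invertible y y≢0
    ... | u , uy≡1 with fixed⇒embedded {u * x} ratio-fixed
      where
      ratio-fixed : φ (u * x) ≡ u * x
      ratio-fixed = *-cancelˡ (*-nonzero y≢0 (y≢0 ∘ φ-zero)) (begin
        (y * φ y) * φ (u * x) ≡⟨ cong ((y * φ y) *_) (φ-* u x) ⟩
        (y * φ y) * (φ u * φ x) ≡⟨ solve 4 (λ y p u x → (y ⊗ p) ⊗ (u ⊗ x) ⊜ (u ⊗ p) ⊗ (y ⊗ x)) refl y (φ y) (φ u) (φ x) ⟩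
        (φ u * φ y) * (y * φ x) ≡⟨ cong₂ _*_ (trans (sym (φ-* u y)) (trans (cong φ uy≡1) φ-1)) (sym (difference-zero D≡0)) ⟩
        1# * (x * φ y) ≡⟨ cong (_* (x * φ y)) uy≡1 ⟨
        (u * y) * (x * φ y) ≡⟨ solve 4 (λ u y x p → (u ⊗ y) ⊗ (x ⊗ p) ⊜ (y ⊗ p) ⊗ (u ⊗ x)) refl u y x (φ y) ⟩
        (y * φ y) * (u * x) ∎)
    ... | a , a≡ = 𝔽.1≢0 (proj₁ (ind 𝔽.1# (𝔽.- a) (begin
      embed 𝔽.1# * x + embed (𝔽.- a) * y ≡⟨ cong₂ (λ s t → s * x + t * y) 1#-homo (trans (-‿homo a) (cong -_ a≡)) ⟩
      1# * x + - (u * x) * y ≡⟨ solve 3 (λ x u y → 𝟙 ⊗ x ⊕ ⊝ (u ⊗ x) ⊗ y ⊜ x ⊗ (𝟙 ⊕ ⊝ (u ⊗ y))) refl x u y ⟩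
      x * (1# + - (u * y)) ≡⟨ cong (λ w → x * (1# + - w)) uy≡1 ⟩
      x * (1# + - 1#) ≡⟨ solve 1 (λ x → x ⊗ (𝟙 ⊕ ⊝ 𝟙) ⊜ 𝟘) refl x ⟩
      0# ∎)))

  -- Cramer's rule with the determinant just shown to be nonzero.
  conjugate-equations : ∀ {x y u v} → FIndependent x y → x * u + y * v ≡ 0# → φ x * u + φ y * v ≡ 0# → u ≡ 0# × v ≡ 0#
  conjugate-equations {x} {y} {u} {v} ind e e′ =
      *-zero-divisor D≢0 (trans
        (solve 6 (λ x y p r u v → (x ⊗ r ⊕ ⊝ (y ⊗ p)) ⊗ u ⊜ r ⊗ (x ⊗ u ⊕ y ⊗ v) ⊕ ⊝ (y ⊗ (p ⊗ u ⊕ r ⊗ v))) refl x y (φ x) (φ y) u v)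
        (trans (cong₂ (λ s t → φ y * s + - (y * t)) e e′) (solve 2 (λ a b → a ⊗ 𝟘 ⊕ ⊝ (b ⊗ 𝟘) ⊜ 𝟘) refl (φ y) y)))
    , *-zero-divisor D≢0 (trans
        (solve 6 (λ x y p r u v → (x ⊗ r ⊕ ⊝ (y ⊗ p)) ⊗ v ⊜ x ⊗ (p ⊗ u ⊕ r ⊗ v) ⊕ ⊝ (p ⊗ (x ⊗ u ⊕ y ⊗ v))) refl x y (φ x) (φ y) u v)
        (trans (cong₂ (λ s t → x * t + - (φ x * s)) e e′) (solve 2 (λ a b → a ⊗ 𝟘 ⊕ ⊝ (b ⊗ 𝟘) ⊜ 𝟘) refl x (φ x))))
    where
    D≢0 = conjugate-determinant ind

  -- In the application l is the line at infinity in the coordinates of the conic, and p is its one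
  -- point over F.
  Tangency : V 3 → VF.V 3 → Set
  Tangency l p = ∀ x → l ∙ ext x ≡ 0# → ∃ λ c → x ≡ c VF.⊡ p

  private
    -- Cyclic permutation of the coordinates, used to bring a nonzero coordinate of p to the front.
    rotate : ∀ {A : Set} → Vec A 3 → Vec A 3
    rotate (a ∷ b ∷ c ∷ []) = b ∷ c ∷ a ∷ []

    rotate-∙ : ∀ l v → rotate l ∙ rotate v ≡ l ∙ v
    rotate-∙ (a ∷ b ∷ c ∷ []) (x ∷ y ∷ z ∷ []) =
      solve 6 (λ a b c x y z → b ⊗ y ⊕ (c ⊗ z ⊕ (a ⊗ x ⊕ 𝟘)) ⊜ a ⊗ x ⊕ (b ⊗ y ⊕ (c ⊗ z ⊕ 𝟘))) refl a b c x y z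

    rotate-frob : ∀ l → frob (rotate l) ≡ rotate (frob l)
    rotate-frob (_ ∷ _ ∷ _ ∷ []) = refl

    rotate-tangency : ∀ l p → Tangency l p → Tangency (rotate l) (rotate p)
    rotate-tangency l (p₀ ∷ p₁ ∷ p₂ ∷ []) tangent (y ∷ z ∷ x ∷ []) e =
      let c , e′ = tangent (x ∷ y ∷ z ∷ []) (trans (sym (rotate-∙ l (ext (x ∷ y ∷ z ∷ [])))) e)
      in c , cong rotate e′

    rotate-multiple : ∀ w p → rotate w ∝ ext (rotate p) → w ∝ ext p
    rotate-multiple (_ ∷ _ ∷ _ ∷ []) (_ ∷ _ ∷ _ ∷ []) (k , e) = k , cong (rotate ∘ rotate) e

    -- As p₀ ≠ 0, tangency makes l₁ and l₂ independent over F: a relation would be a zero of l with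
    -- first coordinate 0. Subtracting from w the multiple of p with the same first coordinate
    -- leaves an equation and its conjugate in two unknowns.
    window₀ : ∀ l p w → Tangency l p → l ∙ ext p ≡ 0# → head p ≢ 𝔽.0# → l ∙ w ≡ 0# → frob l ∙ w ≡ 0# → w ∝ ext p
    window₀ l@(l₀ ∷ l₁ ∷ l₂ ∷ []) p@(p₀ ∷ p₁ ∷ p₂ ∷ []) w@(w₀ ∷ w₁ ∷ w₂ ∷ []) tangent lp≡0 p₀≢0 lw≡0 l′w≡0 = solved (𝔽.invertible p₀ p₀≢0)
      where
      independent : FIndependent l₁ l₂
      independent a b e = vanish (tangent (𝔽.0# ∷ a ∷ b ∷ []) (trans
          (cong (λ z → l₀ * z + (l₁ * embed a + (l₂ * embed b + 0#))) 0#-homo)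
          (trans (solve 5 (λ r s t a b → r ⊗ 𝟘 ⊕ (s ⊗ a ⊕ (t ⊗ b ⊕ 𝟘)) ⊜ a ⊗ s ⊕ b ⊗ t) refl l₀ l₁ l₂ (embed a) (embed b)) e)))
        where
        vanish : (∃ λ c → 𝔽.0# ∷ a ∷ b ∷ [] ≡ c VF.⊡ p) → a ≡ 𝔽.0# × b ≡ 𝔽.0#
        vanish (c , e) = trans (cong (head ∘ tail) e) (trans (cong (𝔽._* p₁) c≡0) (𝔽.zeroˡ p₁))
                       , trans (cong (head ∘ tail ∘ tail) e) (trans (cong (𝔽._* p₂) c≡0) (𝔽.zeroˡ p₂))
          where
          c≡0 : c ≡ 𝔽.0#
          c≡0 = 𝔽.*-zero-divisor p₀≢0 (trans (𝔽.*-comm p₀ c) (sym (cong head e)))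
      solved : (∃ λ u → u 𝔽.* p₀ ≡ 𝔽.1#) → w ∝ ext p
      solved (u , up₀≡1) = k , cong₂ _∷_ w₀≡ (cong₂ _∷_ (difference-zero (proj₁ zeros)) (cong₂ _∷_ (difference-zero (proj₂ zeros)) refl))
        where
        k : Carrier
        k = w₀ * embed u
        w₀≡ : w₀ ≡ k * embed p₀
        w₀≡ = sym (trans (*-assoc w₀ (embed u) (embed p₀)) (trans (cong (w₀ *_) (trans (sym (*-homo u p₀)) (trans (cong embed up₀≡1) 1#-homo))) (*-identityʳ w₀)))
        reduced : ∀ (m : V 3) → m ∙ w ≡ 0# → m ∙ ext p ≡ 0# →
                  head (tail m) * (w₁ + - (k * embed p₁)) + head (tail (tail m)) * (w₂ + - (k * embed p₂)) ≡ 0#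
        reduced (m₀ ∷ m₁ ∷ m₂ ∷ []) mw≡0 mp≡0 = begin
          m₁ * (w₁ + - (k * embed p₁)) + m₂ * (w₂ + - (k * embed p₂))
            ≡⟨ solve 9 (λ a b c w x k p r s → b ⊗ (w ⊕ ⊝ (k ⊗ r)) ⊕ c ⊗ (x ⊕ ⊝ (k ⊗ s)) ⊜
                 (a ⊗ (k ⊗ p) ⊕ (b ⊗ w ⊕ (c ⊗ x ⊕ 𝟘))) ⊕ ⊝ (k ⊗ (a ⊗ p ⊕ (b ⊗ r ⊕ (c ⊗ s ⊕ 𝟘)))))
                 refl m₀ m₁ m₂ w₁ w₂ k (embed p₀) (embed p₁) (embed p₂) ⟩
          (m₀ * (k * embed p₀) + (m₁ * w₁ + (m₂ * w₂ + 0#))) + - (k * ((m₀ ∷ m₁ ∷ m₂ ∷ []) ∙ ext p))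
            ≡⟨ cong₂ (λ s t → (m₀ * s + (m₁ * w₁ + (m₂ * w₂ + 0#))) + - (k * t)) (sym w₀≡) mp≡0 ⟩
          (m₀ ∷ m₁ ∷ m₂ ∷ []) ∙ w + - (k * 0#)
            ≡⟨ trans (cong (_+ - (k * 0#)) mw≡0) (solve 1 (λ k → 𝟘 ⊕ ⊝ (k ⊗ 𝟘) ⊜ 𝟘) refl k) ⟩
          0# ∎
        l′p≡0 : frob l ∙ ext p ≡ 0#
        l′p≡0 = trans (frob-∙-ext l p) (trans (cong φ lp≡0) φ-0)
        zeros = conjugate-equations independent (reduced l lw≡0 lp≡0) (reduced (frob l) l′w≡0 l′p≡0)

  -- Geometrically, l and its conjugate are different lines of PG(2,K) through the point p over F,
  -- so p is all they share.
  window : ∀ l p w → p ≢ VF.𝟎 → Tangency l p → l ∙ ext p ≡ 0# → l ∙ w ≡ 0# → frob l ∙ w ≡ 0# → w ∝ ext p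
  window l p@(p₀ ∷ p₁ ∷ p₂ ∷ []) w p≢𝟎 tangent lp lw l′w = by-case (p₀ 𝔽.≟ 𝔽.0#) (p₁ 𝔽.≟ 𝔽.0#) (p₂ 𝔽.≟ 𝔽.0#)
    where
    r = rotate
    rot-ext : ∀ v → ext (rotate v) ≡ rotate (ext v)
    rot-ext (_ ∷ _ ∷ _ ∷ []) = refl
    step : ∀ l v → l ∙ v ≡ 0# → rotate l ∙ rotate v ≡ 0#
    step l v e = trans (rotate-∙ l v) e
    lp′ : rotate l ∙ ext (rotate p) ≡ 0#
    lp′ = trans (cong (rotate l ∙_) (rot-ext p)) (step l (ext p) lp)
    l′w′ : frob (rotate l) ∙ rotate w ≡ 0#
    l′w′ = trans (cong (_∙ rotate w) (rotate-frob l)) (step (frob l) w l′w)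
    by-case : Dec (p₀ ≡ 𝔽.0#) → Dec (p₁ ≡ 𝔽.0#) → Dec (p₂ ≡ 𝔽.0#) → w ∝ ext p
    by-case (no p₀≢0) _ _ = window₀ l p w tangent lp p₀≢0 lw l′w
    by-case (yes _) (no p₁≢0) _ = rotate-multiple w p
      (window₀ (r l) (r p) (r w) (rotate-tangency l p tangent) lp′ p₁≢0 (step l w lw) l′w′)
    by-case (yes _) (yes _) (no p₂≢0) = rotate-multiple w p (rotate-multiple (r w) (r p)
      (window₀ (r (r l)) (r (r p)) (r (r w)) (rotate-tangency (r l) (r p) (rotate-tangency l p tangent))
        (trans (cong (r (r l) ∙_) (rot-ext (r p))) (step (r l) (ext (r p)) lp′)) p₂≢0
        (step (r l) (r w) (step l w lw)) (trans (cong (_∙ r (r w)) (rotate-frob (r l))) (step (frob (r l)) (r w) l′w′))))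
    by-case (yes a) (yes b) (yes c) = contradiction (cong₂ _∷_ a (cong₂ _∷_ b (cong₂ _∷_ c refl))) p≢𝟎

  -- Consecutive windows of v are multiples of p, which is off the conic, so
  -- the ratio vᵢ₊₁ : vᵢ would be both p₁ : p₀ and p₂ : p₁.
  ⋆₂-injective : ∀ n l p → p ≢ VF.𝟎 → Tangency l p → l ∙ ext p ≡ 0# →
    head (tail p) 𝔽.* head (tail p) ≢ head p 𝔽.* head (tail (tail p)) →
    ∀ (v : V (4 ℕ.+ n)) → l ⋆₂ v ≡ 𝟎 → frob l ⋆₂ v ≡ 𝟎 → v ≡ 𝟎
  ⋆₂-injective n l p@(p₀ ∷ p₁ ∷ p₂ ∷ []) p≢𝟎 tangent lp off = go n
    where
    D≢0 : embed p₁ * embed p₁ + - (embed p₀ * embed p₂) ≢ 0#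
    D≢0 e = off (embed-injective (trans (*-homo p₁ p₁) (trans (difference-zero e) (sym (*-homo p₀ p₂)))))

    first-two : ∀ {x y z t} → x ∷ y ∷ z ∷ [] ∝ ext p → y ∷ z ∷ t ∷ [] ∝ ext p →
                x ≡ 0# × y ∷ z ∷ t ∷ [] ≡ 𝟎
    first-two {x} {y} {z} {t} (k , e) (k′ , e′) =
        trans (cong head e) (trans (cong (_* embed p₀) k≡0) (zeroˡ (embed p₀)))
      , trans e′ (trans (cong (_⊡ ext p) k′≡0) (⊡-zeroˡ (ext p)))
      where
      P₀ = embed p₀
      P₁ = embed p₁
      P₂ = embed p₂
      s₁ : k * P₁ ≡ k′ * P₀
      s₁ = trans (sym (cong (head ∘ tail) e)) (cong head e′)
      s₂ : k * P₂ ≡ k′ * P₁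
      s₂ = trans (sym (cong (head ∘ tail ∘ tail) e)) (cong (head ∘ tail) e′)
      k≡0 : k ≡ 0#
      k≡0 = *-zero-divisor D≢0 (begin
        (P₁ * P₁ + - (P₀ * P₂)) * k ≡⟨ solve 4 (λ a b c k → (b ⊗ b ⊕ ⊝ (a ⊗ c)) ⊗ k ⊜ (k ⊗ b) ⊗ b ⊕ ⊝ ((k ⊗ c) ⊗ a)) refl P₀ P₁ P₂ k ⟩
        (k * P₁) * P₁ + - ((k * P₂) * P₀) ≡⟨ cong₂ (λ s t → s * P₁ + - (t * P₀)) s₁ s₂ ⟩
        (k′ * P₀) * P₁ + - ((k′ * P₁) * P₀) ≡⟨ solve 3 (λ a b k → (k ⊗ a) ⊗ b ⊕ ⊝ ((k ⊗ b) ⊗ a) ⊜ 𝟘) refl P₀ P₁ k′ ⟩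
        0# ∎)
      k′≡0 : k′ ≡ 0#
      k′≡0 = *-zero-divisor D≢0 (begin
        (P₁ * P₁ + - (P₀ * P₂)) * k′ ≡⟨ solve 4 (λ a b c k → (b ⊗ b ⊕ ⊝ (a ⊗ c)) ⊗ k ⊜ (k ⊗ b) ⊗ b ⊕ ⊝ ((k ⊗ a) ⊗ c)) refl P₀ P₁ P₂ k′ ⟩
        (k′ * P₁) * P₁ + - ((k′ * P₀) * P₂) ≡⟨ cong₂ (λ s t → s * P₁ + - (t * P₂)) s₂ s₁ ⟨
        (k * P₂) * P₁ + - ((k * P₁) * P₂) ≡⟨ solve 3 (λ b c k → (k ⊗ c) ⊗ b ⊕ ⊝ ((k ⊗ b) ⊗ c) ⊜ 𝟘) refl P₁ P₂ k ⟩
        0# ∎)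

    multiple : ∀ w → l ∙ w ≡ 0# → frob l ∙ w ≡ 0# → w ∝ ext p
    multiple w = window l p w p≢𝟎 tangent lp

    go : ∀ n (v : V (4 ℕ.+ n)) → l ⋆₂ v ≡ 𝟎 → frob l ⋆₂ v ≡ 𝟎 → v ≡ 𝟎
    go zero (x ∷ y ∷ z ∷ t ∷ []) e e′ =
      let x≡0 , rest = first-two (multiple (x ∷ y ∷ z ∷ []) (cong head e) (cong head e′))
                                 (multiple (y ∷ z ∷ t ∷ []) (cong (head ∘ tail) e) (cong (head ∘ tail) e′))
      in cong₂ _∷_ x≡0 rest
    go (suc n) (x ∷ v@(y ∷ z ∷ t ∷ _)) e e′ = cong₂ _∷_
      (proj₁ (first-two (multiple (x ∷ y ∷ z ∷ []) (cong head e) (cong head e′))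
                        (multiple (y ∷ z ∷ t ∷ []) (cong (head ∘ tail) e) (cong (head ∘ tail) e′))))
      (go n v (cong tail e) (cong tail e′))

  -- Any two consecutive entries of v satisfy an equation and its conjugate, so both vanish.
  ⋆₁-injective : ∀ n m₀ m₁ → FIndependent m₀ m₁ → ∀ (v : V (2 ℕ.+ n)) →
    (m₀ ∷ m₁ ∷ []) ⋆₁ v ≡ 𝟎 → frob (m₀ ∷ m₁ ∷ []) ⋆₁ v ≡ 𝟎 → v ≡ 𝟎
  ⋆₁-injective n m₀ m₁ ind = go n
    where
    two : ∀ x y → (m₀ ∷ m₁ ∷ []) ∙ (x ∷ y ∷ []) ≡ 0# → frob (m₀ ∷ m₁ ∷ []) ∙ (x ∷ y ∷ []) ≡ 0# → x ≡ 0# × y ≡ 0#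
    two x y e e′ = conjugate-equations ind (trans (sym (cong (m₀ * x +_) (+-identityʳ (m₁ * y)))) e)
                                           (trans (sym (cong (φ m₀ * x +_) (+-identityʳ (φ m₁ * y)))) e′)
    go : ∀ n (v : V (2 ℕ.+ n)) → (m₀ ∷ m₁ ∷ []) ⋆₁ v ≡ 𝟎 → frob (m₀ ∷ m₁ ∷ []) ⋆₁ v ≡ 𝟎 → v ≡ 𝟎
    go zero (x ∷ y ∷ []) e e′ = let x≡0 , y≡0 = two x y (cong head e) (cong head e′) in cong₂ _∷_ x≡0 (cong₂ _∷_ y≡0 refl)
    go (suc n) (x ∷ v@(y ∷ _)) e e′ = cong₂ _∷_ (proj₁ (two x y (cong head e) (cong head e′))) (go n v (cong tail e) (cong tail e′))

-- Points and lines of the Bruck-Bose plane in PG(2,K)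

module BruckBosePlane {q : ℕ} (primePower : PrimePower q) (2≤q : 2 ≤ q) (E : CubicExtension q)
  (Σ∞ : Point (CubicExtension.F E) 6) (𝓢 : RegularSpread E Σ∞)
  (C : TraceTheory.Coordinates primePower 2≤q E Σ∞ 𝓢) where
  open TraceTheory primePower 2≤q E
  open RegularSpread 𝓢
  open Coordinates C
  open Cross K
  open ≡-Reasoning
  open VF using () renaming (_⊞_ to _⊞ᶠ_; _⊡_ to _⊡ᶠ_)

  h : VF.V 7
  h = coords Σ∞

  third : V 3 → Carrier
  third v = head (tail (tail v))

  third-⊞ : ∀ u v → third (u ⊞ v) ≡ third u + third v
  third-⊞ (_ ∷ _ ∷ _ ∷ []) (_ ∷ _ ∷ _ ∷ []) = refl

  third-⊡ : ∀ c v → third (c ⊡ v) ≡ c * third v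
  third-⊡ c (_ ∷ _ ∷ _ ∷ []) = refl

  embed-nonzero : ∀ {a} → a ≢ 𝔽.0# → embed a ≢ 0#
  embed-nonzero a≢0 e = a≢0 (embed-injective (trans e (sym 0#-homo)))

  Θ-zero : Θ VF.𝟎 ≡ 𝟎
  Θ-zero = trans (cong Θ (sym (VF.⊡-zeroˡ VF.𝟎))) (trans (Θ-⊡ 𝔽.0# VF.𝟎) (trans (cong (_⊡ Θ VF.𝟎) 0#-homo) (⊡-zeroˡ (Θ VF.𝟎))))

  Θ-nonzero : ∀ {v} → v ≢ VF.𝟎 → Θ v ≢ 𝟎
  Θ-nonzero v≢𝟎 e = v≢𝟎 (Θ-injective (trans e (sym Θ-zero)))

  -- Off Σ∞ a K-multiple is an F-multiple: compare third coordinates.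
  affine-multiple : ∀ u v k → dot F h v ≢ 𝔽.0# → Θ u ≡ k ⊡ Θ v → ∃ λ c → u ≡ c ⊡ᶠ v × k ≡ embed c
  affine-multiple u v k hv≢0 e with 𝔽.invertible (dot F h v) hv≢0
  ... | d , d·hv≡1 = c , Θ-injective (trans e (trans (cong (_⊡ Θ v) k≡) (sym (Θ-⊡ c v)))) , k≡
    where
    c : 𝔽.Carrier
    c = d 𝔽.* dot F h u
    thirds : embed (dot F h u) ≡ k * embed (dot F h v)
    thirds = trans (sym (Θ-third u)) (trans (cong third e) (trans (third-⊡ k (Θ v)) (cong (k *_) (Θ-third v))))
    k≡ : k ≡ embed c
    k≡ = sym (begin
      embed (d 𝔽.* dot F h u) ≡⟨ *-homo d (dot F h u) ⟩
      embed d * embed (dot F h u) ≡⟨ cong (embed d *_) thirds ⟩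
      embed d * (k * embed (dot F h v)) ≡⟨ solve 3 (λ d k v → d ⊗ (k ⊗ v) ⊜ k ⊗ (d ⊗ v)) refl (embed d) k (embed (dot F h v)) ⟩
      k * (embed d * embed (dot F h v)) ≡⟨ cong (k *_) (trans (sym (*-homo d (dot F h v))) (trans (cong embed d·hv≡1) 1#-homo)) ⟩
      k * 1# ≡⟨ *-identityʳ k ⟩
      k ∎)

  at-infinity : Carrier → Carrier → V 3
  at-infinity α β = α ∷ β ∷ 0# ∷ []

  g-nonzero : ∀ α β {X} → comb (Flat.basis g) (α ∷ β ∷ []) ≡ X → X ≢ 𝟎 → at-infinity α β ≢ 𝟎
  g-nonzero α β span X≢𝟎 e = X≢𝟎 (trans (sym span) (trans (cong (comb (Flat.basis g)) (cong₂ _∷_ (cong head e) (cong₂ _∷_ (cong (head ∘ tail) e) refl)))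
    (IsLinear.𝟎-homo (comb-linear (Flat.basis g)))))

  -- The point of PG(2,K) that a Bruck-Bose point stands for. By `pointsOf⇔` affine points and
  -- spread planes can be treated alike from here on.
  Φ : BBPoint E Σ∞ 𝓢 → Point K 2
  Φ (affine P _) = point (Θ (coords P)) (Θ-nonzero (nonzero P))
  Φ (plane X (α ∷ β ∷ [] , s)) = point (at-infinity α β) (g-nonzero α β s (nonzero X))

  spreadPlane⇔ : ∀ X α β → comb (Flat.basis g) (α ∷ β ∷ []) ≡ coords X →
                 ∀ Q → spreadPlane X Q ⇔ Θ (coords Q) ∝ at-infinity α β
  spreadPlane⇔ X α β span Q = subst (λ X → OnPlane Σ∞ 𝓢 X (coords Q) ⇔ Θ (coords Q) ∝ at-infinity α β) span
    (Θ-plane α β (coords Q))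

  pointsOf⇔ : ∀ B Q → pointsOf E Σ∞ 𝓢 B Q ⇔ Θ (coords Q) ∝ coords (Φ B)
  pointsOf⇔ (plane X (α ∷ β ∷ [] , s)) Q = spreadPlane⇔ X α β s Q
  pointsOf⇔ (affine P P∉) Q = mk⇔
    (λ (c , _ , e) → embed c , trans (cong Θ e) (Θ-⊡ c (coords P)))
    (λ (k , e) → let c , Q≡ , _ = affine-multiple (coords Q) (coords P) k P∉ e in
      c , (λ c≡0 → nonzero Q (trans Q≡ (trans (cong (_⊡ᶠ coords P) c≡0) (VF.⊡-zeroˡ (coords P))))) , Q≡)

  -- Solids will be kernels of forms linear over K, so one vector over F decides for a whole spread
  -- plane.
  representative : ∀ B → ∃ λ v → Θ v ≡ coords (Φ B)
  representative (affine P _) = coords P , refl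
  representative (plane X (α ∷ β ∷ [] , s)) =
    let v , e = Θ-onto α β 𝔽.0# in v , trans e (cong₂ _∷_ refl (cong₂ _∷_ refl (cong₂ _∷_ 0#-homo refl)))

  ⨯-at-infinity : ∀ α β s t → (α ∷ β ∷ 0# ∷ []) ⨯ (s ∷ t ∷ 0# ∷ []) ≡ 𝟎 → at-infinity α β ≢ 𝟎 → at-infinity s t ∝ at-infinity α β
  ⨯-at-infinity α β s t e a≢𝟎 = by-case (α ≟ 0#) (β ≟ 0#)
    where
    αt≡βs : α * t ≡ β * s
    αt≡βs = difference-zero (cong third e)
    0≡k0 : ∀ k → 0# ≡ k * 0#
    0≡k0 k = sym (zeroʳ k)
    by-case : Dec (α ≡ 0#) → Dec (β ≡ 0#) → at-infinity s t ∝ at-infinity α β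
    by-case (no α≢0) _ with invertible α α≢0
    ... | d , dα≡1 = s * d , cong₂ _∷_
        (sym (trans (*-assoc s d α) (trans (cong (s *_) dα≡1) (*-identityʳ s))))
        (cong₂ _∷_ (begin
          t ≡⟨ *-identityˡ t ⟨
          1# * t ≡⟨ cong (_* t) dα≡1 ⟨
          d * α * t ≡⟨ *-assoc d α t ⟩
          d * (α * t) ≡⟨ cong (d *_) αt≡βs ⟩
          d * (β * s) ≡⟨ solve 3 (λ d b s → d ⊗ (b ⊗ s) ⊜ s ⊗ d ⊗ b) refl d β s ⟩
          s * d * β ∎) (cong₂ _∷_ (0≡k0 (s * d)) refl))
    by-case (yes α≡0) (no β≢0) with invertible β β≢0
    ... | d , dβ≡1 = t * d , cong₂ _∷_ (begin
          s ≡⟨ *-identityˡ s ⟨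
          1# * s ≡⟨ cong (_* s) dβ≡1 ⟨
          d * β * s ≡⟨ *-assoc d β s ⟩
          d * (β * s) ≡⟨ cong (d *_) αt≡βs ⟨
          d * (α * t) ≡⟨ solve 3 (λ d b s → d ⊗ (b ⊗ s) ⊜ s ⊗ d ⊗ b) refl d α t ⟩
          t * d * α ∎)
        (cong₂ _∷_ (sym (trans (*-assoc t d β) (trans (cong (t *_) dβ≡1) (*-identityʳ t)))) (cong₂ _∷_ (0≡k0 (t * d)) refl))
    by-case (yes α≡0) (yes β≡0) = contradiction (cong₂ _∷_ α≡0 (cong₂ _∷_ β≡0 refl)) a≢𝟎

  -- A solid W through the spread plane of a and the affine vector Q is the
  -- preimage of the line of PG(2,K) with dual coordinates a × Θ Q.
  module Solid (W : Flat F 6 3) (α β : Carrier) (a≢𝟎 : at-infinity α β ≢ 𝟎)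
    (plane⊆W : ∀ v k → Θ v ≡ k ⊡ at-infinity α β → Span F (Flat.basis W) v)
    (cs : VF.V 4) (Q : VF.V 7) (Q≡ : combination F cs (Flat.basis W) ≡ Q) (hQ≢0 : dot F h Q ≢ 𝔽.0#) where

    a d μ : V 3
    a = at-infinity α β
    d = Θ Q
    μ = a ⨯ d

    d₃≢0 : third d ≢ 0#
    d₃≢0 e = embed-nonzero hQ≢0 (trans (sym (Θ-third Q)) e)

    μ-nonzero : μ ≢ 𝟎
    μ-nonzero e = a≢𝟎 (cong₂ _∷_ (α≡0 d d₃≢0 e) (cong₂ _∷_ (β≡0 d d₃≢0 e) refl))
      where
      β≡0 : ∀ d → third d ≢ 0# → a ⨯ d ≡ 𝟎 → β ≡ 0#
      β≡0 (x ∷ y ∷ z ∷ []) z≢0 e = *-zero-divisor z≢0 (trans (solve 3 (λ z b y → z ⊗ b ⊜ b ⊗ z ⊕ ⊝ (𝟘 ⊗ y)) refl z β y) (cong head e))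
      α≡0 : ∀ d → third d ≢ 0# → a ⨯ d ≡ 𝟎 → α ≡ 0#
      α≡0 (x ∷ y ∷ z ∷ []) z≢0 e = *-zero-divisor z≢0 (trans (solve 3 (λ z a x → z ⊗ a ⊜ ⊝ (𝟘 ⊗ x ⊕ ⊝ (a ⊗ z))) refl z α x)
        (trans (cong -_ (cong (head ∘ tail) e)) (solve 0 (⊝ 𝟘 ⊜ 𝟘) refl)))

    -- The line joining a to the affine point d meets the line at infinity in a only.
    reduce : ∀ d r → third r ≡ 0# → third d ≢ 0# → (a ⨯ d) ∙ r ≡ 0# → r ∝ a
    reduce (x ∷ y ∷ z ∷ []) (s ∷ t ∷ _ ∷ []) refl z≢0 e = ⨯-at-infinity α β s t
      (cong₂ _∷_ (solve 2 (λ b t → b ⊗ 𝟘 ⊕ ⊝ (𝟘 ⊗ t) ⊜ 𝟘) refl β t) (cong₂ _∷_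
        (solve 2 (λ b t → 𝟘 ⊗ t ⊕ ⊝ (b ⊗ 𝟘) ⊜ 𝟘) refl α s) (cong₂ _∷_
        (*-zero-divisor z≢0 (trans (solve 7 (λ a b x y z s t → z ⊗ (a ⊗ t ⊕ ⊝ (b ⊗ s)) ⊜
            ⊝ ((b ⊗ z ⊕ ⊝ (𝟘 ⊗ y)) ⊗ s ⊕ ((𝟘 ⊗ x ⊕ ⊝ (a ⊗ z)) ⊗ t ⊕ ((a ⊗ y ⊕ ⊝ (b ⊗ x)) ⊗ 𝟘 ⊕ 𝟘)))) refl α β x y z s t)
          (trans (cong -_ e) (solve 0 (⊝ 𝟘 ⊜ 𝟘) refl)))) refl))) a≢𝟎

    in-span : ∀ v k c → Θ (v ⊞ᶠ (𝔽.- 𝔽.1#) ⊡ᶠ (c ⊡ᶠ Q)) ≡ k ⊡ a → Span F (Flat.basis W) v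
    in-span v k c e = combine (plane⊆W _ k e)
      where
      v₀ = v ⊞ᶠ (𝔽.- 𝔽.1#) ⊡ᶠ (c ⊡ᶠ Q)
      lin = VF.comb-linear (Flat.basis W)
      combine : Span F (Flat.basis W) v₀ → Span F (Flat.basis W) v
      combine (ds , e) = ds ⊞ᶠ c ⊡ᶠ cs , trans (VF.IsLinear.⊞-homo lin ds (c ⊡ᶠ cs))
        (trans (cong₂ _⊞ᶠ_ e (trans (VF.IsLinear.⊡-homo lin c cs) (cong (c ⊡ᶠ_) Q≡))) (VF.⊟-cancel v (c ⊡ᶠ Q)))

    Θ-neg : ∀ v c → Θ (v ⊞ᶠ (𝔽.- 𝔽.1#) ⊡ᶠ (c ⊡ᶠ Q)) ≡ Θ v ⊞ (- 1#) ⊡ (embed c ⊡ d)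
    Θ-neg v c = trans (Θ-⊞ v _) (cong (Θ v ⊞_) (trans (Θ-⊡ (𝔽.- 𝔽.1#) (c ⊡ᶠ Q))
      (cong₂ _⊡_ (trans (-‿homo 𝔽.1#) (cong -_ 1#-homo)) (Θ-⊡ c Q))))

    -- Subtracting from v the multiple of Q over F with the same third coordinate leaves a vector at
    -- infinity on the line μ, that is, one in the spread plane.
    kernel⇒span : ∀ v → μ ∙ Θ v ≡ 0# → Span F (Flat.basis W) v
    kernel⇒span v e = from-inverse (𝔽.invertible (dot F h Q) hQ≢0)
      where
      from-inverse : (∃ λ u → u 𝔽.* dot F h Q ≡ 𝔽.1#) → Span F (Flat.basis W) v
      from-inverse (u , u·hQ≡1) = in-span v (proj₁ multiple) c (trans (Θ-neg v c) (proj₂ multiple))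
        where
        c : 𝔽.Carrier
        c = dot F h v 𝔽.* u
        s : V 3
        s = Θ v ⊞ (- 1#) ⊡ (embed c ⊡ d)
        c·d₃ : embed c * third d ≡ third (Θ v)
        c·d₃ = begin
          embed c * third d ≡⟨ cong (embed c *_) (Θ-third Q) ⟩
          embed c * embed (dot F h Q) ≡⟨ *-homo c (dot F h Q) ⟨
          embed (dot F h v 𝔽.* u 𝔽.* dot F h Q) ≡⟨ cong embed (trans (𝔽.*-assoc (dot F h v) u (dot F h Q)) (trans (cong (dot F h v 𝔽.*_) u·hQ≡1) (𝔽.*-identityʳ (dot F h v)))) ⟩
          embed (dot F h v) ≡⟨ Θ-third v ⟨
          third (Θ v) ∎
        s₃≡0 : third s ≡ 0#
        s₃≡0 = trans (third-⊞ (Θ v) _) (trans (cong (third (Θ v) +_) (trans (third-⊡ (- 1#) (embed c ⊡ d)) (cong (- 1# *_) (trans (third-⊡ (embed c) d) c·d₃))))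
          (solve 1 (λ x → x ⊕ ⊝ 𝟙 ⊗ x ⊜ 𝟘) refl (third (Θ v))))
        μs≡0 : μ ∙ s ≡ 0#
        μs≡0 = trans (∙-⊞ μ (Θ v) _) (trans (cong₂ _+_ e (trans (∙-⊡ μ (- 1#) (embed c ⊡ d)) (cong (- 1# *_)
            (trans (∙-⊡ μ (embed c) d) (cong (embed c *_) (trans (∙-comm μ d) (∙-⨯ʳ a d)))))))
          (solve 1 (λ c → 𝟘 ⊕ ⊝ 𝟙 ⊗ (c ⊗ 𝟘) ⊜ 𝟘) refl (embed c)))
        multiple : s ∝ a
        multiple = reduce d s s₃≡0 d₃≢0 μs≡0

    private
      plane-vector : ∀ k → ∃ λ v → Θ v ≡ k ⊡ a
      plane-vector k = let v , e = Θ-onto (k * α) (k * β) 𝔽.0# in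
        v , trans e (cong₂ _∷_ refl (cong₂ _∷_ refl (cong₂ _∷_ (trans 0#-homo (sym (zeroʳ k))) refl)))

      W-vector : Carrier × 𝔽.Carrier → VF.V 7
      W-vector (k , c) = proj₁ (plane-vector k) ⊞ᶠ c ⊡ᶠ Q

      Θ-W-vector : ∀ k c → Θ (W-vector (k , c)) ≡ k ⊡ a ⊞ embed c ⊡ d
      Θ-W-vector k c = trans (Θ-⊞ (proj₁ (plane-vector k)) (c ⊡ᶠ Q)) (cong₂ _⊞_ (proj₂ (plane-vector k)) (Θ-⊡ c Q))

      third-W : ∀ k c → third (k ⊡ a ⊞ embed c ⊡ d) ≡ embed c * third d
      third-W k c = trans (third-⊞ (k ⊡ a) (embed c ⊡ d)) (trans (cong₂ _+_ (zeroʳ k) (third-⊡ (embed c) d)) (+-identityˡ _))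

      W-injective : ∀ {k c k′ c′} → k ⊡ a ⊞ embed c ⊡ d ≡ k′ ⊡ a ⊞ embed c′ ⊡ d → (k , c) ≡ (k′ , c′)
      W-injective {k} {c} {k′} {c′} e = cong₂ _,_ k≡k′ c≡c′
        where
        c≡c′ : c ≡ c′
        c≡c′ = embed-injective (*-cancelˡ d₃≢0 (trans (*-comm _ _) (trans (sym (third-W k c)) (trans (cong third e) (trans (third-W k′ c′) (*-comm _ _))))))
        ka≡k′a : k ⊡ a ≡ k′ ⊡ a
        ka≡k′a = begin
          k ⊡ a ≡⟨ ⊞-cancel (k ⊡ a) (embed c ⊡ d) ⟨
          (k ⊡ a ⊞ embed c ⊡ d) ⊞ (- 1#) ⊡ (embed c ⊡ d) ≡⟨ cong₂ (λ u w → u ⊞ (- 1#) ⊡ (embed w ⊡ d)) e c≡c′ ⟩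
          (k′ ⊡ a ⊞ embed c′ ⊡ d) ⊞ (- 1#) ⊡ (embed c′ ⊡ d) ≡⟨ ⊞-cancel (k′ ⊡ a) (embed c′ ⊡ d) ⟩
          k′ ⊡ a ∎
        k≡k′ : k ≡ k′
        k≡k′ = difference-zero (⊡-zero-scalar a≢𝟎 (begin
          (k + - k′) ⊡ a ≡⟨ cong (λ w → (k + w) ⊡ a) (solve 1 (λ x → ⊝ x ⊜ ⊝ 𝟙 ⊗ x) refl k′) ⟩
          (k + - 1# * k′) ⊡ a ≡⟨ trans (⊡-distribʳ k (- 1# * k′) a) (cong (k ⊡ a ⊞_) (⊡-assoc (- 1#) k′ a)) ⟩
          k ⊡ a ⊞ (- 1#) ⊡ (k′ ⊡ a) ≡⟨ cong (λ w → w ⊞ (- 1#) ⊡ (k′ ⊡ a)) ka≡k′a ⟩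
          k′ ⊡ a ⊞ (- 1#) ⊡ (k′ ⊡ a) ≡⟨ ⊟-self (k′ ⊡ a) ⟩
          𝟎 ∎))

      W-vector∈W : ∀ t → Span F (Flat.basis W) (W-vector t)
      W-vector∈W (k , c) = in-span (W-vector (k , c)) k c
        (trans (cong Θ (VF.⊞-cancel (proj₁ (plane-vector k)) (c ⊡ᶠ Q))) (proj₂ (plane-vector k)))

      ι : Carrier × 𝔽.Carrier → VF.V 4
      ι t = proj₁ (W-vector∈W t)

      comb-ι : ∀ t → combination F (ι t) (Flat.basis W) ≡ W-vector t
      comb-ι t = proj₂ (W-vector∈W t)

      ι-injective : Injective _≡_ _≡_ ι
      ι-injective {k , c} {k′ , c′} e = W-injective (trans (sym (Θ-W-vector k c)) (trans (cong Θ
        (trans (sym (comb-ι (k , c))) (trans (cong (λ cs → combination F cs (Flat.basis W)) e) (comb-ι (k′ , c′))))) (Θ-W-vector k′ c′)))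

      pairs-finite : (Carrier × 𝔽.Carrier) ↔ Fin (q ℕ.^ 4)
      pairs-finite = subst (λ n → (Carrier × 𝔽.Carrier) ↔ Fin n) (trans (cong (q ℕ.^ 3 ℕ.*_) (sym (ℕ.*-identityʳ q))) (sym (ℕ.^-distribˡ-+-* q 3 1)))
        (×-finite enumeration 𝔽.enumeration)

    -- By counting: the vectors k a + c Q form an injective image of K × F inside W, and both have
    -- q⁴ elements. So every vector of W is of this form, and μ kills a and Θ Q.
    span⇒kernel : ∀ v → Span F (Flat.basis W) v → μ ∙ Θ v ≡ 0#
    span⇒kernel v (ds , e) = from-preimage (injective⇒surjective pairs-finite (vec-finite 𝔽.enumeration 4) ι ι-injective ds)
      where
      from-preimage : (∃ λ t → ι t ≡ ds) → μ ∙ Θ v ≡ 0#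
      from-preimage ((k , c) , ι≡) = begin
        μ ∙ Θ v ≡⟨ cong (λ w → μ ∙ Θ w) (trans (sym e) (trans (cong (λ cs → combination F cs (Flat.basis W)) (sym ι≡)) (comb-ι (k , c)))) ⟩
        μ ∙ Θ (W-vector (k , c)) ≡⟨ cong (μ ∙_) (Θ-W-vector k c) ⟩
        μ ∙ (k ⊡ a ⊞ embed c ⊡ d) ≡⟨ trans (∙-⊞ μ (k ⊡ a) (embed c ⊡ d)) (cong₂ _+_ (∙-⊡ μ k a) (∙-⊡ μ (embed c) d)) ⟩
        k * μ ∙ a + embed c * μ ∙ d ≡⟨ cong₂ (λ u w → k * u + embed c * w) (trans (∙-comm μ a) (∙-⨯ˡ a d)) (trans (∙-comm μ d) (∙-⨯ʳ a d)) ⟩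
        k * 0# + embed c * 0# ≡⟨ solve 2 (λ k c → k ⊗ 𝟘 ⊕ c ⊗ 𝟘 ⊜ 𝟘) refl k (embed c) ⟩
        0# ∎

  LineCoordinates : BBLine E Σ∞ 𝓢 → Set
  LineCoordinates ℓ = ∃ λ (μ : Point K 2) → ∀ B → _Iᴮ_ E Σ∞ 𝓢 B ℓ ⇔ dot K (coords μ) (coords (Φ B)) ≡ 0#

  third-dot : ∀ v → dot K (0# ∷ 0# ∷ 1# ∷ []) v ≡ third v
  third-dot (x ∷ y ∷ z ∷ []) = solve 3 (λ x y z → 𝟘 ⊗ x ⊕ (𝟘 ⊗ y ⊕ (𝟙 ⊗ z ⊕ 𝟘)) ⊜ z) refl x y z

  line∞-coordinates : ∀ B → _Iᴮ_ E Σ∞ 𝓢 B line∞ ⇔ third (coords (Φ B)) ≡ 0#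
  line∞-coordinates (affine P P∉) = mk⇔ (λ ()) (λ e → P∉ (embed-injective (trans (sym (Θ-third (coords P))) (trans e (sym 0#-homo)))))
  line∞-coordinates (plane X (_ ∷ _ ∷ [] , _)) = mk⇔ (λ _ → refl) _

  -- A search through the finitely many coefficient vectors turns the negated inclusion into a
  -- witness.
  affine-vector : (W : Flat F 6 3) → ¬ (points F W ⊆ onHyperplane F Σ∞) →
                  ∃ λ cs → dot F h (combination F cs (Flat.basis W)) ≢ 𝔽.0#
  affine-vector W W⊈ with any-finite? (vec-finite 𝔽.enumeration 4) (λ cs → ¬? (dot F h (combination F cs (Flat.basis W)) 𝔽.≟ 𝔽.0#))
  ... | yes found = found
  ... | no none = contradiction (λ {P} (cs , e) → subst (λ v → dot F h v ≡ 𝔽.0#) e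
      (decidable-stable (dot F h (combination F cs (Flat.basis W)) 𝔽.≟ 𝔽.0#) (λ ne → none (cs , ne)))) W⊈

  line-coordinates : ∀ ℓ → LineCoordinates ℓ
  line-coordinates line∞ = point (0# ∷ 0# ∷ 1# ∷ []) (1≢0 ∘ cong (head ∘ tail ∘ tail)) , λ B →
    subst (λ x → _Iᴮ_ E Σ∞ 𝓢 B line∞ ⇔ x ≡ 0#) (sym (third-dot (coords (Φ B)))) (line∞-coordinates B)
  line-coordinates (solid W W⊈ through@(X , ((α ∷ β ∷ [] , s) , X⊆W))) = from-affine (affine-vector W W⊈)
    where
    span-zero : Span F (Flat.basis W) VF.𝟎
    span-zero = VF.𝟎 , VF.IsLinear.𝟎-homo (VF.comb-linear (Flat.basis W))

    plane⊆W : ∀ v k → Θ v ≡ k ⊡ at-infinity α β → Span F (Flat.basis W) v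
    plane⊆W v k e with v VF.≟ᵛ VF.𝟎
    ... | yes v≡𝟎 = subst (Span F (Flat.basis W)) (sym v≡𝟎) span-zero
    ... | no v≢𝟎 = X⊆W {point v v≢𝟎} (Equivalence.from (spreadPlane⇔ X α β s (point v v≢𝟎)) (k , e))

    from-affine : (∃ λ cs → dot F h (combination F cs (Flat.basis W)) ≢ 𝔽.0#) → LineCoordinates (solid W W⊈ through)
    from-affine (cs , hQ≢0) = point S.μ S.μ-nonzero , λ B → mk⇔ (⇒ B) (⇐ B)
      where
      module S = Solid W α β (g-nonzero α β s (nonzero X)) plane⊆W cs (combination F cs (Flat.basis W)) refl hQ≢0
      ⇐ : ∀ B → S.μ ∙ coords (Φ B) ≡ 0# → pointsOf E Σ∞ 𝓢 B ⊆ points F W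
      ⇐ B e {Q} Q∈B = on-multiple (Equivalence.to (pointsOf⇔ B Q) Q∈B)
        where
        on-multiple : Θ (coords Q) ∝ coords (Φ B) → points F W Q
        on-multiple (k , ΘQ≡) = S.kernel⇒span (coords Q)
          (trans (cong (S.μ ∙_) ΘQ≡) (trans (∙-⊡ S.μ k (coords (Φ B))) (trans (cong (k *_) e) (zeroʳ k))))
      ⇒ : ∀ B → pointsOf E Σ∞ 𝓢 B ⊆ points F W → S.μ ∙ coords (Φ B) ≡ 0#
      ⇒ B B⊆W = from-representative (representative B)
        where
        from-representative : (∃ λ v → Θ v ≡ coords (Φ B)) → S.μ ∙ coords (Φ B) ≡ 0#
        from-representative (v , e) = trans (cong (S.μ ∙_) (sym e)) (S.span⇒kernel v (B⊆W {Q} (Equivalence.from (pointsOf⇔ B Q) (1# , trans e (sym (⊡-identity (coords (Φ B))))))))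
          where
          Q : Point F 6
          Q = point v (λ v≡𝟎 → nonzero (Φ B) (trans (sym e) (trans (cong Θ v≡𝟎) Θ-zero)))

-- The normal rational curves

module NormalCurves {q : ℕ} (primePower : PrimePower q) (2≤q : 2 ≤ q) (E : CubicExtension q)
  (Σ∞ : Point (CubicExtension.F E) 6) (𝓢 : RegularSpread E Σ∞)
  (C : TraceTheory.Coordinates primePower 2≤q E Σ∞ 𝓢) where
  open TraceTheory primePower 2≤q E
  open RegularSpread 𝓢
  open Coordinates C
  open BruckBosePlane primePower 2≤q E Σ∞ 𝓢 C
  open ConjugateWindows primePower 2≤q E
  open Contraction K
  open ≡-Reasoning
  open VF using () renaming (_⊞_ to _⊞ᶠ_; _⊡_ to _⊡ᶠ_)

  ext-powers : ∀ n θ → ext (tabulate {n = n} (λ i → θ 𝔽.^ᶠ toℕ i)) ≡ powers n (embed θ)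
  ext-powers n θ = trans (sym (Vec.tabulate-∘ embed (λ i → θ 𝔽.^ᶠ toℕ i))) (Vec.tabulate-cong (λ i → homo-^ isRingHomomorphism θ (toℕ i)))

  ext-∞ : ∀ n → ext (replicate n 𝔽.0# ∷ʳ 𝔽.1#) ≡ at-∞ n
  ext-∞ n = trans (Vec.map-∷ʳ embed 𝔽.1# (replicate n 𝔽.0#)) (cong₂ _∷ʳ_ Extend.map-𝟎 1#-homo)

  powersᶠ : ∀ n → 𝔽.Carrier → VF.V n
  powersᶠ n θ = tabulate (λ i → θ 𝔽.^ᶠ toℕ i)

  ∞ᶠ : ∀ n → VF.V (suc n)
  ∞ᶠ n = replicate n 𝔽.0# ∷ʳ 𝔽.1#

  linear-scale : ∀ {a b} {f : V a → V b} → IsLinear f → ∀ {s t u v w} → u ≡ s ⊡ v → f v ≡ t ⊡ w → f u ≡ (s * t) ⊡ w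
  linear-scale {f = f} f-linear {s} {t} {v = v} {w} refl fv≡ = trans (IsLinear.⊡-homo f-linear s v) (trans (cong (s ⊡_) fv≡) (sym (⊡-assoc s t w)))

  module _ (a₀ a₁ a₂ : V 3) (A-independent : LinearlyIndependent K (a₀ ∷ a₁ ∷ a₂ ∷ [])) where
    A : Vec (V 3) 3
    A = a₀ ∷ a₁ ∷ a₂ ∷ []

    l : V 3
    l = third a₀ ∷ third a₁ ∷ third a₂ ∷ []

    -- The multiple is taken over K. Off Σ∞ this leaves a single point of PG(6,F); for a point at
    -- infinity it fills the spread plane, as exactness at infinity demands.
    OnCurve : Pred (Point F 6) 0ℓ
    OnCurve P = ∃ λ y → StandardNRC F 2 y × Θ (coords P) ∝ comb A (ext y)

    third-comb : ∀ d → third (comb A d) ≡ l ∙ d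
    third-comb (x ∷ y ∷ z ∷ []) = trans (third-⊞ (x ⊡ a₀) _) (trans (cong₂ _+_ (third-⊡ x a₀)
      (trans (third-⊞ (y ⊡ a₁) _) (cong₂ _+_ (third-⊡ y a₁) (trans (third-⊞ (z ⊡ a₂) 𝟎) (cong (_+ 0#) (third-⊡ z a₂))))))
      (solve 6 (λ x y z a b c → x ⊗ a ⊕ (y ⊗ b ⊕ (z ⊗ c ⊕ 𝟘)) ⊜ a ⊗ x ⊕ (b ⊗ y ⊕ (c ⊗ z ⊕ 𝟘))) refl x y z (third a₀) (third a₁) (third a₂)))

    -- A linear map on coefficient vectors whose values on F-vectors have third
    -- coordinate in F descends to a map into F⁷, hence to a flat.
    module Lift {r : ℕ} (L : V (suc r) → V 3) (L-linear : IsLinear L)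
      (L-fixed : ∀ v → φ (l ∙ L (ext v)) ≡ l ∙ L (ext v)) (L-kernel : ∀ v → L (ext v) ≡ 𝟎 → v ≡ VF.𝟎) where

      private
        S : VF.V (suc r) → V 3
        S v = L (ext v)

        S-⊞ : ∀ u v → S (u ⊞ᶠ v) ≡ S u ⊞ S v
        S-⊞ u v = trans (cong L (Extend.map-⊞ u v)) (IsLinear.⊞-homo L-linear (ext u) (ext v))

        S-⊡ : ∀ c v → S (c ⊡ᶠ v) ≡ embed c ⊡ S v
        S-⊡ c v = trans (cong L (Extend.map-⊡ c v)) (IsLinear.⊡-homo L-linear (embed c) (ext v))

        eta : ∀ (v : V 3) {w} → w ≡ third v → head v ∷ head (tail v) ∷ w ∷ [] ≡ v
        eta (_ ∷ _ ∷ _ ∷ []) refl = refl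

        lift : ∀ v → ∃ λ u → Θ u ≡ comb A (S v)
        lift v =
          let z , z≡ = fixed⇒embedded (L-fixed v)
              u , Θu≡ = Θ-onto (head (comb A (S v))) (head (tail (comb A (S v)))) z
          in u , trans Θu≡ (eta (comb A (S v)) (trans z≡ (sym (third-comb (S v)))))

      T : VF.V (suc r) → VF.V 7
      T v = proj₁ (lift v)

      Θ-T : ∀ v → Θ (T v) ≡ comb A (S v)
      Θ-T v = proj₂ (lift v)

      T-linear : VF.IsLinear T
      T-linear = record
        { ⊞-homo = λ u v → Θ-injective (trans (Θ-T (u ⊞ᶠ v)) (trans (cong (comb A) (S-⊞ u v)) (trans (IsLinear.⊞-homo (comb-linear A) (S u) (S v))
            (sym (trans (Θ-⊞ (T u) (T v)) (cong₂ _⊞_ (Θ-T u) (Θ-T v)))))))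
        ; ⊡-homo = λ c v → Θ-injective (trans (Θ-T (c ⊡ᶠ v)) (trans (cong (comb A) (S-⊡ c v)) (trans (IsLinear.⊡-homo (comb-linear A) (embed c) (S v))
            (sym (trans (Θ-⊡ c (T v)) (cong (embed c ⊡_) (Θ-T v))))))) }

      T-kernel : ∀ v → T v ≡ VF.𝟎 → v ≡ VF.𝟎
      T-kernel v Tv≡𝟎 = L-kernel v (A-independent (S v) (trans (sym (Θ-T v)) (trans (cong Θ Tv≡𝟎) Θ-zero)))

      flat : Flat F 6 r
      flat = record
        { basis = proj₁ (VF.columns T-linear)
        ; independent = λ cs e → T-kernel cs (trans (sym (proj₂ (VF.columns T-linear) cs)) e) }

      flat-comb : ∀ v → combination F v (Flat.basis flat) ≡ T v
      flat-comb = proj₂ (VF.columns T-linear)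

      module _ (x : VF.V (suc r)) (y : VF.V 3) (k : Carrier) (Sx≡ : L (ext x) ≡ k ⊡ ext y) where
        private
          ΘT≡ : Θ (T x) ≡ k ⊡ comb A (ext y)
          ΘT≡ = trans (Θ-T x) (trans (cong (comb A) Sx≡) (IsLinear.⊡-homo (comb-linear A) k (ext y)))

        from-flat : ∀ (P : Point F 6) → _~_ F (coords P) (combination F x (Flat.basis flat)) → Θ (coords P) ∝ comb A (ext y)
        from-flat P (c , _ , P≡) = embed c * k , (begin
          Θ (coords P) ≡⟨ cong Θ (trans P≡ (cong (c ⊡ᶠ_) (flat-comb x))) ⟩
          Θ (c ⊡ᶠ T x) ≡⟨ Θ-⊡ c (T x) ⟩
          embed c ⊡ Θ (T x) ≡⟨ cong (embed c ⊡_) ΘT≡ ⟩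
          embed c ⊡ (k ⊡ comb A (ext y)) ≡⟨ ⊡-assoc (embed c) k (comb A (ext y)) ⟨
          (embed c * k) ⊡ comb A (ext y) ∎)

        -- The two inequalities make `T x` affine, and there `affine-multiple` turns a K-multiple
        -- into an F-multiple.
        to-flat : k ≢ 0# → l ∙ ext y ≢ 0# → ∀ (P : Point F 6) → Θ (coords P) ∝ comb A (ext y) →
                  _~_ F (coords P) (combination F x (Flat.basis flat))
        to-flat k≢0 ly≢0 P (j , ΘP≡) = from-inverse (invertible k k≢0)
          where
          hT≢0 : dot F h (T x) ≢ 𝔽.0#
          hT≢0 e = *-nonzero k≢0 ly≢0 (begin
            k * l ∙ ext y ≡⟨ cong (k *_) (third-comb (ext y)) ⟨
            k * third (comb A (ext y)) ≡⟨ third-⊡ k (comb A (ext y)) ⟨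
            third (k ⊡ comb A (ext y)) ≡⟨ cong third ΘT≡ ⟨
            third (Θ (T x)) ≡⟨ Θ-third (T x) ⟩
            embed (dot F h (T x)) ≡⟨ trans (cong embed e) 0#-homo ⟩
            0# ∎)
          from-inverse : (∃ λ u → u * k ≡ 1#) → _~_ F (coords P) (combination F x (Flat.basis flat))
          from-inverse (u , uk≡1) = conclude (affine-multiple (coords P) (T x) (j * u) hT≢0 (begin
            Θ (coords P) ≡⟨ ΘP≡ ⟩
            j ⊡ comb A (ext y) ≡⟨ cong (j ⊡_) (⊡-inverse uk≡1 (comb A (ext y))) ⟨
            j ⊡ (u ⊡ (k ⊡ comb A (ext y))) ≡⟨ ⊡-assoc j u (k ⊡ comb A (ext y)) ⟨
            (j * u) ⊡ (k ⊡ comb A (ext y)) ≡⟨ cong ((j * u) ⊡_) ΘT≡ ⟨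
            (j * u) ⊡ Θ (T x) ∎))
            where
            conclude : (∃ λ c → coords P ≡ c ⊡ᶠ T x × j * u ≡ embed c) → _~_ F (coords P) (combination F x (Flat.basis flat))
            conclude (c , P≡ , _) = c , (λ c≡0 → nonzero P (trans P≡ (trans (cong (_⊡ᶠ T x) c≡0) (VF.⊡-zeroˡ (T x)))))
                                      , trans P≡ (cong (c ⊡ᶠ_) (sym (flat-comb x)))

    -- Multiplying a point (X : Y : L) of the conic by L′L″ turns its third
    -- coordinate into the norm of L, which lies in F.
    module OffConic (p : VF.V 3) (p≢𝟎 : p ≢ VF.𝟎) (tangent : Tangency l p) (lp≡0 : l ∙ ext p ≡ 0#)
      (off : head (tail p) 𝔽.* head (tail p) ≢ head p 𝔽.* head (tail (tail p))) where

      private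
        l′ l″ : V 3
        l′ = frob l
        l″ = frob l′

        S : V 7 → V 3
        S v = l′ ⋆₂ l″ ⋆₂ v

        frob-S : ∀ v → frob (S (ext v)) ≡ l ⋆₂ l″ ⋆₂ ext v
        frob-S v = begin
          frob (l′ ⋆₂ l″ ⋆₂ ext v) ≡⟨ trans (frob-⋆₂ l′ (l″ ⋆₂ ext v)) (cong (l″ ⋆₂_) (frob-⋆₂ l″ (ext v))) ⟩
          l″ ⋆₂ frob l″ ⋆₂ frob (ext v) ≡⟨ cong₂ (λ a b → l″ ⋆₂ a ⋆₂ b) (frob³ l) (frob-ext v) ⟩
          l″ ⋆₂ l ⋆₂ ext v ≡⟨ ⋆₂-comm l″ l (ext v) ⟩
          l ⋆₂ l″ ⋆₂ ext v ∎

        head-⋆₂ : ∀ m (v : V 3) → head (m ⋆₂ v) ≡ m ∙ v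
        head-⋆₂ m (_ ∷ _ ∷ _ ∷ []) = refl

        -- Both sides contract v by the product of the three conjugates of l, which Frobenius only
        -- permutes.
        S-fixed : ∀ v → φ (l ∙ S (ext v)) ≡ l ∙ S (ext v)
        S-fixed v = begin
          φ (l ∙ S (ext v)) ≡⟨ Frobenius.map-∙ l (S (ext v)) ⟩
          l′ ∙ frob (S (ext v)) ≡⟨ cong (l′ ∙_) (frob-S v) ⟩
          l′ ∙ (l ⋆₂ l″ ⋆₂ ext v) ≡⟨ head-⋆₂ l′ (l ⋆₂ l″ ⋆₂ ext v) ⟨
          head (l′ ⋆₂ l ⋆₂ l″ ⋆₂ ext v) ≡⟨ cong head (⋆₂-comm l′ l (l″ ⋆₂ ext v)) ⟩
          head (l ⋆₂ l′ ⋆₂ l″ ⋆₂ ext v) ≡⟨ head-⋆₂ l (S (ext v)) ⟩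
          l ∙ S (ext v) ∎

        -- Conjugating l′ ⋆ l″ ⋆ v = 0 gives l ⋆ l″ ⋆ v = 0, so l″ ⋆ v, of length 5, vanishes by
        -- `⋆₂-injective`. The conjugates of this equation say that l and l′ kill v itself, of
        -- length 7, and the lemma applies again.
        S-kernel : ∀ v → S (ext v) ≡ 𝟎 → v ≡ VF.𝟎
        S-kernel v Sv≡𝟎 = ext-injective (trans (⋆₂-injective 3 l p p≢𝟎 tangent lp≡0 off (ext v) lv≡𝟎 l′v≡𝟎) (sym Extend.map-𝟎))
          where
          l″v≡𝟎 : l″ ⋆₂ ext v ≡ 𝟎
          l″v≡𝟎 = ⋆₂-injective 1 l p p≢𝟎 tangent lp≡0 off (l″ ⋆₂ ext v) (trans (sym (frob-S v)) (frob-𝟎 Sv≡𝟎)) Sv≡𝟎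
          lv≡𝟎 : l ⋆₂ ext v ≡ 𝟎
          lv≡𝟎 = trans (sym (trans (frob-⋆₂ l″ (ext v)) (cong₂ _⋆₂_ (frob³ l) (frob-ext v)))) (frob-𝟎 l″v≡𝟎)
          l′v≡𝟎 : l′ ⋆₂ ext v ≡ 𝟎
          l′v≡𝟎 = trans (sym (trans (frob-⋆₂ l (ext v)) (cong (l′ ⋆₂_) (frob-ext v)))) (frob-𝟎 lv≡𝟎)

        module L = Lift S (∘-linear (⋆₂-linear l′) (⋆₂-linear l″)) S-fixed S-kernel

        S-power : ∀ θ → S (ext (powersᶠ 7 θ)) ≡ conjugateProduct l (powersᶠ 3 θ) ⊡ ext (powersᶠ 3 θ)
        S-power θ = trans (cong S (ext-powers 7 θ)) (trans
          (linear-scale (⋆₂-linear l′) (⋆₂-powers 5 l″ (embed θ)) (⋆₂-powers 3 l′ (embed θ)))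
          (cong (λ P → (l″ ∙ P * l′ ∙ P) ⊡ P) (sym (ext-powers 3 θ))))

        S-∞ : S (ext (∞ᶠ 6)) ≡ conjugateProduct l (∞ᶠ 2) ⊡ ext (∞ᶠ 2)
        S-∞ = trans (cong S (ext-∞ 6)) (trans
          (linear-scale (⋆₂-linear l′) (⋆₂-∞ 4 l″) (⋆₂-∞ 2 l′))
          (cong (λ P → (l″ ∙ P * l′ ∙ P) ⊡ P) (sym (ext-∞ 2))))

        off-multiple : ∀ c p₀ p₁ p₂ x y z → x ∷ y ∷ z ∷ [] ≡ c ⊡ᶠ (p₀ ∷ p₁ ∷ p₂ ∷ []) → x ∷ y ∷ z ∷ [] ≢ VF.𝟎 →
                       p₁ 𝔽.* p₁ ≢ p₀ 𝔽.* p₂ → y 𝔽.* y ≢ x 𝔽.* z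
        off-multiple c p₀ p₁ p₂ x y z e ne off y²≡xz = off (𝔽.*-cancelˡ (𝔽.*-nonzero c≢0 c≢0) (begin
          c 𝔽.* c 𝔽.* (p₁ 𝔽.* p₁) ≡⟨ 𝔽.solve 2 (λ c p → c ⊗ c ⊗ (p ⊗ p) ⊜ (c ⊗ p) ⊗ (c ⊗ p)) refl c p₁ ⟩
          (c 𝔽.* p₁) 𝔽.* (c 𝔽.* p₁) ≡⟨ cong (λ y → y 𝔽.* y) (cong (head ∘ tail) e) ⟨
          y 𝔽.* y ≡⟨ y²≡xz ⟩
          x 𝔽.* z ≡⟨ cong₂ 𝔽._*_ (cong head e) (cong (head ∘ tail ∘ tail) e) ⟩
          (c 𝔽.* p₀) 𝔽.* (c 𝔽.* p₂) ≡⟨ 𝔽.solve 3 (λ c p r → (c ⊗ p) ⊗ (c ⊗ r) ⊜ c ⊗ c ⊗ (p ⊗ r)) refl c p₀ p₂ ⟩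
          c 𝔽.* c 𝔽.* (p₀ 𝔽.* p₂) ∎))
          where
          c≢0 : c ≢ 𝔽.0#
          c≢0 c≡0 = ne (trans e (trans (cong (_⊡ᶠ (p₀ ∷ p₁ ∷ p₂ ∷ [])) c≡0) (VF.⊡-zeroˡ (p₀ ∷ p₁ ∷ p₂ ∷ []))))

        eta : ∀ (v : VF.V 3) → v ≡ head v ∷ head (tail v) ∷ head (tail (tail v)) ∷ []
        eta (_ ∷ _ ∷ _ ∷ []) = refl

        -- In the parameter plane the conic is y² = x z. A standard point on l would be a multiple
        -- of p, which does not satisfy this equation.
        standard-off-l : ∀ {y} → StandardNRC F 2 y → l ∙ ext y ≢ 0#
        standard-off-l (finite θ) e = off-tangent (tangent (powersᶠ 3 θ) e)
          where
          off-tangent : ¬ (∃ λ c → powersᶠ 3 θ ≡ c ⊡ᶠ p)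
          off-tangent (c , e) = off-multiple c (head p) (head (tail p)) (head (tail (tail p))) 𝔽.1# (θ 𝔽.* 𝔽.1#) (θ 𝔽.* (θ 𝔽.* 𝔽.1#))
            (trans e (cong (c ⊡ᶠ_) (eta p))) (𝔽.1≢0 ∘ cong head) off
            (𝔽.solve 1 (λ θ → (θ ⊗ 𝟙) ⊗ (θ ⊗ 𝟙) ⊜ 𝟙 ⊗ (θ ⊗ (θ ⊗ 𝟙))) refl θ)
        standard-off-l infinite e = off-tangent (tangent (∞ᶠ 2) e)
          where
          off-tangent : ¬ (∃ λ c → ∞ᶠ 2 ≡ c ⊡ᶠ p)
          off-tangent (c , e) = off-multiple c (head p) (head (tail p)) (head (tail (tail p))) 𝔽.0# 𝔽.0# 𝔽.1#
            (trans e (cong (c ⊡ᶠ_) (eta p))) (𝔽.1≢0 ∘ cong (head ∘ tail ∘ tail)) off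
            (𝔽.solve 0 (𝟘 ⊗ 𝟘 ⊜ 𝟘 ⊗ 𝟙) refl)

      curve₆ : IsNormalRationalCurve F 6 OnCurve
      curve₆ = L.flat , (λ {P} → to P) , (λ {P} → from P)
        where
        to : ∀ P → OnCurve P → ∃ λ x → StandardNRC F 6 x × _~_ F (coords P) (combination F x (Flat.basis L.flat))
        to P (_ , finite θ , m) = powersᶠ 7 θ , finite θ , L.to-flat (powersᶠ 7 θ) y (conjugateProduct l y) (S-power θ)
            (conjugateProduct≢0 l y (standard-off-l (finite θ))) (standard-off-l (finite θ)) P m
          where y = powersᶠ 3 θ
        to P (_ , infinite , m) = ∞ᶠ 6 , infinite , L.to-flat (∞ᶠ 6) y (conjugateProduct l y) S-∞
            (conjugateProduct≢0 l y (standard-off-l infinite)) (standard-off-l infinite) P m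
          where y = ∞ᶠ 2
        from : ∀ P → (∃ λ x → StandardNRC F 6 x × _~_ F (coords P) (combination F x (Flat.basis L.flat))) → OnCurve P
        from P (_ , finite θ , m) = powersᶠ 3 θ , finite θ , L.from-flat (powersᶠ 7 θ) (powersᶠ 3 θ) (conjugateProduct l (powersᶠ 3 θ)) (S-power θ) P m
        from P (_ , infinite , m) = ∞ᶠ 2 , infinite , L.from-flat (∞ᶠ 6) (∞ᶠ 2) (conjugateProduct l (∞ᶠ 2)) S-∞ P m

    -- Here L = t M with M linear, and it suffices to multiply by M′M″.
    module OnConic (tangent : Tangency l (∞ᶠ 2)) (l∞≡0 : l ∙ ext (∞ᶠ 2) ≡ 0#) where

      private
        m m′ m″ : V 2
        m = third a₀ ∷ third a₁ ∷ []
        m′ = frob m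
        m″ = frob m′

        l₂≡0 : third a₂ ≡ 0#
        l₂≡0 = trans (solve 3 (λ a b c → c ⊜ a ⊗ 𝟘 ⊕ (b ⊗ 𝟘 ⊕ (c ⊗ 𝟙 ⊕ 𝟘))) refl (third a₀) (third a₁) (third a₂))
          (trans (cong (l ∙_) (sym (ext-∞ 2))) l∞≡0)

        l-∙ : ∀ x y z → l ∙ (x ∷ y ∷ z ∷ []) ≡ m ∙ (x ∷ y ∷ [])
        l-∙ x y z = trans (cong (λ c → third a₀ * x + (third a₁ * y + (c * z + 0#))) l₂≡0)
          (solve 5 (λ a b x y z → a ⊗ x ⊕ (b ⊗ y ⊕ (𝟘 ⊗ z ⊕ 𝟘)) ⊜ a ⊗ x ⊕ (b ⊗ y ⊕ 𝟘)) refl (third a₀) (third a₁) x y z)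

        l-⋆₁ : ∀ v → l ∙ v ≡ head (m ⋆₁ v)
        l-⋆₁ (x ∷ y ∷ z ∷ []) = l-∙ x y z

        -- A relation over F would be a zero of l with last coordinate 0, but the only zeros of l
        -- over F are multiples of (0, 0, 1).
        independent : FIndependent (third a₀) (third a₁)
        independent a b e = vanish (tangent (a ∷ b ∷ 𝔽.0# ∷ []) (trans (l-∙ (embed a) (embed b) (embed 𝔽.0#))
            (trans (solve 4 (λ a b x y → a ⊗ x ⊕ (b ⊗ y ⊕ 𝟘) ⊜ x ⊗ a ⊕ y ⊗ b) refl (third a₀) (third a₁) (embed a) (embed b)) e)))
          where
          vanish : (∃ λ c → a ∷ b ∷ 𝔽.0# ∷ [] ≡ c ⊡ᶠ ∞ᶠ 2) → a ≡ 𝔽.0# × b ≡ 𝔽.0#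
          vanish (c , e) = trans (cong head e) (𝔽.zeroʳ c) , trans (cong (head ∘ tail) e) (𝔽.zeroʳ c)

        S : V 5 → V 3
        S v = m′ ⋆₁ m″ ⋆₁ v

        frob-S : ∀ v → frob (S (ext v)) ≡ m ⋆₁ m″ ⋆₁ ext v
        frob-S v = begin
          frob (m′ ⋆₁ m″ ⋆₁ ext v) ≡⟨ trans (frob-⋆₁ m′ (m″ ⋆₁ ext v)) (cong (m″ ⋆₁_) (frob-⋆₁ m″ (ext v))) ⟩
          m″ ⋆₁ frob m″ ⋆₁ frob (ext v) ≡⟨ cong₂ (λ a b → m″ ⋆₁ a ⋆₁ b) (frob³ m) (frob-ext v) ⟩
          m″ ⋆₁ m ⋆₁ ext v ≡⟨ ⋆₁-comm m″ m (ext v) ⟩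
          m ⋆₁ m″ ⋆₁ ext v ∎

        S-fixed : ∀ v → φ (l ∙ S (ext v)) ≡ l ∙ S (ext v)
        S-fixed v = begin
          φ (l ∙ S (ext v)) ≡⟨ cong φ (l-⋆₁ (S (ext v))) ⟩
          φ (head (m ⋆₁ S (ext v))) ≡⟨ φ-head (m ⋆₁ S (ext v)) ⟩
          head (frob (m ⋆₁ S (ext v))) ≡⟨ cong head (trans (frob-⋆₁ m (S (ext v))) (cong (m′ ⋆₁_) (frob-S v))) ⟩
          head (m′ ⋆₁ m ⋆₁ m″ ⋆₁ ext v) ≡⟨ cong head (⋆₁-comm m′ m (m″ ⋆₁ ext v)) ⟩
          head (m ⋆₁ S (ext v)) ≡⟨ l-⋆₁ (S (ext v)) ⟨
          l ∙ S (ext v) ∎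
          where
          φ-head : ∀ {n} (w : V (suc n)) → φ (head w) ≡ head (frob w)
          φ-head (_ ∷ _) = refl

        -- The two conjugations of the other case, now with vectors of length 4 and 5.
        S-kernel : ∀ v → S (ext v) ≡ 𝟎 → v ≡ VF.𝟎
        S-kernel v Sv≡𝟎 = ext-injective (trans (⋆₁-injective 3 (third a₀) (third a₁) independent (ext v) mv≡𝟎 m′v≡𝟎) (sym Extend.map-𝟎))
          where
          m″v≡𝟎 : m″ ⋆₁ ext v ≡ 𝟎
          m″v≡𝟎 = ⋆₁-injective 2 (third a₀) (third a₁) independent (m″ ⋆₁ ext v) (trans (sym (frob-S v)) (frob-𝟎 Sv≡𝟎)) Sv≡𝟎
          mv≡𝟎 : m ⋆₁ ext v ≡ 𝟎
          mv≡𝟎 = trans (sym (trans (frob-⋆₁ m″ (ext v)) (cong₂ _⋆₁_ (frob³ m) (frob-ext v)))) (frob-𝟎 m″v≡𝟎)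
          m′v≡𝟎 : m′ ⋆₁ ext v ≡ 𝟎
          m′v≡𝟎 = trans (sym (trans (frob-⋆₁ m (ext v)) (cong (m′ ⋆₁_) (frob-ext v)))) (frob-𝟎 mv≡𝟎)

        module L = Lift S (∘-linear (⋆₁-linear m′) (⋆₁-linear m″)) S-fixed S-kernel

        S-power : ∀ θ → S (ext (powersᶠ 5 θ)) ≡ conjugateProduct m (powersᶠ 2 θ) ⊡ ext (powersᶠ 3 θ)
        S-power θ = trans (cong S (ext-powers 5 θ)) (trans
          (linear-scale (⋆₁-linear m′) (⋆₁-powers 4 m″ (embed θ)) (⋆₁-powers 3 m′ (embed θ)))
          (cong₂ (λ P Q → (m″ ∙ P * m′ ∙ P) ⊡ Q) (sym (ext-powers 2 θ)) (sym (ext-powers 3 θ))))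

        S-∞ : S (ext (∞ᶠ 4)) ≡ conjugateProduct m (∞ᶠ 1) ⊡ ext (∞ᶠ 2)
        S-∞ = trans (cong S (ext-∞ 4)) (trans
          (linear-scale (⋆₁-linear m′) (⋆₁-∞ 3 m″) (⋆₁-∞ 2 m′))
          (cong₂ (λ P Q → (m″ ∙ P * m′ ∙ P) ⊡ Q) (sym (ext-∞ 1)) (sym (ext-∞ 2))))

        power-off-l : ∀ θ → l ∙ ext (powersᶠ 3 θ) ≢ 0#
        power-off-l θ e = off-tangent (tangent (powersᶠ 3 θ) e)
          where
          off-tangent : ¬ (∃ λ c → powersᶠ 3 θ ≡ c ⊡ᶠ ∞ᶠ 2)
          off-tangent (c , e) = 𝔽.1≢0 (trans (cong head e) (𝔽.zeroʳ c))

        power-off-m : ∀ θ → m ∙ ext (powersᶠ 2 θ) ≢ 0#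
        power-off-m θ e = power-off-l θ (trans (l-∙ (embed 𝔽.1#) (embed (θ 𝔽.* 𝔽.1#)) (embed (θ 𝔽.* (θ 𝔽.* 𝔽.1#)))) e)

        v∞ : V 3
        v∞ = comb A (ext (∞ᶠ 2))

        third-v∞ : third v∞ ≡ 0#
        third-v∞ = trans (third-comb (ext (∞ᶠ 2))) l∞≡0

        α β : Carrier
        α = head v∞
        β = head (tail v∞)

        v∞≡ : v∞ ≡ at-infinity α β
        v∞≡ = eta v∞ third-v∞
          where
          eta : ∀ v → third v ≡ 0# → v ≡ at-infinity (head v) (head (tail v))
          eta (_ ∷ _ ∷ _ ∷ []) refl = refl

        X : Point K 6
        X = point (comb (Flat.basis g) (α ∷ β ∷ [])) λ X≡𝟎 →
          let αβ≡𝟎 = Flat.independent g (α ∷ β ∷ []) X≡𝟎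
              v≡𝟎 = trans v∞≡ (cong₂ _∷_ (cong head αβ≡𝟎) (cong₂ _∷_ (cong (head ∘ tail) αβ≡𝟎) refl))
          in 1≢0 (cong (head ∘ tail ∘ tail) (trans (sym (ext-∞ 2)) (A-independent (ext (∞ᶠ 2)) v≡𝟎)))

        -- The parameter ∞ is included. Its point lies on the spread plane, so the two pieces
        -- overlap.
        N₄ : Pred (Point F 6) 0ℓ
        N₄ P = ∃ λ x → StandardNRC F 4 x × _~_ F (coords P) (combination F x (Flat.basis L.flat))

        on-plane : ∀ P → spreadPlane X P ⇔ Θ (coords P) ∝ at-infinity α β
        on-plane P = spreadPlane⇔ X α β refl P

      curve₄ : ∃ λ (N₄ : Pred (Point F 6) 0ℓ) → ∃ λ (X : Point K 6) →
               IsNormalRationalCurve F 4 N₄ × points K g X × OnCurve ≐ (N₄ ∪ spreadPlane X)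
      curve₄ = N₄ , X , (L.flat , id , id) , (α ∷ β ∷ [] , refl) , (λ {P} → to P) , (λ {P} → from P)
        where
        to : ∀ P → OnCurve P → N₄ P ⊎ spreadPlane X P
        to P (_ , finite θ , e) = inj₁ (powersᶠ 5 θ , finite θ ,
          L.to-flat (powersᶠ 5 θ) (powersᶠ 3 θ) (conjugateProduct m (powersᶠ 2 θ)) (S-power θ) (conjugateProduct≢0 m (powersᶠ 2 θ) (power-off-m θ)) (power-off-l θ) P e)
        to P (_ , infinite , k , e) = inj₂ (Equivalence.from (on-plane P) (k , trans e (cong (k ⊡_) v∞≡)))
        from : ∀ P → N₄ P ⊎ spreadPlane X P → OnCurve P
        from P (inj₁ (_ , finite θ , e)) = powersᶠ 3 θ , finite θ , L.from-flat (powersᶠ 5 θ) (powersᶠ 3 θ) (conjugateProduct m (powersᶠ 2 θ)) (S-power θ) P e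
        from P (inj₁ (_ , infinite , e)) = ∞ᶠ 2 , infinite , L.from-flat (∞ᶠ 4) (∞ᶠ 2) (conjugateProduct m (∞ᶠ 1)) S-∞ P e
        from P (inj₂ P∈X) = on-curve (Equivalence.to (on-plane P) P∈X)
          where
          on-curve : Θ (coords P) ∝ at-infinity α β → OnCurve P
          on-curve (k , e) = ∞ᶠ 2 , infinite , k , trans e (cong (k ⊡_) (sym v∞≡))

-- The conic in the Bruck-Bose representation

conic-point : ∀ {q} → 2 ≤ q → (F : FiniteField q) (Q : TernaryQuadraticForm F) → ∃ λ P → TernaryQuadraticForm.zeros Q P
conic-point {suc zero} (s≤s ())
conic-point {suc (suc m)} _ F Q = Chevalley.rational-point (s≤s z≤n) F Q

module Twist {q : ℕ} (primePower : PrimePower q) (2≤q : 2 ≤ q) (E : CubicExtension q)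
  (σ : FiniteField.Carrier (CubicExtension.F E) → FiniteField.Carrier (CubicExtension.K E))
  (σ-homo : IsRingHomomorphism (FiniteField.rawRing (CubicExtension.F E)) (FiniteField.rawRing (CubicExtension.K E)) σ) where
  open TraceTheory primePower 2≤q E
  open ≡-Reasoning
  module σ = IsRingHomomorphism σ-homo
  module Map = HomTheory {A = F} {B = K} σ σ.+-homo σ.*-homo σ.0#-homo

  private
    lift : ∀ a → ∃ λ b → embed b ≡ σ a
    lift a = fixed⇒embedded (trans (sym (homo-^ σ-homo a q)) (cong σ (𝔽.fermat a)))

  -- The values of σ are fixed by Frobenius because a^q = a in F, so they lie in the image of
  -- `embed`. Thus σ is `embed` after an automorphism of F.
  τ : 𝔽.Carrier → 𝔽.Carrier
  τ a = proj₁ (lift a)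

  embed-τ : ∀ a → embed (τ a) ≡ σ a
  embed-τ a = proj₂ (lift a)

  τ-injective : Injective _≡_ _≡_ τ
  τ-injective {a} {b} e = homo-injective σ-homo (trans (sym (embed-τ a)) (trans (cong embed e) (embed-τ b)))

  τ-surjective : ∀ b → ∃ λ a → τ a ≡ b
  τ-surjective = injective⇒surjective 𝔽.enumeration 𝔽.enumeration τ τ-injective

  τ-* : ∀ a b → τ (a 𝔽.* b) ≡ τ a 𝔽.* τ b
  τ-* a b = embed-injective (trans (embed-τ (a 𝔽.* b)) (trans (σ.*-homo a b) (trans (sym (cong₂ _*_ (embed-τ a) (embed-τ b))) (sym (*-homo (τ a) (τ b))))))

  τ-0 : τ 𝔽.0# ≡ 𝔽.0#
  τ-0 = embed-injective (trans (embed-τ 𝔽.0#) (trans σ.0#-homo (sym 0#-homo)))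

  τ-1 : τ 𝔽.1# ≡ 𝔽.1#
  τ-1 = embed-injective (trans (embed-τ 𝔽.1#) (trans σ.1#-homo (sym 1#-homo)))

  τ-^ : ∀ a k → τ (a 𝔽.^ᶠ k) ≡ τ a 𝔽.^ᶠ k
  τ-^ a zero = τ-1
  τ-^ a (suc k) = trans (τ-* a (a 𝔽.^ᶠ k)) (cong (τ a 𝔽.*_) (τ-^ a k))

  τᵛ : ∀ {n} → VF.V n → VF.V n
  τᵛ = map τ

  ext-τᵛ : ∀ {n} (v : VF.V n) → ext (τᵛ v) ≡ map σ v
  ext-τᵛ v = trans (sym (Vec.map-∘ embed τ v)) (Vec.map-cong embed-τ v)

  τᵛ-⊡ : ∀ {n} c (v : VF.V n) → τᵛ (c VF.⊡ v) ≡ τ c VF.⊡ τᵛ v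
  τᵛ-⊡ c [] = refl
  τᵛ-⊡ c (x ∷ v) = cong₂ _∷_ (τ-* c x) (τᵛ-⊡ c v)

  τᵛ-𝟎 : ∀ {n} → τᵛ (VF.𝟎 {n}) ≡ VF.𝟎
  τᵛ-𝟎 {n} = trans (Vec.map-replicate τ 𝔽.0# n) (cong (replicate n) τ-0)

  τᵛ-injective : ∀ {n} → Injective _≡_ _≡_ (τᵛ {n})
  τᵛ-injective {x = []} {[]} e = refl
  τᵛ-injective {x = x ∷ u} {y ∷ v} e = cong₂ _∷_ (τ-injective (cong head e)) (τᵛ-injective (cong tail e))

  τᵛ-surjective : ∀ {n} (v : VF.V n) → ∃ λ u → τᵛ u ≡ v
  τᵛ-surjective [] = [] , refl
  τᵛ-surjective (x ∷ v) = let a , e = τ-surjective x ; u , e′ = τᵛ-surjective v in a ∷ u , cong₂ _∷_ e e′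

  τᵛ-powers : ∀ n θ → τᵛ (tabulate {n = n} (λ i → θ 𝔽.^ᶠ toℕ i)) ≡ tabulate (λ i → τ θ 𝔽.^ᶠ toℕ i)
  τᵛ-powers n θ = trans (sym (Vec.tabulate-∘ τ (λ i → θ 𝔽.^ᶠ toℕ i))) (Vec.tabulate-cong (λ i → τ-^ θ (toℕ i)))

  τᵛ-∞ : ∀ n → τᵛ (replicate n 𝔽.0# ∷ʳ 𝔽.1#) ≡ replicate n 𝔽.0# ∷ʳ 𝔽.1#
  τᵛ-∞ n = trans (Vec.map-∷ʳ τ 𝔽.1# (replicate n 𝔽.0#)) (cong₂ _∷ʳ_ τᵛ-𝟎 τ-1)

  -- An automorphism of F moves only the parameter, so the standard curve is mapped to itself.
  τᵛ-standard : ∀ {n y} → StandardNRC F n y → StandardNRC F n (τᵛ y)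
  τᵛ-standard {n} (finite θ) = subst (StandardNRC F n) (sym (τᵛ-powers (suc n) θ)) (finite (τ θ))
  τᵛ-standard {n} infinite = subst (StandardNRC F n) (sym (τᵛ-∞ n)) infinite

  standard-τᵛ : ∀ {n y} → StandardNRC F n y → ∃ λ x → StandardNRC F n x × τᵛ x ≡ y
  standard-τᵛ {n} (finite θ) = let η , e = τ-surjective θ in
    _ , finite η , trans (τᵛ-powers (suc n) η) (Vec.tabulate-cong (λ i → cong (𝔽._^ᶠ toℕ i) e))
  standard-τᵛ {n} infinite = _ , infinite , τᵛ-∞ n

  -- Spanning, unlike independence, passes directly from F to K: the unit vectors are combinations
  -- of M over F, and applying σ exhibits them as combinations over K.
  map-independent : (M : Vec (VF.V 3) 3) → LinearlyIndependent F M → LinearlyIndependent K (map (map σ) M)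
  map-independent M M-independent = spanning⇒independent N λ { (x ∷ y ∷ z ∷ []) →
    let u₀ , e₀ = in-span (𝔽.1# ∷ 𝔽.0# ∷ 𝔽.0# ∷ [])
        u₁ , e₁ = in-span (𝔽.0# ∷ 𝔽.1# ∷ 𝔽.0# ∷ [])
        u₂ , e₂ = in-span (𝔽.0# ∷ 𝔽.0# ∷ 𝔽.1# ∷ [])
    in x ⊡ u₀ ⊞ (y ⊡ u₁ ⊞ z ⊡ u₂) , (begin
      comb N (x ⊡ u₀ ⊞ (y ⊡ u₁ ⊞ z ⊡ u₂))
        ≡⟨ trans (⊞-homo (x ⊡ u₀) (y ⊡ u₁ ⊞ z ⊡ u₂)) (cong₂ _⊞_ (⊡-homo x u₀) (trans (⊞-homo (y ⊡ u₁) (z ⊡ u₂)) (cong₂ _⊞_ (⊡-homo y u₁) (⊡-homo z u₂)))) ⟩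
      x ⊡ comb N u₀ ⊞ (y ⊡ comb N u₁ ⊞ z ⊡ comb N u₂)
        ≡⟨ cong₂ (λ a b → x ⊡ a ⊞ b) (trans e₀ (triple σ.1#-homo σ.0#-homo σ.0#-homo))
             (cong₂ (λ a b → y ⊡ a ⊞ z ⊡ b) (trans e₁ (triple σ.0#-homo σ.1#-homo σ.0#-homo)) (trans e₂ (triple σ.0#-homo σ.0#-homo σ.1#-homo))) ⟩
      x ⊡ (1# ∷ 0# ∷ 0# ∷ []) ⊞ (y ⊡ (0# ∷ 1# ∷ 0# ∷ []) ⊞ z ⊡ (0# ∷ 0# ∷ 1# ∷ []))
        ≡⟨ triple (solve 3 (λ x y z → x ⊗ 𝟙 ⊕ (y ⊗ 𝟘 ⊕ z ⊗ 𝟘) ⊜ x) refl x y z)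
                  (solve 3 (λ x y z → x ⊗ 𝟘 ⊕ (y ⊗ 𝟙 ⊕ z ⊗ 𝟘) ⊜ y) refl x y z)
                  (solve 3 (λ x y z → x ⊗ 𝟘 ⊕ (y ⊗ 𝟘 ⊕ z ⊗ 𝟙) ⊜ z) refl x y z) ⟩
      x ∷ y ∷ z ∷ [] ∎) }
    where
    N = map (map σ) M
    open IsLinear (comb-linear N)
    triple : ∀ {a b c a′ b′ c′ : Carrier} → a ≡ a′ → b ≡ b′ → c ≡ c′ → a ∷ b ∷ c ∷ [] ≡ a′ ∷ b′ ∷ c′ ∷ []
    triple refl refl refl = refl
    in-span : ∀ u → Span K N (map σ u)
    in-span u = let cs , e = VF.independent⇒spanning M M-independent u in
      map σ cs , trans (sym (Map.map-comb M cs)) (cong (map σ) e)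

module Assembly {q : ℕ} (primePower : PrimePower q) (2≤q : 2 ≤ q) (E : CubicExtension q)
  (Σ∞ : Point (CubicExtension.F E) 6) (𝓢 : RegularSpread E Σ∞)
  (ℓ∞ : Point (CubicExtension.K E) 2) (rep : Representation E Σ∞ 𝓢 ℓ∞)
  (π : Subplane (PG2 (CubicExtension.K E)) q) (tangent : Tangent (PG2 (CubicExtension.K E)) π ℓ∞)
  (C : Pred (Point (CubicExtension.K E) 2) 0ℓ) (conic : IsConicOf E π C) where
  open TraceTheory primePower 2≤q E
  open Representation rep
  open IsConicOf conic renaming (coordinates to frame)
  open RegularSpread 𝓢

  𝓒 : Coordinates Σ∞ 𝓢
  𝓒 = coordinates Σ∞ 𝓢

  open Coordinates 𝓒
  open BruckBosePlane primePower 2≤q E Σ∞ 𝓢 𝓒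
  open ConjugateWindows primePower 2≤q E
  open ≡-Reasoning

  private
    module Iso = Isomorphism isomorphism
    module Frame = Isomorphism frame

  image-point : Point F 2 → Point K 2
  image-point P = proj₁ (Frame.point↦ P)

  ψ : Point F 2 → Point K 2
  ψ P = Φ (Iso.point↦ (image-point P))

  ψ* : Point F 2 → Point K 2
  ψ* ℓ = proj₁ (line-coordinates (Iso.line↦ (proj₁ (Frame.line↦ ℓ))))

  ψ-incidence : ∀ ℓ P → dot F (coords ℓ) (coords P) ≡ 𝔽.0# ⇔ dot K (coords (ψ* ℓ)) (coords (ψ P)) ≡ 0#
  ψ-incidence ℓ P = proj₂ (line-coordinates (Iso.line↦ (proj₁ (Frame.line↦ ℓ)))) (Iso.point↦ (image-point P))
    ⇔-∘ (Iso.incidence (image-point P) (proj₁ (Frame.line↦ ℓ)) ⇔-∘ Frame.incidence P ℓ)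

  ≈line∞⇒≡ : ∀ ℓ → _≈ᴸ_ E Σ∞ 𝓢 ℓ line∞ → ℓ ≡ line∞
  ≈line∞⇒≡ line∞ _ = refl

  ψ-infinite : ∀ P → third (coords (ψ P)) ≡ 0# ⇔ onHyperplane K ℓ∞ (image-point P)
  ψ-infinite P = mk⇔
    (λ e → Equivalence.from (Iso.incidence (image-point P) ℓ∞)
      (subst (_Iᴮ_ E Σ∞ 𝓢 (Iso.point↦ (image-point P))) (sym ℓ≡) (Equivalence.from (line∞-coordinates (Iso.point↦ (image-point P))) e)))
    (λ e → Equivalence.to (line∞-coordinates (Iso.point↦ (image-point P)))
      (subst (_Iᴮ_ E Σ∞ 𝓢 (Iso.point↦ (image-point P))) ℓ≡ (Equivalence.to (Iso.incidence (image-point P) ℓ∞) e)))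
    where
    ℓ≡ = ≈line∞⇒≡ (Iso.line↦ ℓ∞) infinity

  private
    T : Point K 2
    T = proj₁ (Bijection.to tangent zero)

    T∈π : Subplane.inPlane π T
    T∈π = proj₁ (proj₂ (Bijection.to tangent zero))

    T∈ℓ∞ : onHyperplane K ℓ∞ T
    T∈ℓ∞ = proj₂ (proj₂ (Bijection.to tangent zero))

    T-unique : ∀ X → Subplane.inPlane π X → onHyperplane K ℓ∞ X → Setoid._≈_ (pointSetoid K 2) T X
    T-unique X X∈π X∈ℓ∞ with Bijection.strictlySurjective tangent (X , X∈π , X∈ℓ∞)
    ... | zero , e = e

  tangent-point : Point F 2
  tangent-point = proj₁ (Bijection.strictlySurjective Frame.onPoints (T , T∈π))

  private
    tangent-point≈T : Setoid._≈_ (pointSetoid K 2) (image-point tangent-point) T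
    tangent-point≈T = proj₂ (Bijection.strictlySurjective Frame.onPoints (T , T∈π))

  ψ-tangent-point : third (coords (ψ tangent-point)) ≡ 0#
  ψ-tangent-point = Equivalence.from (ψ-infinite tangent-point) (on tangent-point≈T)
    where
    on : Setoid._≈_ (pointSetoid K 2) (image-point tangent-point) T → onHyperplane K ℓ∞ (image-point tangent-point)
    on (c , _ , e) = trans (cong (coords ℓ∞ ∙_) e) (trans (∙-⊡ (coords ℓ∞) c (coords T)) (trans (cong (c *_) T∈ℓ∞) (zeroʳ c)))

  ψ-tangent-unique : ∀ P → third (coords (ψ P)) ≡ 0# → _~_ F (coords P) (coords tangent-point)
  ψ-tangent-unique P e = Bijection.injective Frame.onPoints (Setoid.trans (pointSetoid K 2) {image-point P} {T} {image-point tangent-point}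
    (Setoid.sym (pointSetoid K 2) {T} {image-point P} (T-unique (image-point P) (proj₂ (Frame.point↦ P)) (Equivalence.to (ψ-infinite P) e)))
    (Setoid.sym (pointSetoid K 2) {image-point tangent-point} {T} tangent-point≈T))

  represented : ∀ Q → ⟦ C ⟧ Q ⇔ (∃ λ P → TernaryQuadraticForm.zeros form P × Θ (coords Q) ∝ coords (ψ P))
  represented Q = mk⇔
    (λ (X , X∈C , Q∈X) → let P , P∈form , X≈P = proj₁ image X∈C in
      P , P∈form , Equivalence.to (pointsOf⇔ (Iso.point↦ (image-point P)) Q) (proj₁ (Bijection.cong Iso.onPoints X≈P) Q∈X))
    (λ (P , P∈form , m) → image-point P , proj₂ image (P , P∈form , Setoid.refl (pointSetoid K 2) {image-point P}) ,
      Equivalence.from (pointsOf⇔ (Iso.point↦ (image-point P)) Q) m)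

  Conclusion : Set₁
  Conclusion =
    (∃ λ (N₆ : Pred (Point F 6) 0ℓ) → IsNormalRationalCurve F 6 N₆ × ⟦ C ⟧ ≐ N₆)
    ⊎
    (∃ λ (N₄ : Pred (Point F 6) 0ℓ) → ∃ λ (X : Point K 6) →
       IsNormalRationalCurve F 4 N₄ × points K g X × ⟦ C ⟧ ≐ (N₄ ∪ spreadPlane X))

  module Semilinear (A : Vec (V 3) 3) (A-independent : LinearlyIndependent K A)
    (σ : 𝔽.Carrier → Carrier) (σ-homo : IsRingHomomorphism (FiniteField.rawRing F) (FiniteField.rawRing K) σ)
    (ψ~ : ∀ P → _~_ K (coords (ψ P)) (comb A (map σ (coords P)))) where
    open Twist primePower 2≤q E σ σ-homo
    open ConicTheory F form
    open TernaryQuadraticForm form using (value)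

    module Parametrised (m₀ m₁ m₂ : VF.V 3) (M-independent : LinearlyIndependent F (m₀ ∷ m₁ ∷ m₂ ∷ []))
      (sound : ∀ {y} → StandardNRC F 2 y → value (VF.comb (m₀ ∷ m₁ ∷ m₂ ∷ []) y) ≡ 𝔽.0#)
      (complete : ∀ x → x ≢ VF.𝟎 → value x ≡ 𝔽.0# → ∃ λ y → StandardNRC F 2 y × _~_ F x (VF.comb (m₀ ∷ m₁ ∷ m₂ ∷ []) y)) where

      M : Vec (VF.V 3) 3
      M = m₀ ∷ m₁ ∷ m₂ ∷ []

      a₀ a₁ a₂ : V 3
      a₀ = comb A (map σ m₀)
      a₁ = comb A (map σ m₁)
      a₂ = comb A (map σ m₂)

      -- The matrix A σ(M). Its rows are the coefficients of the forms X, Y and L; its argument is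
      -- the parameter vector twisted by τ.
      B : Vec (V 3) 3
      B = a₀ ∷ a₁ ∷ a₂ ∷ []

      B-comb : ∀ x → comb B x ≡ comb A (comb (map (map σ) M) x)
      B-comb x = sym (comb-map (comb-linear A) (map (map σ) M) x)

      B-independent : LinearlyIndependent K B
      B-independent x e = map-independent M M-independent x (A-independent (comb (map (map σ) M) x) (trans (sym (B-comb x)) e))

      B-τ : ∀ x → comb B (ext (τᵛ x)) ≡ comb A (map σ (VF.comb M x))
      B-τ x = trans (cong (comb B) (ext-τᵛ x)) (trans (B-comb (map σ x)) (cong (comb A) (sym (Map.map-comb M x))))

      open NormalCurves primePower 2≤q E Σ∞ 𝓢 𝓒 using (OnCurve; third-comb; module OffConic; module OnConic)

      Curve : Pred (Point F 6) 0ℓ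
      Curve = OnCurve a₀ a₁ a₂ B-independent

      standard-nonzero : ∀ {y} → StandardNRC F 2 y → y ≢ VF.𝟎
      standard-nonzero (finite θ) e = 𝔽.1≢0 (cong head e)
      standard-nonzero infinite e = 𝔽.1≢0 (cong (head ∘ tail ∘ tail) e)

      ψ-multiple : ∀ P x c → coords P ≡ c VF.⊡ VF.comb M x → coords (ψ P) ∝ comb B (ext (τᵛ x))
      ψ-multiple P x c e = multiply (ψ~ P)
        where
        multiply : _~_ K (coords (ψ P)) (comb A (map σ (coords P))) → coords (ψ P) ∝ comb B (ext (τᵛ x))
        multiply (d , _ , ψP≡) = d * σ c , (begin
          coords (ψ P) ≡⟨ ψP≡ ⟩
          d ⊡ comb A (map σ (coords P)) ≡⟨ cong (λ v → d ⊡ comb A (map σ v)) e ⟩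
          d ⊡ comb A (map σ (c VF.⊡ VF.comb M x)) ≡⟨ cong (λ v → d ⊡ comb A v) (Map.map-⊡ c (VF.comb M x)) ⟩
          d ⊡ comb A (σ c ⊡ map σ (VF.comb M x)) ≡⟨ cong (d ⊡_) (IsLinear.⊡-homo (comb-linear A) (σ c) (map σ (VF.comb M x))) ⟩
          d ⊡ (σ c ⊡ comb A (map σ (VF.comb M x))) ≡⟨ ⊡-assoc d (σ c) (comb A (map σ (VF.comb M x))) ⟨
          (d * σ c) ⊡ comb A (map σ (VF.comb M x)) ≡⟨ cong ((d * σ c) ⊡_) (B-τ x) ⟨
          (d * σ c) ⊡ comb B (ext (τᵛ x)) ∎)

      M-point : ∀ x → x ≢ VF.𝟎 → Point F 2
      M-point x x≢𝟎 = point (VF.comb M x) (x≢𝟎 ∘ M-independent x)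

      ψ-M : ∀ x (x≢𝟎 : x ≢ VF.𝟎) → comb B (ext (τᵛ x)) ∝ coords (ψ (M-point x x≢𝟎))
      ψ-M x x≢𝟎 = invert (ψ~ (M-point x x≢𝟎))
        where
        invert : _~_ K (coords (ψ (M-point x x≢𝟎))) (comb A (map σ (VF.comb M x))) → comb B (ext (τᵛ x)) ∝ coords (ψ (M-point x x≢𝟎))
        invert (d , d≢0 , e) = let u , ud≡1 = invertible d d≢0 in u , (begin
          comb B (ext (τᵛ x)) ≡⟨ B-τ x ⟩
          comb A (map σ (VF.comb M x)) ≡⟨ ⊡-inverse ud≡1 (comb A (map σ (VF.comb M x))) ⟨
          u ⊡ (d ⊡ comb A (map σ (VF.comb M x))) ≡⟨ cong (u ⊡_) e ⟨
          u ⊡ coords (ψ (M-point x x≢𝟎)) ∎)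

      ⟦C⟧≐Curve : ⟦ C ⟧ ≐ Curve
      ⟦C⟧≐Curve = (λ {Q} → to Q ∘ Equivalence.to (represented Q)) , (λ {Q} → Equivalence.from (represented Q) ∘ from Q)
        where
        to : ∀ Q → (∃ λ P → TernaryQuadraticForm.zeros form P × ∃ λ k → Θ (coords Q) ≡ k ⊡ coords (ψ P)) → Curve Q
        to Q (P , P∈form , k , ΘQ≡) =
          let y , std , c , _ , P≡ = complete (coords P) (nonzero P) P∈form
              j , ψP≡ = ψ-multiple P y c P≡
          in τᵛ y , τᵛ-standard std , k * j , trans ΘQ≡ (trans (cong (k ⊡_) ψP≡) (sym (⊡-assoc k j (comb B (ext (τᵛ y))))))
        from : ∀ Q → Curve Q → ∃ λ P → TernaryQuadraticForm.zeros form P × Θ (coords Q) ∝ coords (ψ P)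
        from Q (y , std , k , ΘQ≡) =
          let x , std′ , τx≡y = standard-τᵛ std
              x≢𝟎 = standard-nonzero std′
              j , e = ψ-M x x≢𝟎
          in M-point x x≢𝟎 , sound std′ , k * j ,
             trans ΘQ≡ (trans (cong (k ⊡_) (trans (cong (comb B ∘ ext) (sym τx≡y)) e)) (sym (⊡-assoc k j (coords (ψ (M-point x x≢𝟎))))))

      l∞ : V 3
      l∞ = third a₀ ∷ third a₁ ∷ third a₂ ∷ []

      -- r is the tangent point in the coordinates of M. The factor d is there because the
      -- parametrisation gives its base point only up to a scalar.
      module _ (r : VF.V 3) (d : 𝔽.Carrier) (d≢0 : d ≢ 𝔽.0#) (r≡ : VF.comb M r ≡ d VF.⊡ coords tangent-point) where
        on-l∞ : l∞ ∙ ext (τᵛ r) ≡ 0#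
        on-l∞ = trans (sym (third-comb a₀ a₁ a₂ B-independent (ext (τᵛ r)))) (trans (cong third (B-τ r)) (vanish (ψ~ tangent-point)))
          where
          vanish : _~_ K (coords (ψ tangent-point)) (comb A (map σ (coords tangent-point))) → third (comb A (map σ (VF.comb M r))) ≡ 0#
          vanish (c , c≢0 , e) = begin
            third (comb A (map σ (VF.comb M r))) ≡⟨ cong (λ v → third (comb A (map σ v))) r≡ ⟩
            third (comb A (map σ (d VF.⊡ coords tangent-point))) ≡⟨ cong (λ v → third (comb A v)) (Map.map-⊡ d (coords tangent-point)) ⟩
            third (comb A (σ d ⊡ map σ (coords tangent-point))) ≡⟨ trans (cong third (IsLinear.⊡-homo (comb-linear A) (σ d) (map σ (coords tangent-point)))) (third-⊡ (σ d) (comb A (map σ (coords tangent-point)))) ⟩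
            σ d * third (comb A (map σ (coords tangent-point))) ≡⟨ cong (σ d *_) (*-zero-divisor c≢0 (trans (sym (third-⊡ c (comb A (map σ (coords tangent-point))))) (trans (cong third (sym e)) ψ-tangent-point))) ⟩
            σ d * 0# ≡⟨ zeroʳ (σ d) ⟩
            0# ∎

        -- Every x over F is τ applied to some u. If l∞ kills x, the point M u is at infinity, so it
        -- is the tangent point, and injectivity of M makes u a multiple of r.
        tangency : Tangency l∞ (τᵛ r)
        tangency x lx≡0 = from-preimage (τᵛ-surjective x)
          where
          from-preimage : (∃ λ u → τᵛ u ≡ x) → ∃ λ c → x ≡ c VF.⊡ τᵛ r
          from-preimage (u , τu≡x) = by-case (u VF.≟ᵛ VF.𝟎)
            where
            by-case : Dec (u ≡ VF.𝟎) → ∃ λ c → x ≡ c VF.⊡ τᵛ r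
            by-case (yes u≡𝟎) = 𝔽.0# , trans (sym τu≡x) (trans (cong τᵛ u≡𝟎) (trans τᵛ-𝟎 (sym (VF.⊡-zeroˡ (τᵛ r)))))
            by-case (no u≢𝟎) = conclude (ψ-tangent-unique (M-point u u≢𝟎) (third-zero (ψ~ (M-point u u≢𝟎))))
              where
              third-zero : _~_ K (coords (ψ (M-point u u≢𝟎))) (comb A (map σ (VF.comb M u))) → third (coords (ψ (M-point u u≢𝟎))) ≡ 0#
              third-zero (c , _ , e) = trans (cong third e) (trans (third-⊡ c (comb A (map σ (VF.comb M u)))) (trans (cong (c *_) (begin
                third (comb A (map σ (VF.comb M u))) ≡⟨ cong third (B-τ u) ⟨
                third (comb B (ext (τᵛ u))) ≡⟨ third-comb a₀ a₁ a₂ B-independent (ext (τᵛ u)) ⟩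
                l∞ ∙ ext (τᵛ u) ≡⟨ cong (λ v → l∞ ∙ ext v) τu≡x ⟩
                l∞ ∙ ext x ≡⟨ lx≡0 ⟩
                0# ∎)) (zeroʳ c)))
              conclude : _~_ F (VF.comb M u) (coords tangent-point) → ∃ λ c → x ≡ c VF.⊡ τᵛ r
              conclude (c , _ , Mu≡) = let v , vd≡1 = 𝔽.invertible d d≢0 in
                τ (c 𝔽.* v) , trans (sym τu≡x) (trans (cong τᵛ (VF.independent⇒injective M M-independent (begin
                  VF.comb M u ≡⟨ Mu≡ ⟩
                  c VF.⊡ coords tangent-point ≡⟨ cong (c VF.⊡_) (VF.⊡-inverse vd≡1 (coords tangent-point)) ⟨
                  c VF.⊡ v VF.⊡ d VF.⊡ coords tangent-point ≡⟨ cong (λ w → c VF.⊡ v VF.⊡ w) r≡ ⟨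
                  c VF.⊡ v VF.⊡ VF.comb M r ≡⟨ VF.⊡-assoc c v (VF.comb M r) ⟨
                  (c 𝔽.* v) VF.⊡ VF.comb M r ≡⟨ VF.IsLinear.⊡-homo (VF.comb-linear M) (c 𝔽.* v) r ⟨
                  VF.comb M ((c 𝔽.* v) VF.⊡ r) ∎))) (τᵛ-⊡ (c 𝔽.* v) r))

      tangent-on-conic : ∀ c → c ≢ 𝔽.0# → VF.comb M (𝔽.0# ∷ 𝔽.0# ∷ 𝔽.1# ∷ []) ≡ c VF.⊡ coords tangent-point → Conclusion
      tangent-on-conic c c≢0 e = conclude OC.curve₄
        where
        ∞₂ : VF.V 3
        ∞₂ = 𝔽.0# ∷ 𝔽.0# ∷ 𝔽.1# ∷ []
        module OC = OnConic a₀ a₁ a₂ B-independent (subst (Tangency l∞) (τᵛ-∞ 2) (tangency ∞₂ c c≢0 e))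
                                                   (subst (λ p → l∞ ∙ ext p ≡ 0#) (τᵛ-∞ 2) (on-l∞ ∞₂ c c≢0 e))
        conclude : _ → Conclusion
        conclude (N₄ , X , N₄-curve , X∈g , ⊑ , ⊒) =
          inj₂ (N₄ , X , N₄-curve , X∈g , (λ {Q} Q∈C → ⊑ {Q} (proj₁ ⟦C⟧≐Curve Q∈C)) , (λ {Q} Q∈N → proj₂ ⟦C⟧≐Curve (⊒ {Q} Q∈N)))

      -- Every solution of r₁² = r₀ r₂ is a multiple of a standard vector: of (0, 0, 1) if r₀ = 0,
      -- and otherwise of the one with parameter r₁ / r₀. Its contrapositive supplies the inequality
      -- needed off the conic.
      value-zero : ∀ r₀ r₁ r₂ → r₁ 𝔽.* r₁ ≡ r₀ 𝔽.* r₂ → value (VF.comb M (r₀ ∷ r₁ ∷ r₂ ∷ [])) ≡ 𝔽.0#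
      value-zero r₀ r₁ r₂ e = by-case (r₀ 𝔽.≟ 𝔽.0#)
        where
        scaled : ∀ c {y} → StandardNRC F 2 y → r₀ ∷ r₁ ∷ r₂ ∷ [] ≡ c VF.⊡ y → value (VF.comb M (r₀ ∷ r₁ ∷ r₂ ∷ [])) ≡ 𝔽.0#
        scaled c {y} std e = trans (cong value (trans (cong (VF.comb M) e) (VF.IsLinear.⊡-homo (VF.comb-linear M) c y)))
          (trans (value-⊡ c (VF.comb M y)) (trans (cong (c 𝔽.* c 𝔽.*_) (sound std)) (𝔽.zeroʳ (c 𝔽.* c))))
        by-case : Dec (r₀ ≡ 𝔽.0#) → value (VF.comb M (r₀ ∷ r₁ ∷ r₂ ∷ [])) ≡ 𝔽.0#
        by-case (yes r₀≡0) = scaled r₂ infinite (cong₂ _∷_ (trans r₀≡0 (sym (𝔽.zeroʳ r₂))) (cong₂ _∷_ (trans r₁≡0 (sym (𝔽.zeroʳ r₂))) (cong₂ _∷_ (sym (𝔽.*-identityʳ r₂)) refl)))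
          where
          r₁≡0 : r₁ ≡ 𝔽.0#
          r₁≡0 = 𝔽.zero-^ 2 (trans (cong (r₁ 𝔽.*_) (𝔽.*-identityʳ r₁)) (trans e (trans (cong (𝔽._* r₂) r₀≡0) (𝔽.zeroˡ r₂))))
        by-case (no r₀≢0) = with-inverse (𝔽.invertible r₀ r₀≢0)
          where
          with-inverse : (∃ λ u → u 𝔽.* r₀ ≡ 𝔽.1#) → value (VF.comb M (r₀ ∷ r₁ ∷ r₂ ∷ [])) ≡ 𝔽.0#
          with-inverse (u , ur₀≡1) = scaled r₀ (finite (u 𝔽.* r₁)) (cong₂ _∷_ (sym (𝔽.*-identityʳ r₀)) (cong₂ _∷_ r₁≡ (cong₂ _∷_ r₂≡ refl)))
            where
            r₁≡ : r₁ ≡ r₀ 𝔽.* ((u 𝔽.* r₁) 𝔽.* 𝔽.1#)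
            r₁≡ = sym (trans (𝔽.solve 3 (λ r u s → r ⊗ ((u ⊗ s) ⊗ 𝟙) ⊜ (u ⊗ r) ⊗ s) refl r₀ u r₁)
              (trans (cong (𝔽._* r₁) ur₀≡1) (𝔽.*-identityˡ r₁)))
            r₂≡ : r₂ ≡ r₀ 𝔽.* ((u 𝔽.* r₁) 𝔽.* ((u 𝔽.* r₁) 𝔽.* 𝔽.1#))
            r₂≡ = sym (begin
              r₀ 𝔽.* ((u 𝔽.* r₁) 𝔽.* ((u 𝔽.* r₁) 𝔽.* 𝔽.1#)) ≡⟨ 𝔽.solve 3 (λ r u s → r ⊗ ((u ⊗ s) ⊗ ((u ⊗ s) ⊗ 𝟙)) ⊜ (u ⊗ r) ⊗ (u ⊗ (s ⊗ s))) refl r₀ u r₁ ⟩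
              (u 𝔽.* r₀) 𝔽.* (u 𝔽.* (r₁ 𝔽.* r₁)) ≡⟨ cong (λ s → (u 𝔽.* r₀) 𝔽.* (u 𝔽.* s)) e ⟩
              (u 𝔽.* r₀) 𝔽.* (u 𝔽.* (r₀ 𝔽.* r₂)) ≡⟨ 𝔽.solve 3 (λ r u t → (u ⊗ r) ⊗ (u ⊗ (r ⊗ t)) ⊜ (u ⊗ r) ⊗ ((u ⊗ r) ⊗ t)) refl r₀ u r₂ ⟩
              (u 𝔽.* r₀) 𝔽.* ((u 𝔽.* r₀) 𝔽.* r₂) ≡⟨ cong (λ s → s 𝔽.* (s 𝔽.* r₂)) ur₀≡1 ⟩
              𝔽.1# 𝔽.* (𝔽.1# 𝔽.* r₂) ≡⟨ trans (𝔽.*-identityˡ _) (𝔽.*-identityˡ r₂) ⟩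
              r₂ ∎)

      tangent-off-conic : value (coords tangent-point) ≢ 𝔽.0# → Conclusion
      tangent-off-conic value≢0 = from-coordinates (VF.independent⇒spanning M M-independent (coords tangent-point))
        where
        from-coordinates : Span F M (coords tangent-point) → Conclusion
        from-coordinates (r₀ ∷ r₁ ∷ r₂ ∷ [] , e) = inj₁ (Curve , O.curve₆ , ⟦C⟧≐Curve)
          where
          r : VF.V 3
          r = r₀ ∷ r₁ ∷ r₂ ∷ []
          e′ : VF.comb M r ≡ 𝔽.1# VF.⊡ coords tangent-point
          e′ = trans e (sym (VF.⊡-identity (coords tangent-point)))
          r≢𝟎 : r ≢ VF.𝟎
          r≢𝟎 r≡𝟎 = nonzero tangent-point (trans (sym e) (trans (cong (VF.comb M) r≡𝟎) (VF.IsLinear.𝟎-homo (VF.comb-linear M))))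
          off : τ r₁ 𝔽.* τ r₁ ≢ τ r₀ 𝔽.* τ r₂
          off τ-relation = value≢0 (trans (cong value (sym e)) (value-zero r₀ r₁ r₂ (τ-injective (trans (τ-* r₁ r₁) (trans τ-relation (sym (τ-* r₀ r₂)))))))
          module O = OffConic a₀ a₁ a₂ B-independent (τᵛ r) (λ τr≡𝟎 → r≢𝟎 (τᵛ-injective (trans τr≡𝟎 (sym τᵛ-𝟎))))
            (tangency r 𝔽.1# 𝔽.1≢0 e′) (on-l∞ r 𝔽.1# 𝔽.1≢0 e′) off

    conclusion : Conclusion
    conclusion = by-case (value (coords tangent-point) 𝔽.≟ 𝔽.0#)
      where
      on : Parametrisation (coords tangent-point) → Conclusion
      on record { matrix = m₀ ∷ m₁ ∷ m₂ ∷ [] ; independent = ind ; ∞↦R = c , c≢0 , e ; sound = sound ; complete = complete } =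
        Parametrised.tangent-on-conic m₀ m₁ m₂ ind sound complete c c≢0 e
      off : ∀ {R} → value (coords tangent-point) ≢ 𝔽.0# → Parametrisation R → Conclusion
      off value≢0 record { matrix = m₀ ∷ m₁ ∷ m₂ ∷ [] ; independent = ind ; sound = sound ; complete = complete } =
        Parametrised.tangent-off-conic m₀ m₁ m₂ ind sound complete value≢0
      by-case : Dec (value (coords tangent-point) ≡ 𝔽.0#) → Conclusion
      -- A tangent point on the conic serves as base point, so that it gets parameter ∞; otherwise
      -- the base point is the one from Chevalley's theorem.
      by-case (yes e) = on (parametrise nonDegenerate (nonzero tangent-point) e)
      by-case (no ne) = let R , fR≡0 = conic-point 2≤q F form in off ne (parametrise nonDegenerate (nonzero R) fR≡0)

  theorem : Conclusion
  theorem = let A , A-independent , σ , σ-homo , ψ~ = FundamentalTheorem.semilinear F K ψ ψ* ψ-incidence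
            in Semilinear.conclusion A A-independent σ σ-homo ψ~

theorem4p3 :
  (q : ℕ) → PrimePower q → 6 ≤ q →
  (E : CubicExtension q) →
  let open CubicExtension E in
  (Σ∞ : Point F 6) (𝓢 : RegularSpread E Σ∞) →
  let open RegularSpread 𝓢 in
  (ℓ∞ : Point K 2) (rep : Representation E Σ∞ 𝓢 ℓ∞) →
  let open Representation rep in
  (π : Subplane (PG2 K) q) → Tangent (PG2 K) π ℓ∞ →
  (C : Pred (Point K 2) 0ℓ) → IsConicOf E π C →
  (∃ λ (N₆ : Pred (Point F 6) 0ℓ) → IsNormalRationalCurve F 6 N₆ × ⟦ C ⟧ ≐ N₆)
  ⊎
  (∃ λ (N₄ : Pred (Point F 6) 0ℓ) → ∃ λ (X : Point K 6) →
     IsNormalRationalCurve F 4 N₄ × points K g X × ⟦ C ⟧ ≐ (N₄ ∪ spreadPlane X))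
theorem4p3 q primePower 6≤q E Σ∞ 𝓢 ℓ∞ rep π tangent C conic =
  Assembly.theorem primePower (ℕ.≤-trans (s≤s (s≤s z≤n)) 6≤q) E Σ∞ 𝓢 ℓ∞ rep π tangent C conic
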